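{- Let $n>k>t$ be positive integers with $n\geq 4(t+2)^2k^2$ and $k\geq 5$. Suppose that $\mathcal{F},\mathcal{G}\subset\binom{[n]}{k}$ are non-trivial cross $t$-intersecting families. Then \[ |\mathcal{F}||\mathcal{G}|\leq \max\left\{|\mathcal{A}(n,k,t)|^2,\ |\mathcal{H}(n,k,t)|^2\right\}. \]
   Context: $[n]=\{1,\dots,n\}$ and $\binom{[n]}{k}$ is the family of all $k$-element subsets of $[n]$; $[a,b]=\{a,a+1,\dots,b\}$. Two families $\mathcal{F},\mathcal{G}\subset\binom{[n]}{k}$ are cross $t$-intersecting if $|F\cap G|\geq t$ for all $F\in\mathcal{F},G\in\mathcal{G}$; they are non-trivial cross $t$-intersecting if moreover $|\bigcap\{F\colon F\in\mathcal{F}\}|<t$ and $|\bigcap\{G\colon G\in\mathcal{G}\}|<t$. Define $\mathcal{H}(n,k,t)=\{H\in\binom{[n]}{k}\colon [t]\subset H,\ H\cap[t+1,k+1]\neq\emptyset\}\cup\{[k+1]\setminus\{j\}\colon 1\leq j\leq t\}$ and $\mathcal{A}(n,k,t)=\{A\in\binom{[n]}{k}\colon |A\cap[t+2]|\geq t+1\}$. -}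

module Defs where

open import Data.Nat using (ℕ; zero; suc; _<ᵇ_; _≤ᵇ_; _≤_; _<_)
open import Data.Nat.Base using (_≡ᵇ_)
open import Data.Bool using (Bool; true; false; T; T?; _∧_; _∨_; not)
open import Data.Fin using (Fin; toℕ)
open import Data.Fin.Subset using (Subset; inside; outside; _∩_; ∣_∣; ⋂)
open import Data.Fin.Subset.Properties using (_⊆?_)
open import Data.List using (List; []; _∷_; [_]; _++_; map; filter; length; upTo)
open import Data.Bool.ListAction using (any)
open import Data.Vec using (Vec; tabulate; _∷_; [])
open import Data.Vec.Properties using (≡-dec)
import Data.Bool.Properties as BP
open import Relation.Nullary.Decidable using (⌊_⌋)

-- Ground set [n] = {1,…,n} is modelled by Fin n, element i ∈ [n] being the
-- Fin index i-1.  A subset of [n] is a Subset n (characteristic vector).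

allSubsets : (n : ℕ) → List (Subset n)
allSubsets zero = [ [] ]
allSubsets (suc n) = map (outside ∷_) (allSubsets n) ++ map (inside ∷_) (allSubsets n)

Family : ℕ → Set
Family n = Subset n → Bool

members : {n : ℕ} → Family n → List (Subset n)
members {n} F = filter (λ A → T? (F A)) (allSubsets n)

card : {n : ℕ} → Family n → ℕ
card F = length (members F)

IsKUniform : {n : ℕ} → ℕ → Family n → Set
IsKUniform k F = ∀ A → T (F A) → ∣ A ∣ ≡' k
  where open import Relation.Binary.PropositionalEquality renaming (_≡_ to _≡'_)

CrossIntersecting : {n : ℕ} → ℕ → Family n → Family n → Set
CrossIntersecting t F G = ∀ A B → T (F A) → T (G B) → t ≤ ∣ A ∩ B ∣

-- |⋂ {F : F ∈ 𝓕}| < t   (the intersection of the empty family is [n])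
NonTrivial : {n : ℕ} → ℕ → Family n → Set
NonTrivial t F = ∣ ⋂ (members F) ∣ < t

NonTrivialCrossIntersecting : {n : ℕ} → ℕ → Family n → Family n → Set
NonTrivialCrossIntersecting t F G =
  CrossIntersecting t F G × NonTrivial t F × NonTrivial t G
  where open import Data.Product using (_×_)

-- The interval [a,b] = {a,…,b} ⊆ [n]  (element i+1 ↔ Fin index i)
interval : {n : ℕ} → ℕ → ℕ → Subset n
interval a b = tabulate (λ i → (a ≤ᵇ suc (toℕ i)) ∧ (suc (toℕ i) ≤ᵇ b))

range : {n : ℕ} → ℕ → Subset n
range m = interval 1 m

-- The single element j ∈ [n] (as a subset); empty if j ∉ [n].
single : {n : ℕ} → ℕ → Subset n
single j = interval j j

_==_ : {n : ℕ} → Subset n → Subset n → Bool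
A == B = ⌊ ≡-dec BP._≟_ A B ⌋

_∖_ : {n : ℕ} → Subset n → Subset n → Subset n
X ∖ Y = Data.Vec.zipWith (λ x y → x ∧ not y) X Y
  where import Data.Vec

isK : {n : ℕ} → ℕ → Subset n → Bool
isK k A = ∣ A ∣ ≡ᵇ k

HFam : (n k t : ℕ) → Family n
HFam n k t H =
  (isK k H ∧ ⌊ range t ⊆? H ⌋ ∧ not (∣ H ∩ interval (suc t) (suc k) ∣ ≡ᵇ 0))
  ∨ any (λ j → H == (range (suc k) ∖ single j)) (map suc (upTo t))

AFam : (n k t : ℕ) → Family n
AFam n k t A = isK k A ∧ (suc t ≤ᵇ ∣ A ∩ range (suc (suc t)) ∣)

{-# OPTIONS --safe #-}
module Submission where

-- Call X a cover of a family if X meets each of its members in at least t elements, and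
-- write N(s) for the number of k-sets containing a given s-set.  After enlarging F and G
-- to a maximal pair, their members are exactly the k-element covers of each other, and
-- non-triviality says that no t-set is a cover.  If the least covers of F and G have t+r′
-- and t+r elements, then choosing a t-subset of a least cover of F and adding elements of
-- members of G one by one gives |F| ≤ C(t+r′,t) k^r N(t+r), and symmetrically for G, which
-- settles r + r′ ≥ 4.  Otherwise the (t+1)-element covers of F and of G matter: they meet
-- each other in at least t elements, and each such cover of G accounts for at most N(t+1)
-- members of F.  If one of the families has at most two of them, or two of them share only
-- t−1 elements, the product is too small.  In the remaining case three
-- covers of G either lie in a common (t+2)-set D, and then all members of F and G meet D in
-- t+1 elements as in 𝒜, or they share a t-set S.  In that last case a member of G missing
-- one element of S forces the members of F containing S to meet a fixed (k−t+1)-set; weighing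
-- the members of F containing S against the members of G not containing S bounds their number
-- by |ℋ|, so |F| + |G| ≤ 2|ℋ|.

open import Defs
open import Data.Bool using (Bool; true; false; T; T?; _∧_; _∨_; not; if_then_else_)
open import Data.Bool.Properties using (∧-zeroʳ; not-involutive)
open import Data.Empty using (⊥-elim)
open import Data.Fin using (Fin; zero; suc; toℕ)
open import Data.Fin.Subset using (Subset; ⊥; ⊤; ⋂; ⁅_⁆; inside; outside; _∩_; _∪_; ∁; ∣_∣; _⊆_)
open import Data.Fin.Subset.Properties using (∪-identityʳ; ∩-zeroˡ; ∩-comm; ∣⊥∣≡0; ∣⊤∣≡n; ∣⁅x⁆∣≡1; ∣∁p∣≡n∸∣p∣; _⊆?_; anySubset?)
open import Data.List using (List; []; _∷_; _++_; map; filter; length; upTo)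
open import Data.List.Membership.Propositional.Properties using (∈-upTo⁺)
open import Data.List.Properties using (length-++; length-map; filter-++)
open import Data.List.Relation.Unary.All using (All; []; _∷_)
import Data.List.Relation.Unary.All as All
import Data.List.Relation.Unary.All.Properties as All
open import Data.List.Relation.Unary.Any using (Any; here; there)
import Data.List.Relation.Unary.Any as Any
import Data.List.Relation.Unary.Any.Properties as Any
open import Data.Nat hiding (NonTrivial)
open import Data.Nat.Combinatorics using (_C_; nC1≡n; nCn≡1; nCk≡nC[n∸k]; nCk+nC[k+1]≡[n+1]C[k+1])
open import Data.Nat.ListAction using (sum)
open import Data.Nat.Properties
open import Data.Nat.Tactic.RingSolver using (solve-∀)
open import Data.Product using (_×_; _,_; proj₁; proj₂; ∃; ∃₂)
open import Data.Sum using (_⊎_; inj₁; inj₂)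
open import Data.Unit using (tt) renaming (⊤ to Unit)
open import Data.Vec using (Vec; []; _∷_; here; there; head; tail; lookup; allFin)
import Data.Vec as Vec
open import Data.Vec.N-ary using (N-ary; _$ⁿ_)
open import Data.Vec.Properties using (lookup-map)
open import Function using (_∘_; id)
open import Relation.Binary.PropositionalEquality
open import Relation.Nullary using (¬_; Dec; yes; no)
open import Relation.Nullary.Decidable using (_×-dec_; ⌊_⌋; fromWitness; toWitness)

-- Everything is measured in units of N(t+1): |𝒜| and |ℋ| are about (t+2) N(t+1) and (k-t+1) N(t+1),
-- so the target is about M² N(t+1)² with M = max(t+2, k-t+1). The hypothesis on n leaves n - s ≥
-- 3(t+2)²k² for all s ≤ k, so a branching step, which costs a factor k, is more than repaid by
-- passing from N(s) to N(s+1). Most cases then win by a constant factor, and comparing leading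
-- coefficients settles them. Two cases are tighter. One cover against several gives the coefficient
-- (t+1)(k-t+1), which can be as large as (t+1)/(t+2) of M², so lower-order terms have to be kept.
-- Covers sharing only t-1 elements give 4 · 3 = 12, which is below M² because k ≥ 5 yields M ≥ 4.
-- Set-theoretic steps are phrased through cardinalities (inclusion means that a difference has at
-- most 0 elements, an element is a one-element set), so that the checked certificates of `linear`
-- dispose of them.

private variable n : ℕ

-- Deciding linear inequalities between cardinalities

+-interchange : ∀ a b c d → (a + b) + (c + d) ≡ (a + c) + (b + d)
+-interchange = solve-∀

-- A linear inequality between cardinalities of Boolean combinations of sets follows from
-- others if, once these are added to it, it holds in every cell of the Venn diagram and
-- coefficientwise in the numerical unknowns.
module Cardinalities where

  private variable m v : ℕ

  infixr 7 _⊓ˢ_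
  infixr 6 _⊔ˢ_
  infixl 6 _⊕_
  infix 8 #_
  infix 4 _≼_
  infix 3 _⊢_

  data Set′ (m : ℕ) : Set where
    var      : Fin m → Set′ m
    _⊓ˢ_ _⊔ˢ_ : Set′ m → Set′ m → Set′ m
    -ˢ_      : Set′ m → Set′ m

  data Lin (m v : ℕ) : Set where
    #_  : Set′ m → Lin m v
    nat : Fin v → Lin m v
    lit : ℕ → Lin m v
    _⊕_ : Lin m v → Lin m v → Lin m v

  record Ineq (m v : ℕ) : Set where
    constructor _≼_
    field lhs rhs : Lin m v

  record Problem (m v : ℕ) : Set where
    constructor _⊢_
    field
      hyps : List (Ineq m v)
      goal : Ineq m v

  ⟦_⟧ˢ : Set′ m → Vec (Subset n) m → Subset n
  ⟦ var i ⟧ˢ  ρ = lookup ρ i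
  ⟦ e ⊓ˢ f ⟧ˢ ρ = ⟦ e ⟧ˢ ρ ∩ ⟦ f ⟧ˢ ρ
  ⟦ e ⊔ˢ f ⟧ˢ ρ = ⟦ e ⟧ˢ ρ ∪ ⟦ f ⟧ˢ ρ
  ⟦ -ˢ e ⟧ˢ   ρ = ∁ (⟦ e ⟧ˢ ρ)

  ⟦_⟧ : Lin m v → Vec (Subset n) m → Vec ℕ v → ℕ
  ⟦ # e ⟧   ρ σ = ∣ ⟦ e ⟧ˢ ρ ∣
  ⟦ nat i ⟧ ρ σ = lookup σ i
  ⟦ lit k ⟧ ρ σ = k
  ⟦ l ⊕ r ⟧ ρ σ = ⟦ l ⟧ ρ σ + ⟦ r ⟧ ρ σ

  Holds : Ineq m v → Vec (Subset n) m → Vec ℕ v → Set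
  Holds (l ≼ r) ρ σ = ⟦ l ⟧ ρ σ ≤ ⟦ r ⟧ ρ σ

  AllHold : List (Ineq m v) → Vec (Subset n) m → Vec ℕ v → Set
  AllHold []       ρ σ = Unit
  AllHold (h ∷ hs) ρ σ = Holds h ρ σ × AllHold hs ρ σ

  bit : Bool → ℕ
  bit true  = 1
  bit false = 0

  at : Set′ m → Vec Bool m → Bool
  at (var i)  ρ = lookup ρ i
  at (e ⊓ˢ f) ρ = at e ρ ∧ at f ρ
  at (e ⊔ˢ f) ρ = at e ρ ∨ at f ρ
  at (-ˢ e)   ρ = not (at e ρ)

  -- The contribution to ⟦ l ⟧ of a single point lying in the sets selected by ρ.
  local : Lin m v → Vec Bool m → ℕ
  local (# e)   ρ = bit (at e ρ)
  local (nat i) ρ = 0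
  local (lit k) ρ = 0
  local (l ⊕ r) ρ = local l ρ + local r ρ

  literal : Lin m v → ℕ
  literal (# e)   = 0
  literal (nat i) = 0
  literal (lit k) = k
  literal (l ⊕ r) = literal l + literal r

  eqᶠ : Fin v → Fin v → ℕ
  eqᶠ zero zero = 1
  eqᶠ zero (suc j) = 0
  eqᶠ (suc i) zero = 0
  eqᶠ (suc i) (suc j) = eqᶠ i j

  coeff : Lin m v → Fin v → ℕ
  coeff (# e)   j = 0
  coeff (nat i) j = eqᶠ i j
  coeff (lit k) j = 0
  coeff (l ⊕ r) j = coeff l j + coeff r j

  split : (e : Set′ m) (ρ : Vec (Subset (suc n)) m) → ⟦ e ⟧ˢ ρ ≡ at e (Vec.map head ρ) ∷ ⟦ e ⟧ˢ (Vec.map tail ρ)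
  split (var i)  ρ rewrite lookup-map i head ρ | lookup-map i tail ρ with lookup ρ i
  ... | x ∷ xs = refl
  split (e ⊓ˢ f) ρ rewrite split e ρ | split f ρ = refl
  split (e ⊔ˢ f) ρ rewrite split e ρ | split f ρ = refl
  split (-ˢ e)   ρ rewrite split e ρ = refl

  card-∷ : ∀ b (p : Subset n) → ∣ b ∷ p ∣ ≡ bit b + ∣ p ∣
  card-∷ true  p = refl
  card-∷ false p = refl

  setPart : Lin m v → Vec (Subset n) m → ℕ
  setPart (# e)   ρ = ∣ ⟦ e ⟧ˢ ρ ∣
  setPart (nat i) ρ = 0
  setPart (lit k) ρ = 0
  setPart (l ⊕ r) ρ = setPart l ρ + setPart r ρ

  setPart-suc : (l : Lin m v) (ρ : Vec (Subset (suc n)) m) →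
    setPart l ρ ≡ local l (Vec.map head ρ) + setPart l (Vec.map tail ρ)
  setPart-suc (# e)   ρ rewrite split e ρ = card-∷ (at e (Vec.map head ρ)) (⟦ e ⟧ˢ (Vec.map tail ρ))
  setPart-suc (nat i) ρ = refl
  setPart-suc (lit k) ρ = refl
  setPart-suc (l ⊕ r) ρ rewrite setPart-suc l ρ | setPart-suc r ρ =
    +-interchange (local l (Vec.map head ρ)) _ _ _

  setPart-zero : (l : Lin m v) (ρ : Vec (Subset 0) m) → setPart l ρ ≡ 0
  setPart-zero (# e)   ρ with ⟦ e ⟧ˢ ρ
  ... | [] = refl
  setPart-zero (nat i) ρ = refl
  setPart-zero (lit k) ρ = refl
  setPart-zero (l ⊕ r) ρ rewrite setPart-zero l ρ = setPart-zero r ρ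

  -- A cardinality is a sum of contributions of the points of the ground set, and the contribution
  -- of a point depends only on which of the sets contain it.
  setPart-mono : (l r : Lin m v) → (∀ ρ → local l ρ ≤ local r ρ) → (ρ : Vec (Subset n) m) → setPart l ρ ≤ setPart r ρ
  setPart-mono {n = zero}  l r l≤r ρ rewrite setPart-zero l ρ = z≤n
  setPart-mono {n = suc n} l r l≤r ρ rewrite setPart-suc l ρ | setPart-suc r ρ =
    +-mono-≤ (l≤r (Vec.map head ρ)) (setPart-mono l r l≤r (Vec.map tail ρ))

  Σᶠ : (Fin v → ℕ) → ℕ
  Σᶠ {zero}  f = 0
  Σᶠ {suc v} f = f zero + Σᶠ (λ i → f (suc i))

  Σᶠ-mono : {f g : Fin v → ℕ} → (∀ i → f i ≤ g i) → Σᶠ f ≤ Σᶠ g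
  Σᶠ-mono {zero}  f≤g = z≤n
  Σᶠ-mono {suc v} f≤g = +-mono-≤ (f≤g zero) (Σᶠ-mono (λ i → f≤g (suc i)))

  Σᶠ-zero : (v : ℕ) → Σᶠ {v} (λ _ → 0) ≡ 0
  Σᶠ-zero zero    = refl
  Σᶠ-zero (suc v) = Σᶠ-zero v

  Σᶠ-eqᶠ : (i : Fin v) (σ : Vec ℕ v) → Σᶠ (λ j → eqᶠ i j * lookup σ j) ≡ lookup σ i
  Σᶠ-eqᶠ {suc v} zero (x ∷ σ) rewrite Σᶠ-zero v = trans (+-identityʳ _) (+-identityʳ _)
  Σᶠ-eqᶠ (suc i) (x ∷ σ) = Σᶠ-eqᶠ i σ

  Σᶠ-+ : (f g : Fin v → ℕ) → Σᶠ (λ i → f i + g i) ≡ Σᶠ f + Σᶠ g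
  Σᶠ-+ {zero}  f g = refl
  Σᶠ-+ {suc v} f g rewrite Σᶠ-+ (λ i → f (suc i)) (λ i → g (suc i)) = +-interchange (f zero) _ _ _

  Σᶠ-cong : {f g : Fin v → ℕ} → (∀ i → f i ≡ g i) → Σᶠ f ≡ Σᶠ g
  Σᶠ-cong {zero}  f≡g = refl
  Σᶠ-cong {suc v} f≡g = cong₂ _+_ (f≡g zero) (Σᶠ-cong (λ i → f≡g (suc i)))

  natPart : (l : Lin m v) (σ : Vec ℕ v) → ℕ
  natPart l σ = Σᶠ (λ j → coeff l j * lookup σ j)

  evaluate : (l : Lin m v) (ρ : Vec (Subset n) m) (σ : Vec ℕ v) →
    ⟦ l ⟧ ρ σ ≡ setPart l ρ + (literal l + natPart l σ)
  evaluate {v = v} (# e)   ρ σ rewrite Σᶠ-zero v = sym (+-identityʳ _)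
  evaluate (nat i) ρ σ = sym (Σᶠ-eqᶠ i σ)
  evaluate {v = v} (lit k) ρ σ rewrite Σᶠ-zero v = sym (+-identityʳ k)
  evaluate (l ⊕ r) ρ σ
    rewrite evaluate l ρ σ | evaluate r ρ σ
          | Σᶠ-cong {f = λ j → coeff (l ⊕ r) j * lookup σ j} (λ j → *-distribʳ-+ (lookup σ j) (coeff l j) (coeff r j))
          | Σᶠ-+ (λ j → coeff l j * lookup σ j) (λ j → coeff r j * lookup σ j) =
    regroup (setPart l ρ) (literal l) (natPart l σ) _ _ _
    where
    regroup : ∀ a b c d e f → (a + (b + c)) + (d + (e + f)) ≡ (a + d) + ((b + e) + (c + f))
    regroup = solve-∀

  everywhere : (Vec Bool m → Bool) → Bool
  everywhere {zero}  f = f []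
  everywhere {suc m} f = everywhere (λ ρ → f (true ∷ ρ)) ∧ everywhere (λ ρ → f (false ∷ ρ))

  everyIndex : (Fin v → Bool) → Bool
  everyIndex {zero}  f = true
  everyIndex {suc v} f = f zero ∧ everyIndex (λ i → f (suc i))

  ∧-split : ∀ a {b} → T (a ∧ b) → T a × T b
  ∧-split true p = tt , p

  everywhere-sound : (f : Vec Bool m → Bool) → T (everywhere f) → ∀ ρ → T (f ρ)
  everywhere-sound f p []          = p
  everywhere-sound f p (true ∷ ρ)  = everywhere-sound _ (proj₁ (∧-split (everywhere (λ ρ → f (true ∷ ρ))) p)) ρ
  everywhere-sound f p (false ∷ ρ) = everywhere-sound _ (proj₂ (∧-split (everywhere (λ ρ → f (true ∷ ρ))) p)) ρ

  everyIndex-sound : (f : Fin v → Bool) → T (everyIndex f) → ∀ i → T (f i)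
  everyIndex-sound f p zero    = proj₁ (∧-split (f zero) p)
  everyIndex-sound f p (suc i) = everyIndex-sound _ (proj₂ (∧-split (f zero) p)) i

  dominated : Lin m v → Lin m v → Bool
  dominated l r = everywhere (λ ρ → local l ρ ≤ᵇ local r ρ) ∧ (literal l ≤ᵇ literal r) ∧ everyIndex (λ i → coeff l i ≤ᵇ coeff r i)

  dominated-sound : (l r : Lin m v) → T (dominated l r) → (ρ : Vec (Subset n) m) (σ : Vec ℕ v) → ⟦ l ⟧ ρ σ ≤ ⟦ r ⟧ ρ σ
  dominated-sound l r p ρ σ rewrite evaluate l ρ σ | evaluate r ρ σ =
    let p₁ , p′ = ∧-split (everywhere (λ ρ → local l ρ ≤ᵇ local r ρ)) p
        p₂ , p₃ = ∧-split (literal l ≤ᵇ literal r) p′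
    in +-mono-≤ (setPart-mono l r (λ ρ → ≤ᵇ⇒≤ _ _ (everywhere-sound _ p₁ ρ)) ρ)
         (+-mono-≤ (≤ᵇ⇒≤ _ _ p₂)
           (Σᶠ-mono (λ i → *-monoˡ-≤ (lookup σ i) (≤ᵇ⇒≤ (coeff l i) (coeff r i) (everyIndex-sound _ p₃ i)))))

  lhs-sum rhs-sum : List (Ineq m v) → Lin m v
  lhs-sum []             = lit 0
  lhs-sum ((l ≼ r) ∷ hs) = l ⊕ lhs-sum hs
  rhs-sum []             = lit 0
  rhs-sum ((l ≼ r) ∷ hs) = r ⊕ rhs-sum hs

  sum-holds : (hs : List (Ineq m v)) (ρ : Vec (Subset n) m) (σ : Vec ℕ v) → AllHold hs ρ σ →
    ⟦ lhs-sum hs ⟧ ρ σ ≤ ⟦ rhs-sum hs ⟧ ρ σ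
  sum-holds []       ρ σ _        = z≤n
  sum-holds (h ∷ hs) ρ σ (p , ps) = +-mono-≤ p (sum-holds hs ρ σ ps)

  -- Every hypothesis enters with coefficient one. A certificate that needs a larger multiplier
  -- lists the hypothesis several times, and a contradiction is derived as the goal `lit 1 ≼ lit 0`.
  valid : Problem m v → Bool
  valid (hs ⊢ l ≼ r) = dominated (l ⊕ rhs-sum hs) (r ⊕ lhs-sum hs)

  Proposition : Problem m v → Vec (Subset n) m → Vec ℕ v → Set
  Proposition (hs ⊢ g) ρ σ = AllHold hs ρ σ → Holds g ρ σ

  valid-sound : (P : Problem m v) → T (valid P) → (ρ : Vec (Subset n) m) (σ : Vec ℕ v) → Proposition P ρ σ
  valid-sound (hs ⊢ l ≼ r) p ρ σ ps = +-cancelʳ-≤ _ _ _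
    (≤-trans (dominated-sound (l ⊕ rhs-sum hs) (r ⊕ lhs-sum hs) p ρ σ)
             (+-monoʳ-≤ (⟦ r ⟧ ρ σ) (sum-holds hs ρ σ ps)))

  instantiate : ∀ m v → N-ary m (Set′ m) (N-ary v (Lin m v) (Problem m v)) → Problem m v
  instantiate m v f = (f $ⁿ Vec.map var (allFin m)) $ⁿ Vec.map nat (allFin v)

  -- The test runs on `f` applied to formal variables, so it evaluates independently of `ρ` and `σ`,
  -- and the implicit proof is filled in as the element of the unit type.
  linear : (ρ : Vec (Subset n) m) (σ : Vec ℕ v) (f : N-ary m (Set′ m) (N-ary v (Lin m v) (Problem m v))) →
    {T (valid (instantiate m v f))} → Proposition (instantiate m v f) ρ σ
  linear {m = m} {v = v} ρ σ f {p} = valid-sound (instantiate m v f) p ρ σ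

  infixr 7 _·_

  _·_ : ℕ → Lin m v → Lin m v
  zero  · l = lit 0
  suc c · l = l ⊕ c · l

  linearℕ : (σ : Vec ℕ v) (f : N-ary v (Lin 0 v) (Problem 0 v)) →
    {T (valid (instantiate 0 v f))} → Proposition {n = 0} (instantiate 0 v f) [] σ
  linearℕ σ f {p} = linear {n = 0} [] σ f {p}

open Cardinalities

-- Counting families by summation over all subsets

∧-intro : ∀ {a b} → T a → T b → T (a ∧ b)
∧-intro {true} _ q = q

-- Recursion on the characteristic vector, in the order of `allSubsets`, lets counting identities be
-- proved by deciding one element of the ground set at a time.
Σₛ : (Subset n → ℕ) → ℕ
Σₛ {zero}  f = f []
Σₛ {suc n} f = Σₛ (f ∘ (outside ∷_)) + Σₛ (f ∘ (inside ∷_))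

Σₛ-mono : {f g : Subset n → ℕ} → (∀ A → f A ≤ g A) → Σₛ f ≤ Σₛ g
Σₛ-mono {zero}  f≤g = f≤g []
Σₛ-mono {suc n} f≤g = +-mono-≤ (Σₛ-mono (f≤g ∘ (outside ∷_))) (Σₛ-mono (f≤g ∘ (inside ∷_)))

Σₛ-cong : {f g : Subset n → ℕ} → (∀ A → f A ≡ g A) → Σₛ f ≡ Σₛ g
Σₛ-cong f≡g = ≤-antisym (Σₛ-mono (≤-reflexive ∘ f≡g)) (Σₛ-mono (≤-reflexive ∘ sym ∘ f≡g))

Σₛ-zero : ∀ n → Σₛ {n} (λ _ → 0) ≡ 0
Σₛ-zero zero    = refl
Σₛ-zero (suc n) rewrite Σₛ-zero n = refl

Σₛ-+ : (f g : Subset n → ℕ) → Σₛ (λ A → f A + g A) ≡ Σₛ f + Σₛ g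
Σₛ-+ {zero}  f g = refl
Σₛ-+ {suc n} f g
  rewrite Σₛ-+ (f ∘ (outside ∷_)) (g ∘ (outside ∷_)) | Σₛ-+ (f ∘ (inside ∷_)) (g ∘ (inside ∷_)) =
  +-interchange (Σₛ (f ∘ (outside ∷_))) _ _ _

Σₛ-sum : {I : Set} (f : I → Subset n → ℕ) (L : List I) →
  Σₛ (λ A → sum (map (λ i → f i A) L)) ≡ sum (map (λ i → Σₛ (f i)) L)
Σₛ-sum {n} f []      = Σₛ-zero n
Σₛ-sum     f (i ∷ L) = trans (Σₛ-+ (f i) _) (cong (Σₛ (f i) +_) (Σₛ-sum f L))

size : Family n → ℕ
size P = Σₛ (bit ∘ P)

card≡size : (P : Family n) → card P ≡ size P
card≡size {zero}  P with P []
... | true  = refl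
... | false = refl
card≡size {suc n} P = begin
  length (filter P? (map (outside ∷_) U ++ map (inside ∷_) U))
    ≡⟨ cong length (filter-++ P? (map (outside ∷_) U) _) ⟩
  length (filter P? (map (outside ∷_) U) ++ filter P? (map (inside ∷_) U))
    ≡⟨ length-++ (filter P? (map (outside ∷_) U)) ⟩
  length (filter P? (map (outside ∷_) U)) + length (filter P? (map (inside ∷_) U))
    ≡⟨ cong₂ _+_ (push outside U) (push inside U) ⟩
  card (P ∘ (outside ∷_)) + card (P ∘ (inside ∷_))
    ≡⟨ cong₂ _+_ (card≡size (P ∘ (outside ∷_))) (card≡size (P ∘ (inside ∷_))) ⟩
  size P ∎
  where
  open ≡-Reasoning
  U = allSubsets n
  P? = λ A → T? (P A)
  push : ∀ x (L : List (Subset n)) → length (filter P? (map (x ∷_) L)) ≡ length (filter (λ A → P? (x ∷ A)) L)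
  push x []      = refl
  push x (A ∷ L) with P (x ∷ A)
  ... | true  = cong suc (push x L)
  ... | false = push x L

bit-mono : ∀ {a b} → (T a → T b) → bit a ≤ bit b
bit-mono {true}  {true}  f = ≤-refl
bit-mono {true}  {false} f with () ← f tt
bit-mono {false} {b}     f = z≤n

size-mono : {P Q : Family n} → (∀ A → T (P A) → T (Q A)) → size P ≤ size Q
size-mono P⊆Q = Σₛ-mono (λ A → bit-mono (P⊆Q A))

size-cong : {P Q : Family n} → (∀ A → P A ≡ Q A) → size P ≡ size Q
size-cong P≡Q = Σₛ-cong (λ A → cong bit (P≡Q A))

size-empty : {P : Family n} → (∀ A → P A ≡ false) → size P ≡ 0
size-empty {n} P≡false = trans (size-cong P≡false) (Σₛ-zero n)

disjoint-sum : (P Q R : Family n) → (∀ A → T (P A) → T (R A)) → (∀ A → T (Q A) → T (R A)) →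
  (∀ A → T (P A) → T (Q A) → T false) → size P + size Q ≤ size R
disjoint-sum P Q R P⊆R Q⊆R P∩Q=∅ = ≤-trans (≤-reflexive (sym (Σₛ-+ (bit ∘ P) (bit ∘ Q)))) (Σₛ-mono λ A → go (P⊆R A) (Q⊆R A) (P∩Q=∅ A))
  where
  go : ∀ {a b c} → (T a → T c) → (T b → T c) → (T a → T b → T false) → bit a + bit b ≤ bit c
  go {true}  {true}  f g h with () ← h tt tt
  go {true}  {false} f g h = bit-mono f
  go {false} {b}     f g h = bit-mono g

union-sum : {I : Set} (P : Family n) (L : List I) (Q : I → Family n) →
  (∀ A → T (P A) → Any (λ i → T (Q i A)) L) → size P ≤ sum (map (size ∘ Q) L)
union-sum P L Q P⊆⋃Q = ≤-trans (Σₛ-mono (λ A → pointwise (P⊆⋃Q A))) (≤-reflexive (Σₛ-sum (λ i A → bit (Q i A)) L))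
  where
  1≤ : ∀ {A L} → Any (λ i → T (Q i A)) L → 1 ≤ sum (map (λ i → bit (Q i A)) L)
  1≤ {A} (here {x = i} q) with Q i A
  ... | true = s≤s z≤n
  1≤ (there q) = ≤-trans (1≤ q) (m≤n+m _ _)
  pointwise : ∀ {b A} → (T b → Any (λ i → T (Q i A)) L) → bit b ≤ sum (map (λ i → bit (Q i A)) L)
  pointwise {true}  f = 1≤ (f tt)
  pointwise {false} f = z≤n

sum≤length* : {I : Set} (f : I → ℕ) (L : List I) {b : ℕ} → All (λ i → f i ≤ b) L → sum (map f L) ≤ length L * b
sum≤length* f []      []       = z≤n
sum≤length* f (i ∷ L) (p ∷ ps) = +-mono-≤ p (sum≤length* f L ps)

union-bound : {I : Set} (P : Family n) (L : List I) (Q : I → Family n) {b : ℕ} →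
  (∀ A → T (P A) → Any (λ i → T (Q i A)) L) → All (λ i → size (Q i) ≤ b) L → size P ≤ length L * b
union-bound P L Q P⊆⋃Q Q≤b = ≤-trans (union-sum P L Q P⊆⋃Q) (sum≤length* (size ∘ Q) L Q≤b)

union₂ : (P Q R : Family n) → (∀ A → T (P A) → T (Q A ∨ R A)) → size P ≤ size Q + size R
union₂ P Q R P⊆Q∪R = ≤-trans (Σₛ-mono λ A → go {P A} {Q A} {R A} (P⊆Q∪R A)) (≤-reflexive (Σₛ-+ (bit ∘ Q) (bit ∘ R)))
  where
  go : ∀ {a b c} → (T a → T (b ∨ c)) → bit a ≤ bit b + bit c
  go {false} f = z≤n
  go {true} {true}  f = s≤s z≤n
  go {true} {false} f = bit-mono f

-- Binomial coefficients with a shifted lower index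

-- choose m k s is C(m, k − s), and 0 when s > k.
choose : ℕ → ℕ → ℕ → ℕ
choose m k       zero    = m C k
choose m zero    (suc s) = 0
choose m (suc k) (suc s) = choose m k s

choose-pascal : ∀ m k s → choose (suc m) k s ≡ choose m k (suc s) + choose m k s
choose-pascal m zero    zero    = refl
choose-pascal m (suc k) zero    = sym (nCk+nC[k+1]≡[n+1]C[k+1] m k)
choose-pascal m zero    (suc s) = refl
choose-pascal m (suc k) (suc s) = choose-pascal m k s

C-pred : ∀ m → suc m C m ≡ suc m
C-pred m = trans (nCk≡nC[n∸k] (n≤1+n m)) (trans (cong (suc m C_) (m+n∸n≡m 1 m)) (nC1≡n (suc m)))

C-absorb : ∀ m k → suc k * (suc m C suc k) ≡ suc m * (m C k)
C-absorb m       zero    = trans (+-identityʳ _) (trans (nC1≡n (suc m)) (sym (*-identityʳ _)))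
C-absorb zero    (suc k) = *-zeroʳ k
C-absorb (suc m) (suc j) = begin
  (2 + j) * ((2 + m) C (2 + j))                                   ≡⟨ cong ((2 + j) *_) (sym (nCk+nC[k+1]≡[n+1]C[k+1] (suc m) (suc j))) ⟩
  (2 + j) * (x + (suc m C (2 + j)))                             ≡⟨ expand j x (suc m C (2 + j)) ⟩
  x + (suc j * x + (2 + j) * (suc m C (2 + j)))                 ≡⟨ cong₂ (λ y z → x + (y + z)) (C-absorb m j) (C-absorb m (suc j)) ⟩
  x + (suc m * (m C j) + suc m * (m C suc j))                 ≡⟨ cong (x +_) (sym (*-distribˡ-+ (suc m) (m C j) _)) ⟩
  x + suc m * ((m C j) + (m C suc j))                         ≡⟨ cong (λ y → x + suc m * y) (nCk+nC[k+1]≡[n+1]C[k+1] m j) ⟩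
  x + suc m * x                                               ∎
  where
  open ≡-Reasoning
  x = suc m C suc j
  expand : ∀ j x y → (2 + j) * (x + y) ≡ x + (suc j * x + (2 + j) * y)
  expand = solve-∀

-- With k - s = j + 1 this is (j+1) C(m+1, j+1) = (m+1) C(m, j). For s ≥ k both sides vanish, the
-- left one through the truncated `k ∸ s`.
choose-absorb : ∀ m k s → (k ∸ s) * choose (suc m) k s ≡ suc m * choose m k (suc s)
choose-absorb m zero    zero    = sym (*-zeroʳ m)
choose-absorb m (suc k) zero    = C-absorb m k
choose-absorb m zero    (suc s) = sym (*-zeroʳ m)
choose-absorb m (suc k) (suc s) = choose-absorb m k s

choose-mono : ∀ k s {m m′} → m ≤ m′ → choose m k s ≤ choose m′ k s
choose-mono k s {m} m≤m′ = go (≤⇒≤′ m≤m′)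
  where
  go : ∀ {m′} → m ≤′ m′ → choose m k s ≤ choose m′ k s
  go (≤′-reflexive refl) = ≤-refl
  go (≤′-step {m′} p) = ≤-trans (go p) (≤-trans (m≤n+m _ _) (≤-reflexive (sym (choose-pascal m′ k s))))

-- Pascal's rule is telescoped and every increment replaced by the largest one; `choose-rise`
-- replaces each by the smallest. Together they control |ℋ| and the losses to first order.
choose-drop : ∀ k s m j → choose (suc j + m) k s ≤ choose m k s + suc j * choose (j + m) k (suc s)
choose-drop k s m zero    = ≤-reflexive (trans (choose-pascal m k s) (trans (+-comm (choose m k (suc s)) _) (cong (choose m k s +_) (sym (+-identityʳ _)))))
choose-drop k s m (suc j) = begin
  choose (2 + j + m) k s                        ≡⟨ choose-pascal (suc j + m) k s ⟩
  q + choose (suc j + m) k s                    ≤⟨ +-monoʳ-≤ q (≤-trans (choose-drop k s m j) (+-monoʳ-≤ (choose m k s) (*-monoʳ-≤ (suc j) (choose-mono k (suc s) (n≤1+n (j + m)))))) ⟩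
  q + (choose m k s + suc j * q)                ≡⟨ swap q (choose m k s) (suc j * q) ⟩
  choose m k s + (q + suc j * q)                ∎
  where
  open ≤-Reasoning
  q = choose (suc j + m) k (suc s)
  swap : ∀ a b c → a + (b + c) ≡ b + (a + c)
  swap = solve-∀

choose-rise : ∀ k s m j → choose m k s + j * choose m k (suc s) ≤ choose (j + m) k s
choose-rise k s m zero    = ≤-reflexive (+-identityʳ _)
choose-rise k s m (suc j) = begin
  choose m k s + (q + j * q)                    ≡⟨ swap (choose m k s) q (j * q) ⟩
  q + (choose m k s + j * q)                    ≤⟨ +-mono-≤ (choose-mono k (suc s) (m≤n+m m j)) (choose-rise k s m j) ⟩
  choose (j + m) k (suc s) + choose (j + m) k s ≡⟨ choose-pascal (j + m) k s ⟨
  choose (suc j + m) k s                        ∎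
  where
  open ≤-Reasoning
  q = choose m k (suc s)
  swap : ∀ a b c → a + (b + c) ≡ b + (a + c)
  swap = solve-∀

-- Inclusion, and the number of k-sets with prescribed elements

infix 4 _⊑_ _⊑ᵇ_

-- Inclusion as a cardinality inequality, the form that `linear` handles.
_⊑_ : Subset n → Subset n → Set
S ⊑ A = ∣ S ∩ ∁ A ∣ ≤ 0

_⊑ᵇ_ : Subset n → Subset n → Bool
S ⊑ᵇ A = ∣ S ∩ ∁ A ∣ ≤ᵇ 0

between : ℕ → Subset n → Subset n → Family n
between k S V A = (S ⊑ᵇ A) ∧ (V ⊑ᵇ ∁ A) ∧ (∣ A ∣ ≡ᵇ k)

size-between : ∀ k (S V : Subset n) → ∣ S ∩ V ∣ ≤ 0 → size (between k S V) ≡ choose (∣ ∁ (S ∪ V) ∣) k (∣ S ∣)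
size-between zero    [] [] _ = refl
size-between (suc k) [] [] _ = refl
size-between k (outside ∷ S) (inside ∷ V) d =
  trans (cong₂ _+_ (size-between k S V d) (size-empty (λ A → ∧-zeroʳ (S ⊑ᵇ A)))) (+-identityʳ _)
size-between {suc n} zero (outside ∷ S) (outside ∷ V) d =
  trans (cong₂ _+_ (size-between zero S V d) (size-empty (λ A → trans (cong ((S ⊑ᵇ A) ∧_) (∧-zeroʳ (V ⊑ᵇ ∁ A))) (∧-zeroʳ (S ⊑ᵇ A)))))
        (trans (+-identityʳ _) (sym (choose-pascal _ zero (∣ S ∣))))
size-between (suc k) (outside ∷ S) (outside ∷ V) d =
  trans (cong₂ _+_ (size-between (suc k) S V d) (size-between k S V d))
        (trans (+-comm (choose (∣ ∁ (S ∪ V) ∣) (suc k) (∣ S ∣)) _) (sym (choose-pascal _ (suc k) (∣ S ∣))))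
size-between {suc n} zero (inside ∷ S) (outside ∷ V) d =
  cong₂ _+_ (Σₛ-zero n) (size-empty (λ A → trans (cong ((S ⊑ᵇ A) ∧_) (∧-zeroʳ (V ⊑ᵇ ∁ A))) (∧-zeroʳ (S ⊑ᵇ A))))
size-between {suc n} (suc k) (inside ∷ S) (outside ∷ V) d =
  cong₂ _+_ (Σₛ-zero n) (size-between k S V d)

size-above : ∀ k (S : Subset n) → size (λ A → (S ⊑ᵇ A) ∧ (∣ A ∣ ≡ᵇ k)) ≡ choose (∣ ∁ S ∣) k (∣ S ∣)
size-above {n} k S = begin
  size (λ A → (S ⊑ᵇ A) ∧ (∣ A ∣ ≡ᵇ k)) ≡⟨ size-cong (λ A → cong (λ x → (S ⊑ᵇ A) ∧ (x ≤ᵇ 0) ∧ (∣ A ∣ ≡ᵇ k)) (sym (trans (cong ∣_∣ (∩-zeroˡ (∁ (∁ A)))) (∣⊥∣≡0 n)))) ⟩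
  size (between k S ⊥)                 ≡⟨ size-between k S ⊥ (linear (S ∷ ⊥ ∷ []) [] (λ s o → (# o ≼ lit 0) ∷ [] ⊢ # (s ⊓ˢ o) ≼ lit 0) (≤-reflexive (∣⊥∣≡0 n) , tt)) ⟩
  choose (∣ ∁ (S ∪ ⊥) ∣) k (∣ S ∣)         ≡⟨ cong (λ X → choose (∣ ∁ X ∣) k (∣ S ∣)) (∪-identityʳ S) ⟩
  choose (∣ ∁ S ∣) k (∣ S ∣)               ∎
  where open ≡-Reasoning

almostAbove : ℕ → Subset n → Family n
almostAbove k D A = (∣ D ∩ ∁ A ∣ ≤ᵇ 1) ∧ (∣ A ∣ ≡ᵇ k)

-- The first term counts the k-sets missing exactly one element of `D`, the second those containing
-- `D`; for `D` of size t + 2 the sum is |𝒜|. The truncation in `∣ D ∣ ∸ 1` is harmless for empty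
-- `D` because of the factor `∣ D ∣`.
size-almostAbove : ∀ k (D : Subset n) →
  size (almostAbove k D) ≡ ∣ D ∣ * choose (∣ ∁ D ∣) k (∣ D ∣ ∸ 1) + choose (∣ ∁ D ∣) k (∣ D ∣)
size-almostAbove zero    []            = refl
size-almostAbove (suc k) []            = refl
size-almostAbove zero (outside ∷ D)
  rewrite choose-pascal (∣ ∁ D ∣) zero (∣ D ∣ ∸ 1) | choose-pascal (∣ ∁ D ∣) zero (∣ D ∣) =
  trans (cong₂ _+_ (size-almostAbove zero D) (size-empty (λ A → ∧-zeroʳ (∣ D ∩ ∁ A ∣ ≤ᵇ 1)))) (+-identityʳ _)
size-almostAbove (suc k) (outside ∷ D)
  rewrite choose-pascal (∣ ∁ D ∣) (suc k) (∣ D ∣ ∸ 1) | choose-pascal (∣ ∁ D ∣) (suc k) (∣ D ∣) =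
  trans (cong₂ _+_ (size-almostAbove (suc k) D) (size-almostAbove k D)) (regroup (∣ D ∣) _ _ _ _)
  where
  regroup : ∀ d x y z w → (d * x + y) + (d * z + w) ≡ d * (z + x) + (w + y)
  regroup = solve-∀
size-almostAbove k (inside ∷ D) =
  trans (cong₂ _+_ (trans (size-cong λ A → cong (_∧ (∣ A ∣ ≡ᵇ k)) (<1 (∣ D ∩ ∁ A ∣))) (size-above k D)) (rest k))
        (sym (+-assoc (choose (∣ ∁ D ∣) k (∣ D ∣)) _ _))
  where
  <1 : ∀ m → (suc m ≤ᵇ 1) ≡ (m ≤ᵇ 0)
  <1 zero    = refl
  <1 (suc m) = refl
  *-choose-zero : ∀ d m → 0 ≡ d * choose m zero d + 0
  *-choose-zero zero    m = refl
  *-choose-zero (suc d) m = sym (trans (+-identityʳ _) (*-zeroʳ d))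
  *-choose-suc : ∀ d m k → d * choose m k (d ∸ 1) ≡ d * choose m (suc k) d
  *-choose-suc zero    m k = refl
  *-choose-suc (suc d) m k = refl
  rest : ∀ k → size (λ A → almostAbove k (inside ∷ D) (inside ∷ A)) ≡
               ∣ D ∣ * choose (∣ ∁ D ∣) k (∣ D ∣) + choose (∣ ∁ D ∣) k (suc (∣ D ∣))
  rest zero    = trans (size-empty (λ A → ∧-zeroʳ (∣ D ∩ ∁ A ∣ ≤ᵇ 1))) (*-choose-zero (∣ D ∣) (∣ ∁ D ∣))
  rest (suc k) = trans (size-almostAbove k D) (cong (_+ choose (∣ ∁ D ∣) k (∣ D ∣)) (*-choose-suc (∣ D ∣) (∣ ∁ D ∣) k))

subsets : ℕ → Subset n → List (Subset n)
subsets zero    X             = ⊥ ∷ []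
subsets (suc j) []            = []
subsets (suc j) (outside ∷ X) = map (outside ∷_) (subsets (suc j) X)
subsets (suc j) (inside  ∷ X) = map (inside ∷_) (subsets j X) ++ map (outside ∷_) (subsets (suc j) X)

length-subsets : ∀ j (X : Subset n) → length (subsets j X) ≡ ∣ X ∣ C j
length-subsets zero    X             = refl
length-subsets (suc j) []            = refl
length-subsets (suc j) (outside ∷ X) = trans (length-map _ (subsets (suc j) X)) (length-subsets (suc j) X)
length-subsets (suc j) (inside  ∷ X) = begin
  length (map (inside ∷_) (subsets j X) ++ map (outside ∷_) (subsets (suc j) X))
    ≡⟨ length-++ (map (inside ∷_) (subsets j X)) ⟩
  length (map (inside ∷_) (subsets j X)) + length (map (outside ∷_) (subsets (suc j) X))
    ≡⟨ cong₂ _+_ (trans (length-map _ (subsets j X)) (length-subsets j X)) (trans (length-map _ (subsets (suc j) X)) (length-subsets (suc j) X)) ⟩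
  (∣ X ∣ C j) + (∣ X ∣ C suc j)
    ≡⟨ nCk+nC[k+1]≡[n+1]C[k+1] (∣ X ∣) j ⟩
  suc (∣ X ∣) C suc j ∎
  where open ≡-Reasoning

⊥⊑ : (A : Subset n) → ⊥ ⊑ A
⊥⊑ {n} A = ≤-reflexive (trans (cong ∣_∣ (∩-zeroˡ (∁ A))) (∣⊥∣≡0 n))

subsets-sound : ∀ j (X : Subset n) → All (λ S → ∣ S ∣ ≡ j × S ⊑ X) (subsets j X)
subsets-sound {n} zero X             = (∣⊥∣≡0 n , ⊥⊑ X) ∷ []
subsets-sound (suc j) []            = []
subsets-sound (suc j) (outside ∷ X) = All.map⁺ (subsets-sound (suc j) X)
subsets-sound (suc j) (inside  ∷ X) =
  All.++⁺ (All.map⁺ (All.map (λ (p , q) → cong suc p , q) (subsets-sound j X))) (All.map⁺ (subsets-sound (suc j) X))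

subsets-complete : ∀ j (X A : Subset n) → j ≤ ∣ A ∩ X ∣ → Any (_⊑ A) (subsets j X)
subsets-complete zero    X             A             _   = here (⊥⊑ A)
subsets-complete (suc j) []            []            ()
subsets-complete (suc j) (outside ∷ X) (outside ∷ A) j≤  = Any.map⁺ (subsets-complete (suc j) X A j≤)
subsets-complete (suc j) (outside ∷ X) (inside  ∷ A) j≤  = Any.map⁺ (subsets-complete (suc j) X A j≤)
subsets-complete (suc j) (inside  ∷ X) (outside ∷ A) j≤  =
  Any.++⁺ʳ (map (inside ∷_) (subsets j X)) (Any.map⁺ (subsets-complete (suc j) X A j≤))
subsets-complete (suc j) (inside  ∷ X) (inside  ∷ A) j≤  =
  Any.++⁺ˡ (Any.map⁺ (subsets-complete j X A (s≤s⁻¹ j≤)))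

-- Used for polynomial inequalities: the slack `e` is an explicit polynomial with nonnegative
-- coefficients, which leaves an identity for the ring solver.
≤-gap : ∀ {m n} e → m + e ≡ n → m ≤ n
≤-gap {m} e eq = ≤-trans (m≤m+n m e) (≤-reflexive eq)

C-sym-absorb : ∀ t r → suc r * ((t + suc r) C t) ≡ (t + suc r) * ((t + r) C t)
C-sym-absorb t r = begin
  suc r * ((t + suc r) C t)                ≡⟨ cong (suc r *_) (flip (suc r)) ⟩
  suc r * ((t + suc r) C suc r)            ≡⟨ cong (λ x → suc r * (x C suc r)) (+-suc t r) ⟩
  suc r * (suc (t + r) C suc r)            ≡⟨ C-absorb (t + r) r ⟩
  suc (t + r) * ((t + r) C r)              ≡⟨ cong₂ _*_ (sym (+-suc t r)) (sym (flip r)) ⟩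
  (t + suc r) * ((t + r) C t)              ∎
  where
  open ≡-Reasoning
  flip : ∀ r → (t + r) C t ≡ (t + r) C r
  flip r = trans (nCk≡nC[n∸k] (m≤m+n t r)) (cong ((t + r) C_) (m+n∸m≡n t r))

≥-reflexive : ∀ {m n} → m ≡ n → n ≤ m
≥-reflexive e = ≤-reflexive (sym e)

All×Any : {I : Set} {P Q : I → Set} {L : List I} → All P L → Any Q L → Any (λ i → P i × Q i) L
All×Any (p ∷ ps) (here q)  = here (p , q)
All×Any (p ∷ ps) (there q) = there (All×Any ps q)

∧-right : ∀ a {b} → T (a ∧ b) → T b
∧-right a p = proj₂ (∧-split a p)

not-intro : ∀ {b} → (T b → T false) → T (not b)
not-intro {true}  f = f tt
not-intro {false} f = tt

not-elim : ∀ {b} → T (not b) → ¬ T b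
not-elim {false} _ ()

⊑ᵇ⇒⊑ : (S A : Subset n) → T (S ⊑ᵇ A) → S ⊑ A
⊑ᵇ⇒⊑ S A = ≤ᵇ⇒≤ (∣ S ∩ ∁ A ∣) 0

⊑⇒⊑ᵇ : (S A : Subset n) → S ⊑ A → T (S ⊑ᵇ A)
⊑⇒⊑ᵇ S A = ≤⇒≤ᵇ

⊑-dec : (S A : Subset n) → S ⊑ A ⊎ 1 ≤ ∣ S ∩ ∁ A ∣
⊑-dec S A = ≤-<-connex (∣ S ∩ ∁ A ∣) 0

-- Elements, degrees and splitting a family

∪-⊑ : {S p A : Subset n} → S ⊑ A → p ⊑ A → (S ∪ p) ⊑ A
∪-⊑ {S = S} {p} {A} h h′ = linear (S ∷ p ∷ A ∷ []) []
  (λ s p a → (# (s ⊓ˢ -ˢ a) ≼ lit 0) ∷ (# (p ⊓ˢ -ˢ a) ≼ lit 0) ∷ [] ⊢ # ((s ⊔ˢ p) ⊓ˢ -ˢ a) ≼ lit 0) (h , h′ , tt)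

-- An element is represented by a one-element set, so that statements about it stay within reach of
-- `linear`.
points : Subset n → List (Subset n)
points = subsets 1

length-points : (X : Subset n) → length (points X) ≡ ∣ X ∣
length-points X = trans (length-subsets 1 X) (nC1≡n (∣ X ∣))

point-of : (X A : Subset n) → 1 ≤ ∣ A ∩ X ∣ → Any (λ p → (∣ p ∣ ≡ 1 × p ⊑ X) × p ⊑ A) (points X)
point-of X A h = All×Any (subsets-sound 1 X) (subsets-complete 1 X A h)

deg : Family n → Subset n → ℕ
deg P S = size (λ A → P A ∧ (S ⊑ᵇ A))

size-branch : {I : Set} (P : Family n) (L : List I) (g : I → Subset n) {b : ℕ} →
  (∀ A → T (P A) → Any (λ i → g i ⊑ A) L) → All (λ i → deg P (g i) ≤ b) L → size P ≤ length L * b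
size-branch P L g h = union-bound P L (λ i A → P A ∧ (g i ⊑ᵇ A)) λ A PA → Any.map (λ {i} p → ∧-intro PA (⊑⇒⊑ᵇ (g i) A p)) (h A PA)

deg-branch : {I : Set} (P : Family n) (S : Subset n) (L : List I) (g : I → Subset n) {b : ℕ} →
  (∀ A → T (P A) → S ⊑ A → Any (λ i → g i ⊑ A) L) → All (λ i → deg P (g i) ≤ b) L → deg P S ≤ length L * b
deg-branch P S L g h = union-bound _ L (λ i A → P A ∧ (g i ⊑ᵇ A)) λ A PSA →
  let PA , SA = ∧-split (P A) PSA in Any.map (λ {i} p → ∧-intro PA (⊑⇒⊑ᵇ (g i) A p)) (h A PA (⊑ᵇ⇒⊑ S A SA))

deg-avoids : (P : Family n) (S : Subset n) → (∀ A → T (P A) → ¬ S ⊑ A) → deg P S ≡ 0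
deg-avoids {n} P S h = n≤0⇒n≡0 (≤-trans (size-mono {Q = λ _ → false} λ A PSA → let PA , SA = ∧-split (P A) PSA in h A PA (⊑ᵇ⇒⊑ S A SA)) (≤-reflexive (Σₛ-zero n)))

without : Family n → Subset n → Family n
without P X A = P A ∧ not (X ⊑ᵇ A)

size-without : (P : Family n) (X : Subset n) → size P ≤ deg P X + size (without P X)
size-without P X = union₂ P _ _ λ A → go (P A) (X ⊑ᵇ A)
  where
  go : ∀ a b → T a → T ((a ∧ b) ∨ (a ∧ not b))
  go true true  _ = tt
  go true false _ = tt

withoutAll : Family n → List (Subset n) → Family n
withoutAll P []       = P
withoutAll P (X ∷ Xs) = withoutAll (without P X) Xs

withoutAll-elim : (P : Family n) (Xs : List (Subset n)) → ∀ A → T (withoutAll P Xs A) → T (P A) × All (λ X → ¬ X ⊑ A) Xs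
withoutAll-elim P []       A h = h , []
withoutAll-elim P (X ∷ Xs) A h =
  let h′ , hs = withoutAll-elim (without P X) Xs A h
      PA , ¬X = ∧-split (P A) h′
  in PA , (λ X⊑A → not-elim ¬X (⊑⇒⊑ᵇ X A X⊑A)) ∷ hs

size-withoutAll : (P : Family n) (Xs : List (Subset n)) {b : ℕ} → All (λ X → deg P X ≤ b) Xs → size P ≤ length Xs * b + size (withoutAll P Xs)
size-withoutAll P []       []       = ≤-refl
size-withoutAll P (X ∷ Xs) {b} (h ∷ hs) = ≤-trans (size-without P X)
  (≤-trans (+-mono-≤ h (size-withoutAll (without P X) Xs (All.map (λ {Y} → ≤-trans (size-mono λ A q →
     let PA , YA = ∧-split (without P X A) q in ∧-intro (proj₁ (∧-split (P A) PA)) YA)) hs)))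
    (≤-reflexive (sym (+-assoc b _ _))))

a-subset : ∀ j (X : Subset n) → j ≤ ∣ X ∣ → ∃ λ p → ∣ p ∣ ≡ j × p ⊑ X
a-subset j X j≤ with subsets j X | subsets-sound j X | subsets-complete j X X (linear (X ∷ []) (j ∷ []) (λ x j → (j ≼ # x) ∷ [] ⊢ j ≼ # (x ⊓ˢ x)) (j≤ , tt))
... | []    | _          | ()
... | p ∷ _ | sound ∷ _  | _ = p , sound

deg-sum : (P : Family n) (S : Subset n) (L : List (Subset n)) →
  (∀ A → T (P A) → S ⊑ A → Any (_⊑ A) L) → deg P S ≤ sum (map (deg P) L)
deg-sum P S L h = union-sum _ L (λ R A → P A ∧ (R ⊑ᵇ A)) λ A PSA →
  let PA , SA = ∧-split (P A) PSA in Any.map (λ {R} p → ∧-intro PA (⊑⇒⊑ᵇ R A p)) (h A PA (⊑ᵇ⇒⊑ S A SA))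

-- Three distinct cells of a 2 × 2 grid are all but one of its cells; the cell diagonally opposite
-- to the omitted one is among them together with both its neighbours.
corner : (R : Bool → Bool → Set) → ∀ {i₁ j₁ i₂ j₂ i₃ j₃} → R i₁ j₁ → R i₂ j₂ → R i₃ j₃ →
  ¬ (i₁ ≡ i₂ × j₁ ≡ j₂) → ¬ (i₁ ≡ i₃ × j₁ ≡ j₃) → ¬ (i₂ ≡ i₃ × j₂ ≡ j₃) →
  ∃₂ λ i j → R i j × R i (not j) × R (not i) j
corner R {i} {j} {i₂} {j₂} {i₃} {j₃} r₁ r₂ r₃ d₁₂ d₁₃ d₂₃ with same? i i₂ | same? j j₂ | same? i i₃ | same? j j₃
  where
  same? : ∀ i i′ → i ≡ i′ ⊎ not i ≡ i′
  same? true  true  = inj₁ refl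
  same? true  false = inj₂ refl
  same? false true  = inj₂ refl
  same? false false = inj₁ refl
... | inj₁ e    | inj₁ e′   | _         | _         = ⊥-elim (d₁₂ (e , e′))
... | _         | _         | inj₁ e    | inj₁ e′   = ⊥-elim (d₁₃ (e , e′))
... | inj₁ refl | inj₂ refl | inj₁ refl | inj₂ refl = ⊥-elim (d₂₃ (refl , refl))
... | inj₂ refl | inj₁ refl | inj₂ refl | inj₁ refl = ⊥-elim (d₂₃ (refl , refl))
... | inj₂ refl | inj₂ refl | inj₂ refl | inj₂ refl = ⊥-elim (d₂₃ (refl , refl))
... | inj₁ refl | inj₂ refl | inj₂ refl | inj₁ refl = i , j , r₁ , r₂ , r₃
... | inj₂ refl | inj₁ refl | inj₁ refl | inj₂ refl = i , j , r₁ , r₃ , r₂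
... | inj₁ refl | inj₂ refl | inj₂ refl | inj₂ refl = i , not j , r₂ , subst (R i) (sym (not-involutive j)) r₁ , r₃
... | inj₂ refl | inj₂ refl | inj₁ refl | inj₂ refl = i , not j , r₃ , subst (R i) (sym (not-involutive j)) r₁ , r₂
... | inj₂ refl | inj₁ refl | inj₂ refl | inj₂ refl = not i , j , r₂ , r₃ , subst (λ i → R i j) (sym (not-involutive i)) r₁
... | inj₂ refl | inj₂ refl | inj₂ refl | inj₁ refl = not i , j , r₃ , r₂ , subst (λ i → R i j) (sym (not-involutive i)) r₁

-- With g = f + d, the square of f + g exceeds 4 f g by d². Assuming the order avoids subtraction.
ordered-product≤square : ∀ {f g} m → f ≤ g → f + g ≤ 2 * m → f * g ≤ m * m
ordered-product≤square {f} m f≤g h with m≤n⇒∃[o]m+o≡n f≤g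
... | d , refl = *-cancelˡ-≤ 4 (begin
  4 * (f * (f + d))                     ≤⟨ ≤-gap (d * d) (gap f d) ⟩
  (f + (f + d)) * (f + (f + d))         ≤⟨ *-mono-≤ h h ⟩
  2 * m * (2 * m)                       ≡⟨ four m ⟩
  4 * (m * m)                           ∎)
  where
  open ≤-Reasoning
  gap : ∀ f d → 4 * (f * (f + d)) + d * d ≡ (f + (f + d)) * (f + (f + d))
  gap = solve-∀
  four : ∀ m → 2 * m * (2 * m) ≡ 4 * (m * m)
  four = solve-∀

product≤square : ∀ {f g} m → f + g ≤ 2 * m → f * g ≤ m * m
product≤square {f} {g} m h with ≤-total f g
... | inj₁ f≤g = ordered-product≤square m f≤g h
... | inj₂ g≤f = ≤-trans (≤-reflexive (*-comm f g)) (ordered-product≤square m g≤f (≤-trans (≤-reflexive (+-comm g f)) h))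

∸-shift : ∀ n s j → s + j ≤ n → n ∸ s ≡ j + (n ∸ (s + j))
∸-shift n s j s+j≤n = sym (begin
  j + (n ∸ (s + j))   ≡⟨ cong (j +_) (∸-+-assoc n s j) ⟨
  j + (n ∸ s ∸ j)     ≡⟨ m+[n∸m]≡n (m+n≤o⇒m≤o∸n j (≤-trans (≤-reflexive (+-comm j s)) s+j≤n)) ⟩
  n ∸ s               ∎)
  where open ≡-Reasoning

choose-+ : ∀ m j s → choose m (s + j) s ≡ m C j
choose-+ m j zero    = refl
choose-+ m j (suc s) = choose-+ m j s

-- Inclusions, intersections and intervals as they occur in the definitions

⊑⇒⊆ : (S A : Subset n) → S ⊑ A → S ⊆ A
⊑⇒⊆ (inside  ∷ S) (inside  ∷ A) h here      = here
⊑⇒⊆ (x       ∷ S) (inside  ∷ A) h (there i) = there (⊑⇒⊆ S A (≤-trans (≤-reflexive (tail≡ x)) h) i)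
  where
  tail≡ : ∀ x → ∣ S ∩ ∁ A ∣ ≡ ∣ (x ∷ S) ∩ ∁ (inside ∷ A) ∣
  tail≡ true  = refl
  tail≡ false = refl
⊑⇒⊆ (outside ∷ S) (outside ∷ A) h (there i) = there (⊑⇒⊆ S A h i)

⊑-antisym : (A B : Subset n) → A ⊑ B → B ⊑ A → A ≡ B
⊑-antisym []            []            h h′ = refl
⊑-antisym (inside  ∷ A) (inside  ∷ B) h h′ = cong (inside ∷_) (⊑-antisym A B h h′)
⊑-antisym (outside ∷ A) (outside ∷ B) h h′ = cong (outside ∷_) (⊑-antisym A B h h′)

⊑⊤ : (S : Subset n) → S ⊑ ⊤
⊑⊤ []            = z≤n
⊑⊤ (inside  ∷ S) = ⊑⊤ S
⊑⊤ (outside ∷ S) = ⊑⊤ S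

⊑⋂ : (S : Subset n) (L : List (Subset n)) → All (S ⊑_) L → S ⊑ ⋂ L
⊑⋂ S []      []       = ⊑⊤ S
⊑⋂ S (A ∷ L) (h ∷ hs) = linear (S ∷ A ∷ ⋂ L ∷ []) [] (λ s a b → (# (s ⊓ˢ -ˢ a) ≼ lit 0) ∷ (# (s ⊓ˢ -ˢ b) ≼ lit 0) ∷ [] ⊢ # (s ⊓ˢ -ˢ (a ⊓ˢ b)) ≼ lit 0) (h , ⊑⋂ S L hs , tt)

∖≡∩∁ : (X Y : Subset n) → X ∖ Y ≡ X ∩ ∁ Y
∖≡∩∁ []      []      = refl
∖≡∩∁ (x ∷ X) (y ∷ Y) = cong (_ ∷_) (∖≡∩∁ X Y)

range-0 : range {n} 0 ≡ ⊥
range-0 {zero}  = refl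
range-0 {suc n} = cong (outside ∷_) range-0

∣range∣ : ∀ n m → m ≤ n → ∣ range {n} m ∣ ≡ m
∣range∣ n       zero    _   = trans (cong ∣_∣ (range-0 {n})) (∣⊥∣≡0 n)
∣range∣ (suc n) (suc m) m≤n = cong suc (∣range∣ n m (s≤s⁻¹ m≤n))

interval≡ : ∀ n t k → t ≤ k → interval {n} (suc t) k ≡ range k ∩ ∁ (range t)
interval≡ zero    t       k       _   = refl
interval≡ (suc n) zero    zero    _   = cong (outside ∷_) (interval≡ n zero zero z≤n)
interval≡ (suc n) zero    (suc k) _   = cong (inside ∷_) (interval≡ n zero k z≤n)
interval≡ (suc n) (suc t) (suc k) t≤k = cong (outside ∷_) (interval≡ n t k (s≤s⁻¹ t≤k))

single≡ : ∀ {n} (i : Fin n) → single (suc (toℕ i)) ≡ ⁅ i ⁆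
single≡ zero    = cong (inside ∷_) range-0
single≡ (suc i) = cong (outside ∷_) (single≡ i)

element : (E : Subset n) → 1 ≤ ∣ E ∣ → ∃ λ i → ⁅ i ⁆ ⊑ E
element (inside  ∷ E) _ = zero , ⊥⊑ E
element (outside ∷ E) h = let i , i∈E = element E h in suc i , i∈E

range-index : ∀ {n} t (i : Fin n) → ⁅ i ⁆ ⊑ range t → toℕ i < t
range-index (suc t) zero    _ = s≤s z≤n
range-index (suc t) (suc i) h = s≤s (range-index t i h)
range-index zero    (suc i) h = ⊥-elim (n≮0 (range-index zero i h))

-- The numbers N(s) under the hypothesis on n

module Extremal (n t c : ℕ) (t≥1 : 1 ≤ t) (k≥5 : 5 ≤ suc t + c)
  (n≥ : 4 * ((t + 2) * (t + 2) * ((suc t + c) * (suc t + c))) ≤ n) where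

  -- Writing k = t + 1 + c avoids subtraction: k - t - 1 is `c`, and the size k - t + 1 of the
  -- interval [t+1, k+1] is `c + 2`.
  k a κ : ℕ
  k = suc t + c
  a = t + 2
  κ = a * a * (k * k)

  -- The number of k-sets containing a given s-set.
  N : ℕ → ℕ
  N s = choose (n ∸ s) k s

  a≥3 : 3 ≤ a
  a≥3 = +-monoˡ-≤ 2 t≥1

  t≤k : t ≤ k
  t≤k = ≤-trans (n≤1+n t) (m≤m+n (suc t) c)

  k≤κ : k ≤ κ
  k≤κ = begin
    k               ≡⟨ *-identityˡ k ⟨
    1 * k           ≤⟨ *-mono-≤ {1} {a * a} (*-mono-≤ {1} {a} {1} {a} 1≤a 1≤a) (m≤m*n k k) ⟩
    a * a * (k * k) ∎
    where
    open ≤-Reasoning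
    1≤a : 1 ≤ a
    1≤a = ≤-trans (s≤s z≤n) a≥3

  -- One of the four copies of `κ` is given up to absorb s ≤ k, so that n - s ≥ 3κ in every ratio
  -- N(s+1) / N(s).
  3κ+k≤n : 3 * κ + k ≤ n
  3κ+k≤n = linearℕ (κ ∷ k ∷ n ∷ []) (λ κ k n → (k ≼ κ) ∷ (4 · κ ≼ n) ∷ [] ⊢ 3 · κ ⊕ k ≼ n) (k≤κ , n≥ , tt)

  k≤n : k ≤ n
  k≤n = ≤-trans (m≤n+m k (3 * κ)) 3κ+k≤n

  N-step : ∀ s → s < n → (n ∸ s) * N (suc s) ≡ (k ∸ s) * N s
  N-step s s<n = begin
    (n ∸ s) * N (suc s)                          ≡⟨ cong (_* N (suc s)) n∸s ⟩
    suc (n ∸ suc s) * N (suc s)                  ≡⟨ choose-absorb (n ∸ suc s) k s ⟨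
    (k ∸ s) * choose (suc (n ∸ suc s)) k s       ≡⟨ cong (λ m → (k ∸ s) * choose m k s) (sym n∸s) ⟩
    (k ∸ s) * N s                                ∎
    where
    open ≡-Reasoning
    n∸s : n ∸ s ≡ suc (n ∸ suc s)
    n∸s = +-∸-assoc 1 s<n

  N-decay : ∀ s → s ≤ k → 3 * κ * N (suc s) ≤ (k ∸ s) * N s
  N-decay s s≤k = ≤-trans (*-monoˡ-≤ (N (suc s)) 3κ≤n∸s) (≤-reflexive (N-step s s<n))
    where
    3κ+s≤n : 3 * κ + s ≤ n
    3κ+s≤n = ≤-trans (+-monoʳ-≤ (3 * κ) s≤k) 3κ+k≤n
    3κ≤n∸s : 3 * κ ≤ n ∸ s
    3κ≤n∸s = m+n≤o⇒m≤o∸n (3 * κ) 3κ+s≤n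
    s<n : s < n
    s<n = ≤-trans (+-monoˡ-≤ s (≤-trans (≤-trans (s≤s z≤n) k≥5) (≤-trans k≤κ (m≤n*m κ 3)))) 3κ+s≤n

  -- Of the two factors k in `κ`, one cancels against `k ∸ s`; the other remains to pay for a
  -- branching step.
  N-mono : ∀ s → s ≤ k → 3 * (a * a) * (k * N (suc s)) ≤ N s
  N-mono s s≤k = *-cancelˡ-≤ k (begin
    k * (3 * (a * a) * (k * N (suc s)))  ≡⟨ regroup k (a * a) (N (suc s)) ⟩
    3 * κ * N (suc s)                    ≤⟨ N-decay s s≤k ⟩
    (k ∸ s) * N s                        ≤⟨ *-monoˡ-≤ (N s) (m∸n≤m k s) ⟩
    k * N s                              ∎)
    where
    open ≤-Reasoning
    regroup : ∀ k b m → k * (3 * b * (k * m)) ≡ 3 * (b * (k * k)) * m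
    regroup = solve-∀

  x y z : ℕ
  x = N (suc t)
  y = N (2 + t)
  z = N (3 + t)

  y-decay : 3 * κ * y ≤ c * x
  y-decay = ≤-trans (N-decay (suc t) (m≤m+n (suc t) c)) (≤-reflexive (cong (_* x) (m+n∸m≡n t c)))

  N-vanish : ∀ s → k < s → N s ≡ 0
  N-vanish s k<s = go (n ∸ s) k s k<s
    where
    go : ∀ m k s → k < s → choose m k s ≡ 0
    go m zero    (suc s) _   = refl
    go m (suc k) (suc s) k<s = go m k s (s≤s⁻¹ k<s)

  z-decay : 3 * κ * z ≤ c * y
  z-decay with ≤-total (2 + t) k
  ... | inj₁ 2+t≤k = ≤-trans (N-decay (2 + t) 2+t≤k) (*-monoˡ-≤ y (≤-trans (∸-monoʳ-≤ k (n≤1+n (suc t))) (≤-reflexive (m+n∸m≡n t c))))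
  ... | inj₂ k≤2+t = ≤-trans (≤-reflexive (trans (cong (3 * κ *_) (N-vanish (3 + t) (s≤s k≤2+t))) (*-zeroʳ (3 * κ)))) z≤n

  -- ∣P∣ ∣Q∣ is at most bound r′ * bound r if the least covers of P and Q have t + r′ and t + r elements.
  bound : ℕ → ℕ
  bound r = ((t + r) C t) * (k ^ r * N (t + r))

  -- The ratio of the binomials is (t+r+1)/(r+1) ≤ t + 2. This factor and the additional k are
  -- absorbed by the decay from N(t+r) to N(t+r+1). For t + r > k the left side is zero.
  bound-step : ∀ r → bound (suc r) ≤ bound r
  bound-step r with ≤-<-connex (t + r) k
  ... | inj₂ k<t+r
    rewrite N-vanish (t + suc r) (≤-trans k<t+r (+-monoʳ-≤ t (n≤1+n r))) | *-zeroʳ (k ^ suc r) | *-zeroʳ ((t + suc r) C t) = z≤n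
  ... | inj₁ t+r≤k = *-cancelˡ-≤ (suc r) (begin
    suc r * bound (suc r)                      ≡⟨ *-assoc (suc r) ((t + suc r) C t) _ ⟨
    suc r * ((t + suc r) C t) * (k ^ suc r * N (t + suc r))
      ≡⟨ cong₂ (λ u v → u * (k ^ suc r * N v)) (C-sym-absorb t r) (+-suc t r) ⟩
    (t + suc r) * b * (k * k ^ r * w)          ≤⟨ *-monoˡ-≤ (k * k ^ r * w) (*-monoˡ-≤ b t+1+r≤) ⟩
    suc r * a * b * (k * k ^ r * w)            ≡⟨ regroup (suc r) a b k (k ^ r) w ⟩
    suc r * (b * (k ^ r * (a * (k * w))))      ≤⟨ *-monoʳ-≤ (suc r) (*-monoʳ-≤ b (*-monoʳ-≤ (k ^ r) akw≤)) ⟩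
    suc r * bound r                            ∎)
    where
    open ≤-Reasoning
    b = (t + r) C t
    w = N (suc (t + r))
    regroup : ∀ r a b k e w → r * a * b * (k * e * w) ≡ r * (b * (e * (a * (k * w))))
    regroup = solve-∀
    t+1+r≤ : t + suc r ≤ suc r * a
    t+1+r≤ = ≤-gap (1 + r + r * t) (gap t r)
      where
      gap : ∀ t r → t + suc r + (1 + r + r * t) ≡ suc r * (t + 2)
      gap = solve-∀
    akw≤ : a * (k * w) ≤ N (t + r)
    akw≤ = ≤-trans (*-monoˡ-≤ (k * w) (≤-trans (m≤m*n a a) (m≤n*m (a * a) 3))) (N-mono (t + r) t+r≤k)
      where instance a≢0 = >-nonZero (≤-trans (s≤s z≤n) a≥3)

  bound-antitone : ∀ {r r′} → r ≤ r′ → bound r′ ≤ bound r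
  bound-antitone r≤r′ = go (≤⇒≤′ r≤r′)
    where
    go : ∀ {r r′} → r ≤′ r′ → bound r′ ≤ bound r
    go (≤′-reflexive refl) = ≤-refl
    go (≤′-step {r′} p)    = ≤-trans (bound-step r′) (go p)

  bound-1 : bound 1 ≡ suc t * (k * x)
  bound-1 = cong₂ _*_ (trans (cong (_C t) (+-comm t 1)) (C-pred t)) (cong₂ _*_ (*-identityʳ k) (cong N (+-comm t 1)))

  C₂ : 2 * ((t + 2) C t) ≡ a * suc t
  C₂ = trans (C-sym-absorb t 1) (cong (a *_) (trans (sym (+-identityʳ _)) (trans (C-sym-absorb t 0) (trans (cong₂ _*_ (+-comm t 1) (trans (cong (_C t) (+-identityʳ t)) (nCn≡1 t))) (*-identityʳ (suc t))))))

  C₂≤ : 2 * ((t + 2) C t) ≤ a * a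
  C₂≤ = ≤-trans (≤-reflexive C₂) (*-monoʳ-≤ a (≤-trans (n≤1+n (suc t)) (≤-reflexive (+-comm 2 t))))

  C₃ : 6 * ((t + 3) C t) ≡ (t + 3) * (a * suc t)
  C₃ = begin
    6 * ((t + 3) C t)              ≡⟨ *-assoc 2 3 ((t + 3) C t) ⟩
    2 * (3 * ((t + 3) C t))        ≡⟨ cong (2 *_) (C-sym-absorb t 2) ⟩
    2 * ((t + 3) * ((t + 2) C t))  ≡⟨ swap 2 (t + 3) _ ⟩
    (t + 3) * (2 * ((t + 2) C t))  ≡⟨ cong ((t + 3) *_) C₂ ⟩
    (t + 3) * (a * suc t)          ∎
    where
    open ≡-Reasoning
    swap : ∀ a b c → a * (b * c) ≡ b * (a * c)
    swap = solve-∀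

  27ky≤x : 27 * (k * y) ≤ x
  27ky≤x = ≤-trans (*-monoˡ-≤ (k * y) (*-monoʳ-≤ 3 (*-mono-≤ a≥3 a≥3))) (N-mono (suc t) (m≤m+n (suc t) c))

  3aaky≤cx : 3 * (a * a) * (k * k * y) ≤ c * x
  3aaky≤cx = ≤-trans (≤-reflexive (regroup (a * a) (k * k) y)) y-decay
    where
    regroup : ∀ b k y → 3 * b * (k * y) ≡ 3 * (b * k) * y
    regroup = solve-∀

  -- The bound that two branching steps from a t-set produce.
  u : ℕ
  u = k * k * y

  -- n ≥ 4 a² k² enters the estimates through 3 a² u ≤ c x.
  27u≤ : 27 * u ≤ c * x
  27u≤ = ≤-trans (*-monoˡ-≤ u (*-monoʳ-≤ 3 (*-mono-≤ a≥3 a≥3))) 3aaky≤cx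

  9au≤ : 9 * (a * u) ≤ c * x
  9au≤ = ≤-trans (≤-reflexive (regroup a u)) (≤-trans (*-monoˡ-≤ u (*-monoʳ-≤ 3 (*-monoˡ-≤ a a≥3))) 3aaky≤cx)
    where
    regroup : ∀ a u → 9 * (a * u) ≡ 3 * (3 * a) * u
    regroup = solve-∀

  9[t+1]u≤ : 9 * (suc t * u) ≤ c * x
  9[t+1]u≤ = ≤-trans (*-monoʳ-≤ 9 (*-monoˡ-≤ u (≤-trans (n≤1+n (suc t)) (≤-reflexive (+-comm 2 t))))) 9au≤

  6C₂u≤ : 6 * (((t + 2) C t) * u) ≤ c * x
  6C₂u≤ = ≤-trans (≤-reflexive (regroup ((t + 2) C t) u)) (≤-trans (*-monoˡ-≤ u (*-monoʳ-≤ 3 C₂≤)) 3aaky≤cx)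
    where
    regroup : ∀ b u → 6 * (b * u) ≡ 3 * (2 * b) * u
    regroup = solve-∀

  bound-2 : bound 2 ≡ ((t + 2) C t) * u
  bound-2 = cong (((t + 2) C t) *_) (cong₂ _*_ (cong (k *_) (*-identityʳ k)) (cong N (+-comm t 2)))

  -- Comparing each product with max(|𝒜|², |ℋ|²)

  module Targets (α η : ℕ) (α≥ : a * x ≤ α + a * y) (η≥ : (c + 2) * x ≤ η + (c + 2) * ((c + 1) * y)) where

    V target : ℕ
    V = α ⊔ η
    target = α ^ 2 ⊔ η ^ 2

    square : ∀ m → m * m ≡ m ^ 2
    square m = cong (m *_) (sym (*-identityʳ m))

    V²≤target : V * V ≤ target
    V²≤target with ⊔-sel α η
    ... | inj₁ e rewrite e = ≤-trans (≤-reflexive (square α)) (m≤m⊔n (α ^ 2) (η ^ 2))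
    ... | inj₂ e rewrite e = ≤-trans (≤-reflexive (square η)) (m≤n⊔m (α ^ 2) (η ^ 2))

    c+1≤k : c + 1 ≤ k
    c+1≤k = ≤-trans (≤-reflexive (+-comm c 1)) (s≤s (m≤n+m c t))

    -- The correction `m * w` is at most a twentieth of `m * x`, so `v` keeps 19/20 of its leading
    -- term.
    low : ∀ m {v w} → m * x ≤ v + m * w → 27 * w ≤ x → 19 * (m * x) ≤ 20 * v
    low m {v} {w} h w≤ = linearℕ (m * x ∷ v ∷ m * w ∷ [])
      (λ X v W → (20 · X ≼ 20 · (v ⊕ W)) ∷ (20 · W ≼ X) ∷ [] ⊢ 19 · X ≼ 20 · v)
      (*-monoʳ-≤ 20 h , ≤-trans (≤-reflexive (swap 20 m w)) (*-monoʳ-≤ m (≤-trans (*-monoˡ-≤ w (≤ᵇ⇒≤ 20 27 tt)) w≤)) , tt)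
      where
      swap : ∀ a b c → a * (b * c) ≡ b * (a * c)
      swap = solve-∀

    a-low : 19 * (a * x) ≤ 20 * V
    a-low = ≤-trans (low a α≥ (≤-trans (*-monoʳ-≤ 27 (m≤n*m y k)) 27ky≤x)) (*-monoʳ-≤ 20 (m≤m⊔n α η))

    c-low : 19 * ((c + 2) * x) ≤ 20 * V
    c-low = ≤-trans (low (c + 2) η≥ (≤-trans (*-monoʳ-≤ 27 (*-monoˡ-≤ y c+1≤k)) 27ky≤x)) (*-monoʳ-≤ 20 (m≤n⊔m α η))

    -- The target is at least (19/20)² = 361/400 of (m x)², which is more than 9/10; so a product
    -- whose leading coefficient e/d is at most 9/10 of m² fits below it.
    coarse : ∀ d e m {p} .{{_ : NonZero d}} → 19 * (m * x) ≤ 20 * V → d * p ≤ e * (x * x) → 10 * e ≤ 9 * (d * (m * m)) → p ≤ target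
    coarse d e m {p} m-low p≤ e≤ = ≤-trans (*-cancelˡ-≤ (400 * d) {{m*n≢0 400 d}} (begin
      400 * d * p                         ≡⟨ *-assoc 400 d p ⟩
      400 * (d * p)                       ≤⟨ *-monoʳ-≤ 400 p≤ ⟩
      400 * (e * (x * x))                 ≡⟨ regroup₀ e x ⟩
      40 * (10 * e * (x * x))             ≤⟨ *-monoʳ-≤ 40 (*-monoˡ-≤ (x * x) e≤) ⟩
      40 * (9 * (d * (m * m)) * (x * x))  ≤⟨ ≤-gap _ (gap d m x) ⟩
      d * (19 * (m * x) * (19 * (m * x))) ≤⟨ *-monoʳ-≤ d (*-mono-≤ m-low m-low) ⟩
      d * (20 * V * (20 * V))             ≡⟨ regroup₂ d V ⟩
      400 * d * (V * V)                   ∎)) V²≤target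
      where
      open ≤-Reasoning
      regroup₀ : ∀ e x → 400 * (e * (x * x)) ≡ 40 * (10 * e * (x * x))
      regroup₀ = solve-∀
      gap : ∀ d m x → 40 * (9 * (d * (m * m)) * (x * x)) + d * (m * x * (m * x)) ≡ d * (19 * (m * x) * (19 * (m * x)))
      gap = solve-∀
      regroup₂ : ∀ d v → d * (20 * v * (20 * v)) ≡ 400 * d * (v * v)
      regroup₂ = solve-∀

    *-bounds : ∀ d d′ e e′ {p p′} → d * p ≤ e * x → d′ * p′ ≤ e′ * x → (d * d′) * (p * p′) ≤ (e * e′) * (x * x)
    *-bounds d d′ e e′ {p} {p′} h h′ =
      ≤-trans (≤-reflexive (*-interchange d d′ p p′)) (≤-trans (*-mono-≤ h h′) (≤-reflexive (*-interchange e x e′ x)))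
      where
      *-interchange : ∀ a b c d → (a * b) * (c * d) ≡ (a * c) * (b * d)
      *-interchange = solve-∀

    case-22 : ∀ {f g} → f ≤ bound 2 → g ≤ bound 2 → f * g ≤ target
    case-22 {f} {g} f≤ g≤ = coarse 36 (c * c) (c + 2) c-low (*-bounds 6 6 c c {f} {g} (6* f≤) (6* g≤)) (≤-gap _ (gap c))
      where
      6* : ∀ {f} → f ≤ bound 2 → 6 * f ≤ c * x
      6* f≤ = ≤-trans (*-monoʳ-≤ 6 (≤-trans f≤ (≤-reflexive bound-2))) 6C₂u≤
      gap : ∀ c → 10 * (c * c) + (314 * (c * c) + 1296 * c + 1296) ≡ 9 * (36 * ((c + 2) * (c + 2)))
      gap = solve-∀

    -- Two decay steps lead from `z` to `x` and contribute (3κ)²; the constant 54 is this 9 times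
    -- the 6 that clears the denominator of C(t+3, t). The remaining (t+1) · 6 C(t+3, t) · k⁴ is at
    -- most κ².
    case-13 : ∀ {p} → p ≤ bound 1 * bound 3 → p ≤ target
    case-13 {p} p≤ = coarse 54 (c * c) (c + 2) c-low
      (≤-trans (*-monoʳ-≤ 54 p≤) (*-cancelˡ-≤ (κ * κ) {{m*n≢0 κ κ {{κ≢0}} {{κ≢0}}}} (begin
        κ * κ * (54 * (bound 1 * bound 3))
          ≡⟨ cong₂ (λ v w → κ * κ * (54 * (v * w))) bound-1 (cong (λ w → ((t + 3) C t) * (k ^ 3 * w)) (cong N (+-comm t 3))) ⟩
        κ * κ * (54 * (suc t * (k * x) * (b * (k ^ 3 * z))))
          ≡⟨ regroup₁ κ (suc t) k x b z ⟩
        suc t * (6 * b) * (k * k * (k * k)) * (x * (3 * κ * (3 * κ * z)))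
          ≤⟨ *-mono-≤ (*-monoˡ-≤ (k * k * (k * k)) C≤) (*-monoʳ-≤ x zz) ⟩
        a * a * (a * a) * (k * k * (k * k)) * (x * (c * (c * x)))
          ≡⟨ regroup₂ (a * a) (k * k) x c ⟩
        κ * κ * (c * c * (x * x)) ∎)))
      (≤-gap _ (gap c))
      where
      open ≤-Reasoning
      b = (t + 3) C t
      κ≢0 : NonZero κ
      κ≢0 = >-nonZero (≤-trans (s≤s z≤n) k≤κ)
      C≤ : suc t * (6 * b) ≤ a * a * (a * a)
      C≤ = ≤-trans (≤-reflexive (cong (suc t *_) C₃)) (≤-gap _ (gap′ t))
        where
        gap′ : ∀ t → suc t * ((t + 3) * ((t + 2) * suc t)) + (t * t * t + 7 * (t * t) + 15 * t + 10) ≡ (t + 2) * (t + 2) * ((t + 2) * (t + 2))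
        gap′ = solve-∀
      zz : 3 * κ * (3 * κ * z) ≤ c * (c * x)
      zz = ≤-trans (*-monoʳ-≤ (3 * κ) z-decay) (≤-trans (≤-reflexive (swap (3 * κ) c y)) (*-monoʳ-≤ c y-decay))
        where
        swap : ∀ a b c → a * (b * c) ≡ b * (a * c)
        swap = solve-∀
      regroup₁ : ∀ κ t k x b z → κ * κ * (54 * (t * (k * x) * (b * (k * (k * (k * 1)) * z)))) ≡ t * (6 * b) * (k * k * (k * k)) * (x * (3 * κ * (3 * κ * z)))
      regroup₁ = solve-∀
      regroup₂ : ∀ a k x c → a * a * (k * k) * (x * (c * (c * x))) ≡ a * k * (a * k) * (c * c * (x * x))
      regroup₂ = solve-∀
      gap : ∀ c → 10 * (c * c) + (476 * (c * c) + 1944 * c + 1944) ≡ 9 * (54 * ((c + 2) * (c + 2)))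
      gap = solve-∀

    case-2-one : ∀ {f g} → f ≤ suc t * u → g ≤ x + ((t + 2) C t) * u → f * g ≤ target
    case-2-one {f} {g} f≤ g≤ = coarse 54 (c * (6 + c)) (c + 2) c-low
      (*-bounds 9 6 c (6 + c) {f} {g} (≤-trans (*-monoʳ-≤ 9 f≤) 9[t+1]u≤) 6g≤) (≤-gap _ (gap c))
      where
      6g≤ : 6 * g ≤ (6 + c) * x
      6g≤ = ≤-trans (*-monoʳ-≤ 6 g≤) (≤-trans (≤-reflexive (*-distribˡ-+ 6 x _)) (≤-trans (+-monoʳ-≤ (6 * x) 6C₂u≤) (≤-reflexive (sym (*-distribʳ-+ x 6 c)))))
      gap : ∀ c → 10 * (c * (6 + c)) + (476 * (c * c) + 1884 * c + 1944) ≡ 9 * (54 * ((c + 2) * (c + 2)))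
      gap = solve-∀

    case-2-two : ∀ {f g} → f ≤ 2 * u → g ≤ ((t + 2) C t) * ((c + 2) * x) → f * g ≤ target
    case-2-two {f} {g} f≤ g≤ = coarse 3 (c * (c + 2)) (c + 2) c-low (begin
      3 * (f * g)                              ≤⟨ *-monoʳ-≤ 3 (*-mono-≤ f≤ g≤) ⟩
      3 * (2 * u * (b * ((c + 2) * x)))        ≡⟨ regroup u b (c + 2) x ⟩
      3 * (2 * b) * u * ((c + 2) * x)          ≤⟨ *-monoˡ-≤ ((c + 2) * x) (≤-trans (*-monoˡ-≤ u (*-monoʳ-≤ 3 C₂≤)) 3aaky≤cx) ⟩
      c * x * ((c + 2) * x)                    ≡⟨ regroup₂ c x (c + 2) ⟩
      c * (c + 2) * (x * x)                    ∎) (≤-gap _ (gap c))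
      where
      open ≤-Reasoning
      b = (t + 2) C t
      regroup : ∀ u b m x → 3 * (2 * u * (b * (m * x))) ≡ 3 * (2 * b) * u * (m * x)
      regroup = solve-∀
      regroup₂ : ∀ c x m → c * x * (m * x) ≡ c * m * (x * x)
      regroup₂ = solve-∀
      gap : ∀ c → 10 * (c * (c + 2)) + (17 * (c * c) + 88 * c + 108) ≡ 9 * (3 * ((c + 2) * (c + 2)))
      gap = solve-∀

    case-one-one : ∀ {f g} → f ≤ x + suc t * u → g ≤ x + suc t * u → f * g ≤ target
    case-one-one {f} {g} f≤ g≤ = coarse 81 ((9 + c) * (9 + c)) (c + 2) c-low (*-bounds 9 9 (9 + c) (9 + c) {f} {g} (9* f≤) (9* g≤)) (≤-gap _ (gap c))
      where
      9* : ∀ {f} → f ≤ x + suc t * u → 9 * f ≤ (9 + c) * x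
      9* f≤ = ≤-trans (*-monoʳ-≤ 9 f≤) (≤-trans (≤-reflexive (*-distribˡ-+ 9 x _)) (≤-trans (+-monoʳ-≤ (9 * x) 9[t+1]u≤) (≤-reflexive (sym (*-distribʳ-+ x 9 c)))))
      gap : ∀ c → 10 * ((9 + c) * (9 + c)) + (719 * (c * c) + 2736 * c + 2106) ≡ 9 * (81 * ((c + 2) * (c + 2)))
      gap = solve-∀

    -- a x and (c + 2) x are the leading terms of the sizes of 𝒜 and ℋ.
    M : ℕ
    M = a ⊔ (c + 2)

    M-low : 19 * (M * x) ≤ 20 * V
    M-low with ⊔-sel a (c + 2)
    ... | inj₁ e rewrite e = a-low
    ... | inj₂ e rewrite e = c-low

    a≤M : a ≤ M
    a≤M = m≤m⊔n a (c + 2)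

    c+2≤M : c + 2 ≤ M
    c+2≤M = m≤n⊔m a (c + 2)

    -- The two entries of `M` add up to k + 3, hence to at least 8.
    M≥4 : 4 ≤ M
    M≥4 = *-cancelˡ-≤ 2 (linearℕ (t ∷ c ∷ M ∷ []) (λ t c M → (lit 5 ≼ lit 1 ⊕ t ⊕ c) ∷ (t ⊕ lit 2 ≼ M) ∷ (c ⊕ lit 2 ≼ M) ∷ [] ⊢ lit 8 ≼ 2 · M) (k≥5 , a≤M , c+2≤M , tt))

    case-two-more : ∀ {f g} → f ≤ 2 * x + 2 * u → g ≤ suc k * x → f * g ≤ target
    case-two-more {f} {g} f≤ g≤ = coarse 27 ((54 + 2 * c) * suc k) M M-low
      (*-bounds 27 1 (54 + 2 * c) (suc k) {f} {g} 27f≤ (≤-trans (≤-reflexive (+-identityʳ g)) g≤)) (poly M≥4)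
      where
      27f≤ : 27 * f ≤ (54 + 2 * c) * x
      27f≤ = ≤-trans (*-monoʳ-≤ 27 f≤) (≤-trans (≤-reflexive (distr x u)) (≤-trans (+-monoʳ-≤ (54 * x) (*-monoʳ-≤ 2 27u≤)) (≤-reflexive (undistr x c))))
        where
        distr : ∀ x u → 27 * (2 * x + 2 * u) ≡ 54 * x + 2 * (27 * u)
        distr = solve-∀
        undistr : ∀ x c → 54 * x + 2 * (c * x) ≡ (54 + 2 * c) * x
        undistr = solve-∀
      poly : 4 ≤ M → 10 * ((54 + 2 * c) * suc k) ≤ 9 * (27 * (M * M))
      -- With M = 4 + w both factors become linear in w: c ≤ M - 2, and k + 1 = a + (c + 2) - 2 ≤ 2
      -- M - 2.
      poly M≥4 with m≤n⇒∃[o]m+o≡n M≥4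
      ... | w , 4+w≡M = begin
        10 * ((54 + 2 * c) * suc k)           ≤⟨ *-monoʳ-≤ 10 (*-mono-≤ h₁ h₂) ⟩
        10 * ((58 + 2 * w) * (6 + 2 * w))     ≤⟨ ≤-gap _ (gap w) ⟩
        9 * (27 * ((4 + w) * (4 + w)))       ≡⟨ cong (λ m → 9 * (27 * (m * m))) 4+w≡M ⟩
        9 * (27 * (M * M))                   ∎
        where
        open ≤-Reasoning
        c≤ : c + 2 ≤ 4 + w
        c≤ = ≤-trans c+2≤M (≤-reflexive (sym 4+w≡M))
        a≤ : a ≤ 4 + w
        a≤ = ≤-trans a≤M (≤-reflexive (sym 4+w≡M))
        h₁ : 54 + 2 * c ≤ 58 + 2 * w
        h₁ = linearℕ (c ∷ w ∷ []) (λ c w → (c ⊕ lit 2 ≼ lit 4 ⊕ w) ∷ (c ⊕ lit 2 ≼ lit 4 ⊕ w) ∷ [] ⊢ lit 54 ⊕ 2 · c ≼ lit 58 ⊕ 2 · w) (c≤ , c≤ , tt)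
        h₂ : suc k ≤ 6 + 2 * w
        h₂ = linearℕ (t ∷ c ∷ w ∷ []) (λ t c w → (c ⊕ lit 2 ≼ lit 4 ⊕ w) ∷ (t ⊕ lit 2 ≼ lit 4 ⊕ w) ∷ [] ⊢ lit 2 ⊕ t ⊕ c ≼ lit 6 ⊕ 2 · w) (c≤ , a≤ , tt)
        gap : ∀ w → 10 * ((58 + 2 * w) * (6 + 2 * w)) + (203 * (w * w) + 664 * w + 408) ≡ 9 * (27 * ((4 + w) * (4 + w)))
        gap = solve-∀

    -- The coefficients 4 and 3 multiply to 12, which leaves room below M² ≥ 16. A second
    -- coefficient 4 would use up this room when M = 4, which is why the sharper 3 is established
    -- for one of the families. The numbers 109 and 82 are 27 · 4 + 1 and 27 · 3 + 1.
    case-far : ∀ {f g} → f ≤ 4 * x + k * y → g ≤ 3 * x + k * y → f * g ≤ target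
    case-far {f} {g} f≤ g≤ = coarse 729 (109 * 82) M M-low (*-bounds 27 27 109 82 {f} {g} (27* 4 f≤) (27* 3 g≤))
      (≤-trans (≤ᵇ⇒≤ (10 * (109 * 82)) (9 * (729 * 16)) tt) (*-monoʳ-≤ 9 (*-monoʳ-≤ 729 (*-mono-≤ M≥4 M≥4))))
      where
      27* : ∀ j {f} → f ≤ j * x + k * y → 27 * f ≤ (1 + 27 * j) * x
      27* j f≤ = ≤-trans (*-monoʳ-≤ 27 f≤) (≤-trans (≤-reflexive (distr (j * x) (k * y))) (≤-trans (+-monoˡ-≤ (27 * (j * x)) 27ky≤x) (≤-reflexive (undistr j x))))
        where
        distr : ∀ x u → 27 * (x + u) ≡ 27 * u + 27 * x
        distr = solve-∀
        undistr : ∀ j x → x + 27 * (j * x) ≡ (1 + 27 * j) * x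
        undistr = solve-∀

    -- This is (X - Y)² ≥ X² - 2XY without subtraction. It keeps the lower-order terms that `coarse`
    -- gives away.
    sqrt-bound : ∀ {α X Y p} → X ≤ α + Y → p + 2 * (X * Y) ≤ X * X → p ≤ α ^ 2
    sqrt-bound {α} {X} {Y} {p} X≤ h = ≤-trans (+-cancelʳ-≤ (2 * (X * Y)) p (α * α) (≤-trans h XX≤)) (≤-reflexive (square α))
      where
      open ≤-Reasoning
      expand : ∀ α X Y → α * (α + Y) + X * Y ≡ α * α + (α * Y + X * Y)
      expand = solve-∀
      double : ∀ m → m + m ≡ 2 * m
      double = solve-∀
      XX≤ : X * X ≤ α * α + 2 * (X * Y)
      XX≤ with ≤-total X α
      ... | inj₁ X≤α = ≤-trans (*-mono-≤ X≤α X≤α) (m≤m+n _ _)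
      ... | inj₂ α≤X = begin
        X * X                        ≤⟨ *-monoʳ-≤ X X≤ ⟩
        X * (α + Y)                  ≡⟨ *-distribˡ-+ X α Y ⟩
        X * α + X * Y                ≡⟨ cong (_+ X * Y) (*-comm X α) ⟩
        α * X + X * Y                ≤⟨ +-monoˡ-≤ (X * Y) (*-monoʳ-≤ α X≤) ⟩
        α * (α + Y) + X * Y          ≡⟨ expand α X Y ⟩
        α * α + (α * Y + X * Y)      ≤⟨ +-monoʳ-≤ (α * α) (+-monoˡ-≤ (X * Y) (*-monoˡ-≤ Y α≤X)) ⟩
        α * α + (X * Y + X * Y)      ≡⟨ cong (α * α +_) (double (X * Y)) ⟩
        α * α + 2 * (X * Y)          ∎

    -- The coefficient (t+1)(c+2) can come as close to M² as the factor (t+1)/(t+2), beyond the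
    -- reach of `coarse`. The larger of `a` and `c + 2` decides whether the comparison is with `α`
    -- or with `η`.
    case-one-two : ∀ {f g} → f ≤ x + 2 * u → g ≤ suc t * ((c + 2) * x) → f * g ≤ target
    case-one-two {f} {g} f≤ g≤ with ≤-total (c + 2) a
    ... | inj₁ c+2≤a = ≤-trans (sqrt-bound {α} {a * x} {a * y} α≥ (begin
      f * g + 2 * (a * x * (a * y))                              ≤⟨ +-monoˡ-≤ _ (*-mono-≤ f≤ (≤-trans g≤ (*-monoʳ-≤ (suc t) (*-monoˡ-≤ x c+2≤a)))) ⟩
      (x + 2 * u) * (suc t * (a * x)) + 2 * (a * x * (a * y))    ≡⟨ regroup x u (suc t) a y ⟩
      x * (a * (suc t * x + 2 * (suc t * u) + 2 * (a * y)))      ≤⟨ *-monoʳ-≤ x (*-monoʳ-≤ a inner) ⟩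
      x * (a * (a * x))                                          ≡⟨ regroup₂ x a ⟩
      a * x * (a * x)                                            ∎)) (m≤m⊔n (α ^ 2) (η ^ 2))
      where
      open ≤-Reasoning
      regroup : ∀ x u s a y → (x + 2 * u) * (s * (a * x)) + 2 * (a * x * (a * y)) ≡ x * (a * (s * x + 2 * (s * u) + 2 * (a * y)))
      regroup = solve-∀
      regroup₂ : ∀ x a → x * (a * (a * x)) ≡ a * x * (a * x)
      regroup₂ = solve-∀
      inner : suc t * x + 2 * (suc t * u) + 2 * (a * y) ≤ a * x
      inner = *-cancelˡ-≤ a {{a≢0}} (begin
        a * (suc t * x + 2 * (suc t * u) + 2 * (a * y))           ≤⟨ *-monoʳ-≤ a (+-monoʳ-≤ (suc t * x + 2 * (suc t * u)) ay≤) ⟩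
        a * (suc t * x + 2 * (suc t * u) + a * u)                 ≤⟨ ≤-gap _ (gap t x u) ⟩
        a * (suc t * x) + 3 * (a * a) * u                         ≤⟨ +-monoʳ-≤ (a * (suc t * x)) (≤-trans 3aaky≤cx (*-monoˡ-≤ x (≤-trans (m≤m+n c 2) c+2≤a))) ⟩
        a * (suc t * x) + a * x                                   ≡⟨ collect t x ⟩
        a * (a * x)                                               ∎)
        where
        a≢0 : NonZero a
        a≢0 = >-nonZero (≤-trans (s≤s z≤n) a≥3)
        ay≤ : 2 * (a * y) ≤ a * u
        ay≤ = ≤-trans (≤-reflexive (swap a y)) (*-monoʳ-≤ a (*-monoˡ-≤ y (≤-trans (≤-trans (s≤s (s≤s z≤n)) k≥5) (m≤m*n k k))))
          where
          swap : ∀ a y → 2 * (a * y) ≡ a * (2 * y)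
          swap = solve-∀
        gap : ∀ t x u → (t + 2) * (suc t * x + 2 * (suc t * u) + (t + 2) * u) + 2 * ((t + 2) * u) ≡ (t + 2) * (suc t * x) + 3 * ((t + 2) * (t + 2)) * u
        gap = solve-∀
        collect : ∀ t x → (t + 2) * (suc t * x) + (t + 2) * x ≡ (t + 2) * ((t + 2) * x)
        collect = solve-∀
    ... | inj₂ a≤c+2 = ≤-trans (sqrt-bound {η} {m * x} {m * ((c + 1) * y)} η≥ (begin
      f * g + 2 * (m * x * (m * ((c + 1) * y)))                         ≤⟨ +-monoˡ-≤ _ (*-mono-≤ f≤ g≤) ⟩
      (x + 2 * u) * (suc t * (m * x)) + 2 * (m * x * (m * ((c + 1) * y)))  ≡⟨ regroup x u (suc t) m ((c + 1) * y) ⟩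
      m * x * (suc t * x + 2 * (suc t * u) + 2 * (m * ((c + 1) * y)))   ≤⟨ *-monoʳ-≤ (m * x) inner ⟩
      m * x * (m * x)                                                   ∎)) (m≤n⊔m (α ^ 2) (η ^ 2))
      where
      open ≤-Reasoning
      m = c + 2
      regroup : ∀ x u s m w → (x + 2 * u) * (s * (m * x)) + 2 * (m * x * (m * w)) ≡ m * x * (s * x + 2 * (s * u) + 2 * (m * w))
      regroup = solve-∀
      inner : suc t * x + 2 * (suc t * u) + 2 * (m * ((c + 1) * y)) ≤ m * x
      inner = *-cancelˡ-≤ (3 * a) {{m*n≢0 3 a {{_}} {{>-nonZero (≤-trans (s≤s z≤n) a≥3)}}}} (begin
        3 * a * (suc t * x + 2 * (suc t * u) + 2 * (m * ((c + 1) * y)))  ≤⟨ *-monoʳ-≤ (3 * a) (+-monoʳ-≤ (suc t * x + 2 * (suc t * u)) (*-monoʳ-≤ 2 w≤u)) ⟩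
        3 * a * (suc t * x + 2 * (suc t * u) + 2 * u)                    ≡⟨ expand t x u ⟩
        3 * a * (suc t * x) + 2 * (3 * (a * a) * u)                      ≤⟨ +-monoʳ-≤ (3 * a * (suc t * x)) (*-monoʳ-≤ 2 3aaky≤cx) ⟩
        3 * a * (suc t * x) + 2 * (c * x)                                ≡⟨ collect (3 * a) (suc t) x c ⟩
        (3 * a * suc t + 2 * c) * x                                      ≤⟨ *-monoˡ-≤ x poly ⟩
        3 * a * m * x                                                    ≡⟨ *-assoc (3 * a) m x ⟩
        3 * a * (m * x)                                                  ∎)
        where
        c+2≤k : c + 2 ≤ k
        c+2≤k = linearℕ (t ∷ c ∷ []) (λ t c → (lit 1 ≼ t) ∷ [] ⊢ c ⊕ lit 2 ≼ lit 1 ⊕ t ⊕ c) (t≥1 , tt)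
        w≤u : m * ((c + 1) * y) ≤ u
        w≤u = ≤-trans (≤-reflexive (sym (*-assoc m (c + 1) y))) (*-monoˡ-≤ y (*-mono-≤ c+2≤k c+1≤k))
        expand : ∀ t x u → 3 * (t + 2) * (suc t * x + 2 * (suc t * u) + 2 * u) ≡ 3 * (t + 2) * (suc t * x) + 2 * (3 * ((t + 2) * (t + 2)) * u)
        expand = solve-∀
        collect : ∀ a s x c → a * (s * x) + 2 * (c * x) ≡ (a * s + 2 * c) * x
        collect = solve-∀
        poly : 3 * a * suc t + 2 * c ≤ 3 * a * m
        poly with m≤n⇒∃[o]m+o≡n (+-cancelʳ-≤ 2 t c a≤c+2)
        ... | e , refl = ≤-gap _ (gap t e)
          where
          gap : ∀ t e → 3 * (t + 2) * suc t + 2 * (t + e) + (t + 6 + 4 * e + 3 * (t * e)) ≡ 3 * (t + 2) * (t + e + 2)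
          gap = solve-∀

  -- Covers, maximal pairs and branching

  Uniform : Family n → Set
  Uniform P = ∀ A → T (P A) → ∣ A ∣ ≡ k

  Cover : Family n → Subset n → Set
  Cover P X = ∀ A → T (P A) → t ≤ ∣ X ∩ A ∣

  Missed : Family n → Subset n → Set
  Missed P X = ∃ λ A → T (P A) × ∣ X ∩ A ∣ < t

  cover? : (P : Family n) (X : Subset n) → Cover P X ⊎ Missed P X
  cover? P X with anySubset? (λ A → T? (P A) ×-dec (∣ X ∩ A ∣ <? t))
  ... | yes m = inj₂ m
  ... | no ¬m = inj₁ λ A PA → ≮⇒≥ λ lt → ¬m (A , PA , lt)

  -- The field covers holds for pairs that are maximal with respect to inclusion.
  record Pair (P Q : Family n) : Set where
    field
      uniformˡ : Uniform P
      uniformʳ : Uniform Q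
      cross    : ∀ A B → T (P A) → T (Q B) → t ≤ ∣ A ∩ B ∣
      missedˡ  : ∀ S → ∣ S ∣ ≡ t → Missed P S
      missedʳ  : ∀ S → ∣ S ∣ ≡ t → Missed Q S
      covers   : ∀ X Y → ∣ X ∣ ≡ suc t → ∣ Y ∣ ≡ suc t → Cover Q X → Cover P Y → t ≤ ∣ X ∩ Y ∣

  open Pair

  swap : ∀ {P Q} → Pair P Q → Pair Q P
  swap π = record
    { uniformˡ = uniformʳ π ; uniformʳ = uniformˡ π
    ; cross = λ A B QA PB → subst (t ≤_) (cong ∣_∣ (∩-comm B A)) (cross π B A PB QA)
    ; missedˡ = missedʳ π ; missedʳ = missedˡ π
    ; covers = λ X Y ∣X∣ ∣Y∣ PX QY → subst (t ≤_) (cong ∣_∣ (∩-comm Y X)) (covers π Y X ∣Y∣ ∣X∣ QY PX) }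

  deg≤N : ∀ {P} → Uniform P → ∀ S → deg P S ≤ N (∣ S ∣)
  deg≤N {P} uni S = begin
    deg P S                                ≤⟨ size-mono (λ A PSA → let PA , SA = ∧-split (P A) PSA in ∧-intro SA (≡⇒≡ᵇ (∣ A ∣) k (uni A PA))) ⟩
    size (λ A → (S ⊑ᵇ A) ∧ (∣ A ∣ ≡ᵇ k))   ≡⟨ size-above k S ⟩
    choose (∣ ∁ S ∣) k (∣ S ∣)             ≡⟨ cong (λ m → choose m k (∣ S ∣)) (∣∁p∣≡n∸∣p∣ S) ⟩
    N (∣ S ∣)                              ∎
    where open ≤-Reasoning

  deg≤N′ : ∀ {P} → Uniform P → ∀ S {s} → ∣ S ∣ ≡ s → deg P S ≤ N s
  deg≤N′ uni S refl = deg≤N uni S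

  size-adjoin : (S p : Subset n) → ∣ p ∣ ≡ 1 → ∣ S ∩ p ∣ ≤ 0 → ∣ S ∪ p ∣ ≡ suc (∣ S ∣)
  size-adjoin S p ∣p∣ d = ≤-antisym
    (linear (S ∷ p ∷ []) [] (λ s p → (# p ≼ lit 1) ∷ [] ⊢ # (s ⊔ˢ p) ≼ lit 1 ⊕ # s) (≤-reflexive ∣p∣ , tt))
    (linear (S ∷ p ∷ []) [] (λ s p → (lit 1 ≼ # p) ∷ (# (s ⊓ˢ p) ≼ lit 0) ∷ [] ⊢ lit 1 ⊕ # s ≼ # (s ⊔ˢ p)) (≥-reflexive ∣p∣ , d , tt))

  -- A member of `P` has at least t elements in `G`, and `S` supplies fewer than t; so a member
  -- containing `S` also contains an element of `G` outside `S`.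
  branch : ∀ {P : Family n} (S G : Subset n) {b} → (∀ A → T (P A) → t ≤ ∣ A ∩ G ∣) → ∣ S ∩ G ∣ < t →
    (∀ p → ∣ p ∣ ≡ 1 → p ⊑ G → ∣ S ∩ p ∣ ≤ 0 → deg P (S ∪ p) ≤ b) → deg P S ≤ ∣ G ∩ ∁ S ∣ * b
  branch {P} S G {b} meets S∩G<t h =
    ≤-trans (deg-branch P S (points X) (S ∪_)
      (λ A PA S⊑A → Any.map (λ (_ , p⊑A) → ∪-⊑ {S = S} S⊑A p⊑A) (point-of X A (hit A PA)))
      (All.map (λ {p} (∣p∣ , p⊑X) → h p ∣p∣
        (linear (S ∷ G ∷ p ∷ []) [] (λ s g p → (# (p ⊓ˢ -ˢ (g ⊓ˢ -ˢ s)) ≼ lit 0) ∷ [] ⊢ # (p ⊓ˢ -ˢ g) ≼ lit 0) (p⊑X , tt))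
        (linear (S ∷ G ∷ p ∷ []) [] (λ s g p → (# (p ⊓ˢ -ˢ (g ⊓ˢ -ˢ s)) ≼ lit 0) ∷ [] ⊢ # (s ⊓ˢ p) ≼ lit 0) (p⊑X , tt)))
        (subsets-sound 1 X)))
      (≤-reflexive (cong (_* b) (length-points X)))
    where
    X = G ∩ ∁ S
    hit : ∀ A → T (P A) → 1 ≤ ∣ A ∩ (G ∩ ∁ S) ∣
    hit A PA = linear (A ∷ S ∷ G ∷ []) (t ∷ [])
      (λ a s g t → (t ≼ # (a ⊓ˢ g)) ∷ (lit 1 ⊕ # (s ⊓ˢ g) ≼ t) ∷ [] ⊢ lit 1 ≼ # (a ⊓ˢ (g ⊓ˢ -ˢ s))) (meets A PA , S∩G<t , tt)

  branch-k : ∀ {P : Family n} (S G : Subset n) {b} → ∣ G ∣ ≡ k → (∀ A → T (P A) → t ≤ ∣ A ∩ G ∣) → ∣ S ∩ G ∣ < t →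
    (∀ p → ∣ p ∣ ≡ 1 → p ⊑ G → ∣ S ∩ p ∣ ≤ 0 → deg P (S ∪ p) ≤ b) → deg P S ≤ k * b
  branch-k S G {b} ∣G∣ meets lt h = ≤-trans (branch S G meets lt h) (*-monoˡ-≤ b
    (linear (S ∷ G ∷ []) (k ∷ []) (λ s g k → (# g ≼ k) ∷ [] ⊢ # (g ⊓ˢ -ˢ s) ≼ k) (≤-reflexive ∣G∣ , tt)))

  _⊆ᶠ_ : Family n → Family n → Set
  R ⊆ᶠ P = ∀ A → T (R A) → T (P A)

  -- Add to S, one at a time, elements of members of Q that S fails to meet in t elements.
  branching : ∀ {P Q R} → Pair P Q → R ⊆ᶠ P → ∀ s →
    (∀ S → t ≤ ∣ S ∣ → ∣ S ∣ < s → Missed Q S ⊎ (∀ A → T (R A) → ¬ S ⊑ A)) →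
    ∀ j S → ∣ S ∣ + j ≡ s → t ≤ ∣ S ∣ → deg R S ≤ k ^ j * N s
  branching {R = R} π R⊆P s H zero S eq t≤ =
    ≤-trans (deg≤N′ (λ A RA → uniformˡ π A (R⊆P A RA)) S (trans (sym (+-identityʳ _)) eq)) (≤-reflexive (sym (+-identityʳ _)))
  branching {R = R} π R⊆P s H (suc j) S eq t≤
    with H S t≤ (≤-trans (≤-trans (s≤s (m≤m+n (∣ S ∣) j)) (≤-reflexive (sym (+-suc (∣ S ∣) j)))) (≤-reflexive eq))
  ... | inj₂ avoids = ≤-trans (≤-reflexive (deg-avoids R S avoids)) z≤n
  ... | inj₁ (G , QG , lt) = ≤-trans
    (branch-k S G (uniformʳ π G QG) (λ A RA → cross π A G (R⊆P A RA) QG) lt λ p ∣p∣ p⊑G S∩p →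
      branching π R⊆P s H j (S ∪ p) (trans (cong (_+ j) (size-adjoin S p ∣p∣ S∩p)) (trans (sym (+-suc (∣ S ∣) j)) eq))
        (≤-trans t≤ (≤-trans (n≤1+n _) (≥-reflexive (size-adjoin S p ∣p∣ S∩p)))))
    (≤-reflexive (sym (*-assoc k (k ^ j) (N s))))

  -- If the missing member `G` meets `S` in t - 1 elements, it has k - t + 1 = c + 2 elements
  -- outside `S`, and one branching step suffices. If it meets `S` in fewer, it still misses `S`
  -- after one element has been added, and two steps along the same `G` give k² y ≤ c x.
  deg-t : ∀ {P Q} → Pair P Q → ∀ S → ∣ S ∣ ≡ t → deg P S ≤ (c + 2) * x
  deg-t {P} π S ∣S∣ with missedʳ π S ∣S∣
  ... | G , QG , lt with ≤-<-connex t (suc (∣ S ∩ G ∣))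
  ...   | inj₁ t≤ = ≤-trans
    (branch S G (λ A PA → cross π A G PA QG) lt λ p ∣p∣ p⊑G S∩p → deg≤N′ (uniformˡ π) (S ∪ p) (trans (size-adjoin S p ∣p∣ S∩p) (cong suc ∣S∣)))
    (*-monoˡ-≤ x (linear (S ∷ G ∷ []) (t ∷ c ∷ []) (λ s g t c → (# g ≼ lit 1 ⊕ t ⊕ c) ∷ (t ≼ lit 1 ⊕ # (s ⊓ˢ g)) ∷ [] ⊢ # (g ⊓ˢ -ˢ s) ≼ c ⊕ lit 2)
      (≤-reflexive (uniformʳ π G QG) , t≤ , tt)))
  ...   | inj₂ lt₂ = begin
    deg P S      ≤⟨ branch-k S G ∣G∣ meets lt (λ p ∣p∣ p⊑G S∩p →
                      branch-k (S ∪ p) G ∣G∣ meets (lt′ p ∣p∣) λ p′ ∣p′∣ p′⊑G d′ →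
                        deg≤N′ (uniformˡ π) ((S ∪ p) ∪ p′) (trans (size-adjoin (S ∪ p) p′ ∣p′∣ d′) (cong suc (trans (size-adjoin S p ∣p∣ S∩p) (cong suc ∣S∣))))) ⟩
    k * (k * y)  ≡⟨ *-assoc k k y ⟨
    u            ≤⟨ m≤n*m u 27 ⟩
    27 * u       ≤⟨ 27u≤ ⟩
    c * x        ≤⟨ *-monoˡ-≤ x (m≤m+n c 2) ⟩
    (c + 2) * x  ∎
    where
    open ≤-Reasoning
    ∣G∣ = uniformʳ π G QG
    meets : ∀ A → T (P A) → t ≤ ∣ A ∩ G ∣
    meets A PA = cross π A G PA QG
    lt′ : ∀ p → ∣ p ∣ ≡ 1 → ∣ (S ∪ p) ∩ G ∣ < t
    lt′ p ∣p∣ = linear (S ∷ p ∷ G ∷ []) (t ∷ []) (λ s p g t → (# p ≼ lit 1) ∷ (lit 2 ⊕ # (s ⊓ˢ g) ≼ t) ∷ [] ⊢ lit 1 ⊕ # ((s ⊔ˢ p) ⊓ˢ g) ≼ t)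
      (≤-reflexive ∣p∣ , lt₂ , tt)

  cover-bound : ∀ {P} T′ {b} → Cover P T′ → (∀ S → ∣ S ∣ ≡ t → deg P S ≤ b) → size P ≤ (∣ T′ ∣ C t) * b
  cover-bound {P} T′ {b} cov h = ≤-trans
    (size-branch P (subsets t T′) id (λ A PA → subsets-complete t T′ A (subst (t ≤_) (cong ∣_∣ (∩-comm T′ A)) (cov A PA)))
      (All.map (λ {S} (∣S∣ , _) → h S ∣S∣) (subsets-sound t T′)))
    (≤-reflexive (cong (_* b) (length-subsets t T′)))

  cover-bound₁ : ∀ {P} X {b} → ∣ X ∣ ≡ suc t → Cover P X → (∀ S → ∣ S ∣ ≡ t → deg P S ≤ b) → size P ≤ suc t * b
  cover-bound₁ X {b} ∣X∣ cov h = ≤-trans (cover-bound X cov h) (≤-reflexive (cong (_* b) (trans (cong (_C t) ∣X∣) (C-pred t))))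

  -- Bounds from covers with t + 1 elements

  module TwoCovers {P : Family n} {bₜ b₁ : ℕ} (h : ∀ S → ∣ S ∣ ≡ t → deg P S ≤ bₜ) (h₁ : ∀ S → ∣ S ∣ ≡ suc t → deg P S ≤ b₁)
    (X Y : Subset n) (∣X∣ : ∣ X ∣ ≡ suc t) (∣Y∣ : ∣ Y ∣ ≡ suc t) (covX : Cover P X) (covY : Cover P Y) where

    -- A member missing a point p of X ∩ Y must contain everything else of `X` and of `Y`, a set of
    -- t + 1 elements; there are t choices of p.
    adjacent : ∣ X ∩ Y ∣ ≡ t → size P ≤ bₜ + t * b₁
    adjacent ∣S∣ = ≤-trans (size-without P S) (+-mono-≤ (h S ∣S∣) (≤-trans
      (size-branch (without P S) (points S) (λ p → (X ∪ Y) ∩ ∁ p)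
        (λ A RA → Any.map (λ {p} ((∣p∣ , p⊑S) , p⊑∁A) →
          linear (X ∷ Y ∷ p ∷ A ∷ []) (t ∷ []) (λ x y p a t →
              (t ≼ # (x ⊓ˢ a)) ∷ (t ≼ # (y ⊓ˢ a)) ∷ (# x ≼ lit 1 ⊕ t) ∷ (# y ≼ lit 1 ⊕ t) ∷ (lit 1 ≼ # p) ∷ (lit 1 ≼ # p) ∷
              (# (p ⊓ˢ -ˢ (x ⊓ˢ y)) ≼ lit 0) ∷ (# (p ⊓ˢ -ˢ (x ⊓ˢ y)) ≼ lit 0) ∷ (# (p ⊓ˢ -ˢ -ˢ a) ≼ lit 0) ∷ (# (p ⊓ˢ -ˢ -ˢ a) ≼ lit 0) ∷ []
              ⊢ # (((x ⊔ˢ y) ⊓ˢ -ˢ p) ⊓ˢ -ˢ a) ≼ lit 0)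
            (covX A (PA A RA) , covY A (PA A RA) , ≤-reflexive ∣X∣ , ≤-reflexive ∣Y∣ , ≥-reflexive ∣p∣ , ≥-reflexive ∣p∣ , p⊑S , p⊑S , p⊑∁A , p⊑∁A , tt))
          (point-of S (∁ A) (miss A RA)))
        (All.map (λ {p} (∣p∣ , p⊑S) → ≤-trans (size-mono λ A q → let WA , r = ∧-split (without P S A) q in ∧-intro (PA A WA) r)
            (h₁ ((X ∪ Y) ∩ ∁ p) (≤-antisym
              (linear (X ∷ Y ∷ p ∷ []) (t ∷ []) (λ x y p t → (# x ≼ lit 1 ⊕ t) ∷ (# y ≼ lit 1 ⊕ t) ∷ (t ≼ # (x ⊓ˢ y)) ∷ (lit 1 ≼ # p) ∷ (# (p ⊓ˢ -ˢ (x ⊓ˢ y)) ≼ lit 0) ∷ []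
                  ⊢ # ((x ⊔ˢ y) ⊓ˢ -ˢ p) ≼ lit 1 ⊕ t) (≤-reflexive ∣X∣ , ≤-reflexive ∣Y∣ , ≥-reflexive ∣S∣ , ≥-reflexive ∣p∣ , p⊑S , tt))
              (linear (X ∷ Y ∷ p ∷ []) (t ∷ []) (λ x y p t → (lit 1 ⊕ t ≼ # x) ∷ (lit 1 ⊕ t ≼ # y) ∷ (# (x ⊓ˢ y) ≼ t) ∷ (# p ≼ lit 1) ∷ []
                  ⊢ lit 1 ⊕ t ≼ # ((x ⊔ˢ y) ⊓ˢ -ˢ p)) (≥-reflexive ∣X∣ , ≥-reflexive ∣Y∣ , ≤-reflexive ∣S∣ , ≤-reflexive ∣p∣ , tt)))))
          (subsets-sound 1 S)))
      (≤-reflexive (cong (_* b₁) (trans (length-points S) ∣S∣)))))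
      where
      S = X ∩ Y
      PA : ∀ A → T (without P S A) → T (P A)
      PA A RA = proj₁ (∧-split (P A) RA)
      miss : ∀ A → T (without P S A) → 1 ≤ ∣ ∁ A ∩ S ∣
      miss A RA with ⊑-dec S A
      ... | inj₁ S⊑A = ⊥-elim (not-elim (∧-right (P A) RA) (⊑⇒⊑ᵇ S A S⊑A))
      ... | inj₂ 1≤ = subst (1 ≤_) (cong ∣_∣ (∩-comm S (∁ A))) 1≤

    -- `Y` has at least two elements outside `X`, and a member omits at most one element of `Y`. So
    -- besides a t-subset of `X` it contains one of two elements fixed in advance.
    far : ∣ X ∩ Y ∣ < t → size P ≤ suc t * (2 * b₁)
    far lt with subsets 2 (Y ∩ ∁ X) | subsets-sound 2 (Y ∩ ∁ X) | subsets-complete 2 (Y ∩ ∁ X) (Y ∩ ∁ X)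
      (linear (X ∷ Y ∷ []) (t ∷ []) (λ x y t → (lit 1 ⊕ t ≼ # y) ∷ (lit 1 ⊕ # (x ⊓ˢ y) ≼ t) ∷ [] ⊢ lit 2 ≼ # ((y ⊓ˢ -ˢ x) ⊓ˢ (y ⊓ˢ -ˢ x))) (≥-reflexive ∣Y∣ , lt , tt))
    ... | [] | _ | ()
    ... | Z ∷ _ | (∣Z∣ , Z⊑) ∷ _ | _ = ≤-trans
      (size-branch P (subsets t X) id (λ A PA → subsets-complete t X A (subst (t ≤_) (cong ∣_∣ (∩-comm X A)) (covX A PA)))
        (All.map (λ {S} (∣S∣ , S⊑X) → ≤-trans
          (deg-branch P S (points Z) (S ∪_)
            (λ A PA S⊑A → Any.map (λ (_ , p⊑A) → ∪-⊑ {S = S} S⊑A p⊑A) (point-of Z A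
              (linear (X ∷ Y ∷ Z ∷ A ∷ []) (t ∷ []) (λ x y z a t → (t ≼ # (y ⊓ˢ a)) ∷ (# y ≼ lit 1 ⊕ t) ∷ (lit 2 ≼ # z) ∷ (# (z ⊓ˢ -ˢ (y ⊓ˢ -ˢ x)) ≼ lit 0) ∷ []
                ⊢ lit 1 ≼ # (a ⊓ˢ z)) (covY A PA , ≤-reflexive ∣Y∣ , ≥-reflexive ∣Z∣ , Z⊑ , tt))))
            (All.map (λ {p} (∣p∣ , p⊑Z) → h₁ (S ∪ p) (trans (size-adjoin S p ∣p∣
              (linear (X ∷ Y ∷ Z ∷ S ∷ p ∷ []) [] (λ x y z s p → (# (z ⊓ˢ -ˢ (y ⊓ˢ -ˢ x)) ≼ lit 0) ∷ (# (s ⊓ˢ -ˢ x) ≼ lit 0) ∷ (# (p ⊓ˢ -ˢ z) ≼ lit 0) ∷ []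
                ⊢ # (s ⊓ˢ p) ≼ lit 0) (Z⊑ , S⊑X , p⊑Z , tt))) (cong suc ∣S∣))) (subsets-sound 1 Z)))
          (≤-reflexive (cong (_* b₁) (trans (length-points Z) ∣Z∣)))) (subsets-sound t X)))
      (≤-reflexive (cong (_* (2 * b₁)) (trans (length-subsets t X) (trans (cong (_C t) ∣X∣) (C-pred t)))))

  Cover? : ∀ P X → Dec (Cover P X)
  Cover? P X with cover? P X
  ... | inj₁ cov = yes cov
  ... | inj₂ (A , PA , lt) = no λ cov → <⇒≱ lt (cov A PA)

  IsCover₁ : Family n → Subset n → Set
  IsCover₁ P X = ∣ X ∣ ≡ suc t × Cover P X

  -- Sets of size t + 1 coincide exactly if they share more than t elements; this form says that the
  -- list exhausts the covers without speaking of equality of sets.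
  Complete : Family n → List (Subset n) → Set
  Complete P Xs = ∀ Y → IsCover₁ P Y → Any (λ X → t < ∣ X ∩ Y ∣) Xs

  another? : ∀ P Xs → (∃ λ Y → IsCover₁ P Y × All (λ X → ∣ X ∩ Y ∣ ≤ t) Xs) ⊎ Complete P Xs
  another? P Xs with anySubset? (λ Y → (∣ Y ∣ ≟ suc t ×-dec Cover? P Y) ×-dec All.all? (λ X → ∣ X ∩ Y ∣ ≤? t) Xs)
  ... | yes found = inj₁ found
  ... | no ¬found = inj₂ λ Y cov → Any.map ≰⇒> (All.¬All⇒Any¬ (λ X → ∣ X ∩ Y ∣ ≤? t) Xs λ all → ¬found (Y , cov , all))

  module Sparse {P Q : Family n} (π : Pair P Q) (Xs : List (Subset n)) (covs : All (IsCover₁ Q) Xs) (complete : Complete Q Xs) where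

    R : Family n
    R = withoutAll P Xs

    R⊆P : R ⊆ᶠ P
    R⊆P A RA = proj₁ (withoutAll-elim P Xs A RA)

    size≤ : size P ≤ length Xs * x + size R
    size≤ = size-withoutAll P Xs (All.map (λ {X} (∣X∣ , _) → deg≤N′ (uniformˡ π) X ∣X∣) covs)

    -- A t-set is missed by non-triviality. A (t+1)-set that is a cover of `Q` is one of the listed
    -- sets, and those are contained in no member of `R`. Branching within `R` therefore always
    -- reaches t + 2 elements.
    missed : ∀ S → t ≤ ∣ S ∣ → ∣ S ∣ < 2 + t → Missed Q S ⊎ (∀ A → T (R A) → ¬ S ⊑ A)
    missed S t≤ lt with m≤n⇒m<n∨m≡n t≤
    ... | inj₂ t≡∣S∣ = inj₁ (missedʳ π S (sym t≡∣S∣))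
    ... | inj₁ t<∣S∣ with cover? Q S
    ...   | inj₂ m = inj₁ m
    ...   | inj₁ cov = inj₂ λ A RA S⊑A → clash A S⊑A (All×Any (All.zip (covs , proj₂ (withoutAll-elim P Xs A RA))) (complete S (∣S∣ , cov)))
      where
      ∣S∣ = ≤-antisym (s≤s⁻¹ lt) t<∣S∣
      clash : ∀ A → S ⊑ A → ¬ Any (λ X → (IsCover₁ Q X × ¬ X ⊑ A) × t < ∣ X ∩ S ∣) Xs
      clash A S⊑A any with Any.satisfied any
      ... | X , ((∣X∣ , _) , X⋢A) , t< = X⋢A (linear (X ∷ S ∷ A ∷ []) (t ∷ []) (λ x s a t →
        (# x ≼ lit 1 ⊕ t) ∷ (lit 1 ⊕ t ≼ # (x ⊓ˢ s)) ∷ (# (s ⊓ˢ -ˢ a) ≼ lit 0) ∷ [] ⊢ # (x ⊓ˢ -ˢ a) ≼ lit 0) (≤-reflexive ∣X∣ , t< , S⊑A , tt))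

    sparse-t : ∀ S → ∣ S ∣ ≡ t → deg R S ≤ u
    sparse-t S ∣S∣ = ≤-trans (branching π R⊆P (2 + t) missed 2 S (trans (cong (_+ 2) ∣S∣) (+-comm t 2)) (≥-reflexive ∣S∣))
      (≤-reflexive (cong (λ m → k * m * y) (*-identityʳ k)))

    sparse-1+t : ∀ S → ∣ S ∣ ≡ suc t → deg R S ≤ k * y
    sparse-1+t S ∣S∣ = ≤-trans (branching π R⊆P (2 + t) missed 1 S (trans (cong (_+ 1) ∣S∣) (+-comm (suc t) 1)) (≤-trans (n≤1+n t) (≥-reflexive ∣S∣)))
      (≤-reflexive (cong (_* y) (*-identityʳ k)))

    restrict : ∀ X → Cover P X → Cover R X
    restrict X cov A RA = cov A (R⊆P A RA)

    size-cover : ∀ X → Cover P X → size P ≤ length Xs * x + (∣ X ∣ C t) * u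
    size-cover X cov = ≤-trans size≤ (+-monoʳ-≤ (length Xs * x) (cover-bound X (restrict X cov) sparse-t))

    size-one : ∀ Y → IsCover₁ P Y → size P ≤ length Xs * x + suc t * u
    size-one Y (∣Y∣ , cov) = ≤-trans size≤ (+-monoʳ-≤ (length Xs * x) (cover-bound₁ Y ∣Y∣ (restrict Y cov) sparse-t))

    -- The far case leaves (t+1) · 2ky and the adjacent case u + t · ky; both are at most 2u because
    -- t + 1 ≤ k.
    size-two : ∀ Y Z → IsCover₁ P Y → IsCover₁ P Z → ∣ Y ∩ Z ∣ ≤ t → size P ≤ length Xs * x + 2 * u
    size-two Y Z (∣Y∣ , covY) (∣Z∣ , covZ) ≤t = ≤-trans size≤ (+-monoʳ-≤ (length Xs * x) (R≤ (m≤n⇒m<n∨m≡n ≤t)))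
      where
      open TwoCovers sparse-t sparse-1+t Y Z ∣Y∣ ∣Z∣ (restrict Y covY) (restrict Z covZ)
      *ky≤ : ∀ {m} → m ≤ k → m * (k * y) ≤ u
      *ky≤ m≤k = ≤-trans (*-monoˡ-≤ (k * y) m≤k) (≤-reflexive (sym (*-assoc k k y)))
      R≤ : ∣ Y ∩ Z ∣ < t ⊎ ∣ Y ∩ Z ∣ ≡ t → size R ≤ 2 * u
      R≤ (inj₁ lt) = begin
        size R                   ≤⟨ far lt ⟩
        suc t * (2 * (k * y))    ≡⟨ *-comm (suc t) (2 * (k * y)) ⟩
        2 * (k * y) * suc t      ≡⟨ *-assoc 2 (k * y) (suc t) ⟩
        2 * (k * y * suc t)      ≡⟨ cong (2 *_) (*-comm (k * y) (suc t)) ⟩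
        2 * (suc t * (k * y))    ≤⟨ *-monoʳ-≤ 2 (*ky≤ (m≤m+n (suc t) c)) ⟩
        2 * u                    ∎
        where open ≤-Reasoning
      R≤ (inj₂ ≡t) = ≤-trans (adjacent ≡t) (+-monoʳ-≤ u (≤-trans (*ky≤ t≤k) (≤-reflexive (sym (+-identityʳ u)))))

  -- Two covers sharing t - 1 elements

  cover-mono : ∀ {P X Y} → X ⊑ Y → Cover P X → Cover P Y
  cover-mono {X = X} {Y} X⊑Y cov A PA = linear (X ∷ Y ∷ A ∷ []) (t ∷ [])
    (λ x y a t → (# (x ⊓ˢ -ˢ y) ≼ lit 0) ∷ (t ≼ # (x ⊓ˢ a)) ∷ [] ⊢ t ≼ # (y ⊓ˢ a)) (X⊑Y , cov A PA , tt)

  -- Two (t+1)-sets X, Y sharing t − 1 elements; the sets K i j are the (t+1)-sets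
  -- meeting both in t elements.
  record Quad : Set where
    field
      O p₁ p₂ q₁ q₂ : Subset n
      ∣O∣ : suc (∣ O ∣) ≡ t
      ∣p₁∣ : ∣ p₁ ∣ ≡ 1
      ∣p₂∣ : ∣ p₂ ∣ ≡ 1
      ∣q₁∣ : ∣ q₁ ∣ ≡ 1
      ∣q₂∣ : ∣ q₂ ∣ ≡ 1
      -- The five parts have t - 1 + 4 elements in total, so this single inequality says that they
      -- are pairwise disjoint.
      disjoint : 3 + t ≤ ∣ O ∪ (p₁ ∪ (p₂ ∪ (q₁ ∪ q₂))) ∣

    p q : Bool → Subset n
    p i = if i then p₁ else p₂
    q j = if j then q₁ else q₂

    K : Bool → Bool → Subset n
    K i j = O ∪ (p i ∪ q j)

    X Y : Subset n
    X = O ∪ (p₁ ∪ p₂)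
    Y = O ∪ (q₁ ∪ q₂)

    pick : ∀ A → O ⊑ A → t ≤ ∣ X ∩ A ∣ → t ≤ ∣ Y ∩ A ∣ → ∃₂ λ i j → K i j ⊑ A
    pick A O⊑A X∩A Y∩A =
      let i , pᵢ⊑A = one-of p₁ p₂ ∣p₁∣ ∣p₂∣ X∩A
          j , qⱼ⊑A = one-of q₁ q₂ ∣q₁∣ ∣q₂∣ Y∩A
      in i , j , ∪-⊑ {S = O} O⊑A (∪-⊑ {S = p i} pᵢ⊑A qⱼ⊑A)
      where
      one-of : ∀ r₁ r₂ → ∣ r₁ ∣ ≡ 1 → ∣ r₂ ∣ ≡ 1 → t ≤ ∣ (O ∪ (r₁ ∪ r₂)) ∩ A ∣ → ∃ λ i → (if i then r₁ else r₂) ⊑ A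
      one-of r₁ r₂ ∣r₁∣ ∣r₂∣ t≤ with ⊑-dec r₁ A | ⊑-dec r₂ A
      ... | inj₁ r₁⊑A | _         = true , r₁⊑A
      ... | inj₂ _    | inj₁ r₂⊑A = false , r₂⊑A
      ... | inj₂ ¬r₁  | inj₂ ¬r₂  = ⊥-elim (<⇒≱ (n<1+n 0) (linear (O ∷ r₁ ∷ r₂ ∷ A ∷ []) (t ∷ []) (λ c r₁ r₂ a t →
        (lit 1 ⊕ # c ≼ t) ∷ (# r₁ ≼ lit 1) ∷ (# r₂ ≼ lit 1) ∷ (t ≼ # ((c ⊔ˢ (r₁ ⊔ˢ r₂)) ⊓ˢ a)) ∷ (lit 1 ≼ # (r₁ ⊓ˢ -ˢ a)) ∷ (lit 1 ≼ # (r₂ ⊓ˢ -ˢ a)) ∷ []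
        ⊢ lit 1 ≼ lit 0) (≤-reflexive ∣O∣ , ≤-reflexive ∣r₁∣ , ≤-reflexive ∣r₂∣ , t≤ , ¬r₁ , ¬r₂ , tt)))

    ∣p∣ : ∀ i → ∣ p i ∣ ≡ 1
    ∣p∣ true  = ∣p₁∣
    ∣p∣ false = ∣p₂∣

    ∣q∣ : ∀ i → ∣ q i ∣ ≡ 1
    ∣q∣ true  = ∣q₁∣
    ∣q∣ false = ∣q₂∣

    disjoint′ : ∀ i j → 3 + t ≤ ∣ O ∪ (p i ∪ (p (not i) ∪ (q j ∪ q (not j)))) ∣
    disjoint′ i j = ≤-trans disjoint (go i j)
      where
      go : ∀ i j → ∣ O ∪ (p₁ ∪ (p₂ ∪ (q₁ ∪ q₂))) ∣ ≤ ∣ O ∪ (p i ∪ (p (not i) ∪ (q j ∪ q (not j)))) ∣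
      go true  true  = ≤-refl
      go true  false = linear (O ∷ p₁ ∷ p₂ ∷ q₁ ∷ q₂ ∷ []) [] (λ c p₁ p₂ q₁ q₂ → [] ⊢ # (c ⊔ˢ (p₁ ⊔ˢ (p₂ ⊔ˢ (q₁ ⊔ˢ q₂)))) ≼ # (c ⊔ˢ (p₁ ⊔ˢ (p₂ ⊔ˢ (q₂ ⊔ˢ q₁))))) tt
      go false true  = linear (O ∷ p₁ ∷ p₂ ∷ q₁ ∷ q₂ ∷ []) [] (λ c p₁ p₂ q₁ q₂ → [] ⊢ # (c ⊔ˢ (p₁ ⊔ˢ (p₂ ⊔ˢ (q₁ ⊔ˢ q₂)))) ≼ # (c ⊔ˢ (p₂ ⊔ˢ (p₁ ⊔ˢ (q₁ ⊔ˢ q₂))))) tt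
      go false false = linear (O ∷ p₁ ∷ p₂ ∷ q₁ ∷ q₂ ∷ []) [] (λ c p₁ p₂ q₁ q₂ → [] ⊢ # (c ⊔ˢ (p₁ ⊔ˢ (p₂ ⊔ˢ (q₁ ⊔ˢ q₂)))) ≼ # (c ⊔ˢ (p₂ ⊔ˢ (p₁ ⊔ˢ (q₂ ⊔ˢ q₁))))) tt

    ∣K∣ : ∀ i j → ∣ K i j ∣ ≡ suc t
    ∣K∣ i j = ≤-antisym
      (linear (O ∷ p i ∷ q j ∷ []) (t ∷ []) (λ c p q t → (lit 1 ⊕ # c ≼ t) ∷ (# p ≼ lit 1) ∷ (# q ≼ lit 1) ∷ [] ⊢ # (c ⊔ˢ (p ⊔ˢ q)) ≼ lit 1 ⊕ t)
        (≤-reflexive ∣O∣ , ≤-reflexive (∣p∣ i) , ≤-reflexive (∣q∣ j) , tt))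
      (linear (O ∷ p i ∷ p (not i) ∷ q j ∷ q (not j) ∷ []) (t ∷ []) (λ c p p′ q q′ t → (lit 3 ⊕ t ≼ # (c ⊔ˢ (p ⊔ˢ (p′ ⊔ˢ (q ⊔ˢ q′))))) ∷ (# p′ ≼ lit 1) ∷ (# q′ ≼ lit 1) ∷ []
        ⊢ lit 1 ⊕ t ≼ # (c ⊔ˢ (p ⊔ˢ q))) (disjoint′ i j , ≤-reflexive (∣p∣ (not i)) , ≤-reflexive (∣q∣ (not j)) , tt))

    module Bound {P : Family n} (uni : Uniform P) (covX : Cover P X) (covY : Cover P Y) where

      -- A member containing `O` contains some `K i j`. A member missing some z in `O` must contain
      -- all the other t + 2 elements of X ∪ Y, which gives one `y` for each z.
      size-K : size P ≤ deg P (K true true) + (deg P (K true false) + (deg P (K false true) + deg P (K false false))) + ∣ O ∣ * y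
      size-K = ≤-trans (size-without P O) (+-mono-≤ deg-O rest)
        where
        deg-O : deg P O ≤ deg P (K true true) + (deg P (K true false) + (deg P (K false true) + deg P (K false false)))
        deg-O = ≤-trans
          (deg-sum P O (K true true ∷ K true false ∷ K false true ∷ K false false ∷ []) λ A PA O⊑A → choice (pick A O⊑A (covX A PA) (covY A PA)))
          (≤-reflexive (cong (λ m → deg P (K true true) + (deg P (K true false) + (deg P (K false true) + m))) (+-identityʳ _)))
          where
          choice : ∀ {A} → (∃₂ λ i j → K i j ⊑ A) → Any (_⊑ A) (K true true ∷ K true false ∷ K false true ∷ K false false ∷ [])
          choice (true  , true  , h) = here h
          choice (true  , false , h) = there (here h)
          choice (false , true  , h) = there (there (here h))
          choice (false , false , h) = there (there (there (here h)))
        U : Subset n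
        U = O ∪ (p₁ ∪ (p₂ ∪ (q₁ ∪ q₂)))
        ∣U∖z∣ : ∀ z → ∣ z ∣ ≡ 1 → z ⊑ O → ∣ U ∩ ∁ z ∣ ≡ 2 + t
        ∣U∖z∣ z ∣z∣ z⊑O = ≤-antisym
          (linear (O ∷ p₁ ∷ p₂ ∷ q₁ ∷ q₂ ∷ z ∷ []) (t ∷ []) (λ c p₁ p₂ q₁ q₂ z t →
            (lit 1 ⊕ # c ≼ t) ∷ (# p₁ ≼ lit 1) ∷ (# p₂ ≼ lit 1) ∷ (# q₁ ≼ lit 1) ∷ (# q₂ ≼ lit 1) ∷ (lit 1 ≼ # z) ∷ (# (z ⊓ˢ -ˢ c) ≼ lit 0) ∷ []
            ⊢ # ((c ⊔ˢ (p₁ ⊔ˢ (p₂ ⊔ˢ (q₁ ⊔ˢ q₂)))) ⊓ˢ -ˢ z) ≼ lit 2 ⊕ t)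
            (≤-reflexive ∣O∣ , ≤-reflexive ∣p₁∣ , ≤-reflexive ∣p₂∣ , ≤-reflexive ∣q₁∣ , ≤-reflexive ∣q₂∣ , ≥-reflexive ∣z∣ , z⊑O , tt))
          (linear (U ∷ z ∷ []) (t ∷ []) (λ u z t → (lit 3 ⊕ t ≼ # u) ∷ (# z ≼ lit 1) ∷ [] ⊢ lit 2 ⊕ t ≼ # (u ⊓ˢ -ˢ z)) (disjoint , ≤-reflexive ∣z∣ , tt))
        rest : size (without P O) ≤ ∣ O ∣ * y
        rest = ≤-trans
          (size-branch (without P O) (points O) (λ z → U ∩ ∁ z)
            (λ A RA → Any.map (λ {z} ((∣z∣ , z⊑O) , z⊑∁A) → inside-A A (proj₁ (∧-split (P A) RA)) z ∣z∣ z⊑O z⊑∁A) (point-of O (∁ A) (miss A RA)))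
            (All.map (λ {z} (∣z∣ , z⊑O) → deg≤N′ (λ A RA → uni A (proj₁ (∧-split (P A) RA))) (U ∩ ∁ z) (∣U∖z∣ z ∣z∣ z⊑O)) (subsets-sound 1 O)))
          (≤-reflexive (cong (_* y) (length-points O)))
          where
          miss : ∀ A → T (without P O A) → 1 ≤ ∣ ∁ A ∩ O ∣
          miss A RA with ⊑-dec O A
          ... | inj₁ O⊑A = ⊥-elim (not-elim (∧-right (P A) RA) (⊑⇒⊑ᵇ O A O⊑A))
          ... | inj₂ 1≤ = subst (1 ≤_) (cong ∣_∣ (∩-comm O (∁ A))) 1≤
          part : ∀ A r₁ r₂ z → ∣ r₁ ∣ ≡ 1 → ∣ r₂ ∣ ≡ 1 → t ≤ ∣ (O ∪ (r₁ ∪ r₂)) ∩ A ∣ → ∣ z ∣ ≡ 1 → z ⊑ O → z ⊑ ∁ A → ((O ∪ (r₁ ∪ r₂)) ∩ ∁ z) ⊑ A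
          part A r₁ r₂ z ∣r₁∣ ∣r₂∣ t≤ ∣z∣ z⊑O z⊑∁A = linear (O ∷ r₁ ∷ r₂ ∷ z ∷ A ∷ []) (t ∷ []) (λ c r₁ r₂ z a t →
            (lit 1 ⊕ # c ≼ t) ∷ (# r₁ ≼ lit 1) ∷ (# r₂ ≼ lit 1) ∷ (t ≼ # ((c ⊔ˢ (r₁ ⊔ˢ r₂)) ⊓ˢ a)) ∷ (lit 1 ≼ # z) ∷ (# (z ⊓ˢ -ˢ c) ≼ lit 0) ∷ (# (z ⊓ˢ -ˢ -ˢ a) ≼ lit 0) ∷ []
            ⊢ # (((c ⊔ˢ (r₁ ⊔ˢ r₂)) ⊓ˢ -ˢ z) ⊓ˢ -ˢ a) ≼ lit 0) (≤-reflexive ∣O∣ , ≤-reflexive ∣r₁∣ , ≤-reflexive ∣r₂∣ , t≤ , ≥-reflexive ∣z∣ , z⊑O , z⊑∁A , tt)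
          inside-A : ∀ A → T (P A) → ∀ z → ∣ z ∣ ≡ 1 → z ⊑ O → z ⊑ ∁ A → (U ∩ ∁ z) ⊑ A
          inside-A A PA z ∣z∣ z⊑O z⊑∁A = linear (O ∷ p₁ ∷ p₂ ∷ q₁ ∷ q₂ ∷ z ∷ A ∷ []) [] (λ c p₁ p₂ q₁ q₂ z a →
            (# (((c ⊔ˢ (p₁ ⊔ˢ p₂)) ⊓ˢ -ˢ z) ⊓ˢ -ˢ a) ≼ lit 0) ∷ (# (((c ⊔ˢ (q₁ ⊔ˢ q₂)) ⊓ˢ -ˢ z) ⊓ˢ -ˢ a) ≼ lit 0) ∷ []
            ⊢ # (((c ⊔ˢ (p₁ ⊔ˢ (p₂ ⊔ˢ (q₁ ⊔ˢ q₂)))) ⊓ˢ -ˢ z) ⊓ˢ -ˢ a) ≼ lit 0)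
            (part A p₁ p₂ z ∣p₁∣ ∣p₂∣ (covX A PA) ∣z∣ z⊑O z⊑∁A , part A q₁ q₂ z ∣q₁∣ ∣q₂∣ (covY A PA) ∣z∣ z⊑O z⊑∁A , tt)

      deg-K : ∀ i j → deg P (K i j) ≤ x
      deg-K i j = deg≤N′ uni (K i j) (∣K∣ i j)

      size-four : size P ≤ 4 * x + k * y
      size-four = begin
        size P                                      ≤⟨ size-K ⟩
        _ + ∣ O ∣ * y                               ≤⟨ +-mono-≤ (+-mono-≤ (deg-K true true) (+-mono-≤ (deg-K true false) (+-mono-≤ (deg-K false true) (deg-K false false)))) (*-monoˡ-≤ y O≤k) ⟩
        x + (x + (x + x)) + k * y                   ≡⟨ cong (λ m → x + (x + (x + m)) + k * y) (sym (+-identityʳ x)) ⟩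
        4 * x + k * y                               ∎
        where
        open ≤-Reasoning
        O≤k : ∣ O ∣ ≤ k
        O≤k = ≤-trans (n≤1+n _) (≤-trans (≤-reflexive ∣O∣) t≤k)

      -- If O ∪ p₁ ∪ q₂ is a cover as well, then a member containing the opposite set O ∪ p₂ ∪ q₁
      -- also contains p₁ or q₂, so that set contributes 2y instead of x.
      size-three : Cover P (K true false) → size P ≤ 3 * x + k * y
      size-three cov = begin
        size P                                      ≤⟨ size-K ⟩
        _ + ∣ O ∣ * y                               ≤⟨ +-monoˡ-≤ (∣ O ∣ * y) (+-mono-≤ (deg-K true true) (+-mono-≤ (deg-K true false) (+-mono-≤ bad (deg-K false false)))) ⟩
        x + (x + (2 * y + x)) + ∣ O ∣ * y           ≤⟨ linearℕ (x ∷ y ∷ ∣ O ∣ * y ∷ k * y ∷ []) (λ x y cy ky → (2 · y ⊕ cy ≼ ky) ∷ [] ⊢ x ⊕ (x ⊕ (2 · y ⊕ x)) ⊕ cy ≼ 3 · x ⊕ ky)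
                                                         (≤-trans (≤-reflexive (sym (*-distribʳ-+ y 2 (∣ O ∣)))) (*-monoˡ-≤ y 2+O≤k) , tt) ⟩
        3 * x + k * y                               ∎
        where
        open ≤-Reasoning
        2+O≤k : 2 + ∣ O ∣ ≤ k
        2+O≤k = ≤-trans (s≤s (≤-reflexive ∣O∣)) (m≤m+n (suc t) c)
        B : Subset n
        B = O ∪ (p₂ ∪ q₁)
        ∣B∪∣ : ∀ r → ∣ r ∣ ≡ 1 → ∣ B ∩ r ∣ ≤ 0 → ∣ B ∪ r ∣ ≡ 2 + t
        ∣B∪∣ r ∣r∣ d = trans (size-adjoin B r ∣r∣ d) (cong suc (∣K∣ false true))
        outside-B : ∣ B ∩ p₁ ∣ ≤ 0 × ∣ B ∩ q₂ ∣ ≤ 0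
        outside-B =
          linear (O ∷ p₁ ∷ p₂ ∷ q₁ ∷ q₂ ∷ []) (t ∷ []) (λ o p₁ p₂ q₁ q₂ t →
            (lit 1 ⊕ # o ≼ t) ∷ (lit 3 ⊕ t ≼ # (o ⊔ˢ (p₁ ⊔ˢ (p₂ ⊔ˢ (q₁ ⊔ˢ q₂))))) ∷ (# p₁ ≼ lit 1) ∷ (# p₂ ≼ lit 1) ∷ (# q₁ ≼ lit 1) ∷ (# q₂ ≼ lit 1) ∷ []
            ⊢ # ((o ⊔ˢ (p₂ ⊔ˢ q₁)) ⊓ˢ p₁) ≼ lit 0) hyps ,
          linear (O ∷ p₁ ∷ p₂ ∷ q₁ ∷ q₂ ∷ []) (t ∷ []) (λ o p₁ p₂ q₁ q₂ t →
            (lit 1 ⊕ # o ≼ t) ∷ (lit 3 ⊕ t ≼ # (o ⊔ˢ (p₁ ⊔ˢ (p₂ ⊔ˢ (q₁ ⊔ˢ q₂))))) ∷ (# p₁ ≼ lit 1) ∷ (# p₂ ≼ lit 1) ∷ (# q₁ ≼ lit 1) ∷ (# q₂ ≼ lit 1) ∷ []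
            ⊢ # ((o ⊔ˢ (p₂ ⊔ˢ q₁)) ⊓ˢ q₂) ≼ lit 0) hyps
          where
          hyps = ≤-reflexive ∣O∣ , disjoint , ≤-reflexive ∣p₁∣ , ≤-reflexive ∣p₂∣ , ≤-reflexive ∣q₁∣ , ≤-reflexive ∣q₂∣ , tt
        bad : deg P (K false true) ≤ 2 * y
        bad = deg-branch P B (p₁ ∷ q₂ ∷ []) (B ∪_)
          (λ A PA B⊑A → hit A PA B⊑A (⊑-dec p₁ A) (⊑-dec q₂ A))
          (deg≤N′ uni (B ∪ p₁) (∣B∪∣ p₁ ∣p₁∣ (proj₁ outside-B)) ∷ deg≤N′ uni (B ∪ q₂) (∣B∪∣ q₂ ∣q₂∣ (proj₂ outside-B)) ∷ [])
          where
          hit : ∀ A → T (P A) → B ⊑ A → p₁ ⊑ A ⊎ 1 ≤ ∣ p₁ ∩ ∁ A ∣ → q₂ ⊑ A ⊎ 1 ≤ ∣ q₂ ∩ ∁ A ∣ → Any (λ r → (B ∪ r) ⊑ A) (p₁ ∷ q₂ ∷ [])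
          hit A PA B⊑A (inj₁ h) _        = here (∪-⊑ {S = B} B⊑A h)
          hit A PA B⊑A (inj₂ _) (inj₁ h) = there (here (∪-⊑ {S = B} B⊑A h))
          hit A PA B⊑A (inj₂ h) (inj₂ h′) = ⊥-elim (<⇒≱ (n<1+n 0) (linear (O ∷ p₁ ∷ q₂ ∷ A ∷ []) (t ∷ []) (λ c p q a t →
            (lit 1 ⊕ # c ≼ t) ∷ (# p ≼ lit 1) ∷ (# q ≼ lit 1) ∷ (t ≼ # ((c ⊔ˢ (p ⊔ˢ q)) ⊓ˢ a)) ∷ (lit 1 ≼ # (p ⊓ˢ -ˢ a)) ∷ (lit 1 ≼ # (q ⊓ˢ -ˢ a)) ∷ [] ⊢ lit 1 ≼ lit 0)
            (≤-reflexive ∣O∣ , ≤-reflexive ∣p₁∣ , ≤-reflexive ∣q₂∣ , cov A PA , h , h′ , tt)))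

  module _ (X Y : Subset n) (∣X∣ : ∣ X ∣ ≡ suc t) (∣Y∣ : ∣ Y ∣ ≡ suc t) (∣X∩Y∣ : suc (∣ X ∩ Y ∣) ≡ t) where

    private
      two : (X Y : Subset n) → ∣ X ∣ ≡ suc t → suc (∣ X ∩ Y ∣) ≡ t → ∣ X ∩ ∁ Y ∣ ≡ 2
      two X Y ∣X∣ ∣X∩Y∣ = ≤-antisym
        (linear (X ∷ Y ∷ []) (t ∷ []) (λ x y t → (# x ≼ lit 1 ⊕ t) ∷ (t ≼ lit 1 ⊕ # (x ⊓ˢ y)) ∷ [] ⊢ # (x ⊓ˢ -ˢ y) ≼ lit 2) (≤-reflexive ∣X∣ , ≥-reflexive ∣X∩Y∣ , tt))
        (linear (X ∷ Y ∷ []) (t ∷ []) (λ x y t → (lit 1 ⊕ t ≼ # x) ∷ (lit 1 ⊕ # (x ⊓ˢ y) ≼ t) ∷ [] ⊢ lit 2 ≼ # (x ⊓ˢ -ˢ y)) (≥-reflexive ∣X∣ , ≤-reflexive ∣X∩Y∣ , tt))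

      other : (D p : Subset n) → ∣ D ∣ ≡ 2 → ∣ p ∣ ≡ 1 → p ⊑ D → ∣ D ∩ ∁ p ∣ ≡ 1
      other D p ∣D∣ ∣p∣ p⊑D = ≤-antisym
        (linear (D ∷ p ∷ []) [] (λ d p → (# d ≼ lit 2) ∷ (lit 1 ≼ # p) ∷ (# (p ⊓ˢ -ˢ d) ≼ lit 0) ∷ [] ⊢ # (d ⊓ˢ -ˢ p) ≼ lit 1) (≤-reflexive ∣D∣ , ≥-reflexive ∣p∣ , p⊑D , tt))
        (linear (D ∷ p ∷ []) [] (λ d p → (lit 2 ≼ # d) ∷ (# p ≼ lit 1) ∷ [] ⊢ lit 1 ≼ # (d ⊓ˢ -ˢ p)) (≥-reflexive ∣D∣ , ≤-reflexive ∣p∣ , tt))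

      D E : Subset n
      D = X ∩ ∁ Y
      E = Y ∩ ∁ X
      ∣D∣ = two X Y ∣X∣ ∣X∩Y∣
      ∣E∣ = two Y X ∣Y∣ (trans (cong (suc ∘ ∣_∣) (∩-comm Y X)) ∣X∩Y∣)
      p = a-subset 1 D (≤-trans (s≤s z≤n) (≥-reflexive ∣D∣))
      q = a-subset 1 E (≤-trans (s≤s z≤n) (≥-reflexive ∣E∣))

    quad : Quad
    quad = record
      { O = X ∩ Y ; p₁ = proj₁ p ; p₂ = D ∩ ∁ (proj₁ p) ; q₁ = proj₁ q ; q₂ = E ∩ ∁ (proj₁ q)
      ; ∣O∣ = ∣X∩Y∣
      ; ∣p₁∣ = proj₁ (proj₂ p)
      ; ∣p₂∣ = other D (proj₁ p) ∣D∣ (proj₁ (proj₂ p)) (proj₂ (proj₂ p))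
      ; ∣q₁∣ = proj₁ (proj₂ q)
      ; ∣q₂∣ = other E (proj₁ q) ∣E∣ (proj₁ (proj₂ q)) (proj₂ (proj₂ q))
      ; disjoint = linear (X ∷ Y ∷ proj₁ p ∷ proj₁ q ∷ []) (t ∷ []) (λ x y p q t →
          (lit 1 ⊕ t ≼ # x) ∷ (lit 1 ⊕ t ≼ # y) ∷ (lit 1 ⊕ # (x ⊓ˢ y) ≼ t) ∷ []
          ⊢ lit 3 ⊕ t ≼ # ((x ⊓ˢ y) ⊔ˢ (p ⊔ˢ (((x ⊓ˢ -ˢ y) ⊓ˢ -ˢ p) ⊔ˢ (q ⊔ˢ ((y ⊓ˢ -ˢ x) ⊓ˢ -ˢ q))))))
          (≥-reflexive ∣X∣ , ≥-reflexive ∣Y∣ , ≤-reflexive ∣X∩Y∣ , tt)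
      }

    X⊑quad : X ⊑ Quad.X quad
    X⊑quad = linear (X ∷ Y ∷ proj₁ p ∷ []) [] (λ x y p → [] ⊢ # (x ⊓ˢ -ˢ ((x ⊓ˢ y) ⊔ˢ (p ⊔ˢ ((x ⊓ˢ -ˢ y) ⊓ˢ -ˢ p)))) ≼ lit 0) tt

    Y⊑quad : Y ⊑ Quad.Y quad
    Y⊑quad = linear (X ∷ Y ∷ proj₁ q ∷ []) [] (λ x y q → [] ⊢ # (y ⊓ˢ -ˢ ((x ⊓ˢ y) ⊔ˢ (q ⊔ˢ ((y ⊓ˢ -ˢ x) ⊓ˢ -ˢ q)))) ≼ lit 0) tt

  module _ {P Q : Family n} (π : Pair P Q) where

    -- Both sets have at least t elements inside the (t+1)-set `W`, so they overlap there in at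
    -- least t - 1.
    distance≤2 : ∀ {X Y W} → IsCover₁ Q X → IsCover₁ Q Y → IsCover₁ P W → t ≤ suc (∣ X ∩ Y ∣)
    distance≤2 {X} {Y} {W} (∣X∣ , covX) (∣Y∣ , covY) (∣W∣ , covW) = linear (X ∷ Y ∷ W ∷ []) (t ∷ [])
      (λ x y w t → (t ≼ # (x ⊓ˢ w)) ∷ (t ≼ # (y ⊓ˢ w)) ∷ (# w ≼ lit 1 ⊕ t) ∷ [] ⊢ t ≼ lit 1 ⊕ # (x ⊓ˢ y))
      (covers π X W ∣X∣ ∣W∣ covX covW , covers π Y W ∣Y∣ ∣W∣ covY covW , ≤-reflexive ∣W∣ , tt)

    module Distant {X Y} (cX : IsCover₁ Q X) (cY : IsCover₁ Q Y) (∣X∩Y∣ : suc (∣ X ∩ Y ∣) ≡ t) where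

      κ₀ : Quad
      κ₀ = quad X Y (proj₁ cX) (proj₁ cY) ∣X∩Y∣

      module K = Quad κ₀

      size-Q : size Q ≤ 4 * x + k * y
      size-Q = K.Bound.size-four (uniformʳ π)
        (cover-mono {Q} {X} {K.X} (X⊑quad X Y (proj₁ cX) (proj₁ cY) ∣X∩Y∣) (proj₂ cX))
        (cover-mono {Q} {Y} {K.Y} (Y⊑quad X Y (proj₁ cX) (proj₁ cY) ∣X∩Y∣) (proj₂ cY))

      corner-of : ∀ W → IsCover₁ P W → ∃₂ λ i j → K.K i j ⊑ W × Cover P (K.K i j)
      corner-of W (∣W∣ , covW) =
        let i , j , K⊑W = K.pick W O⊑W (meets X K.X (X⊑quad X Y (proj₁ cX) (proj₁ cY) ∣X∩Y∣) X∩W) (meets Y K.Y (Y⊑quad X Y (proj₁ cX) (proj₁ cY) ∣X∩Y∣) Y∩W)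
        in i , j , K⊑W , cover-mono {P} {W} {K.K i j} (linear (W ∷ K.K i j ∷ []) (t ∷ []) (λ w k t → (# w ≼ lit 1 ⊕ t) ∷ (lit 1 ⊕ t ≼ # k) ∷ (# (k ⊓ˢ -ˢ w) ≼ lit 0) ∷ [] ⊢ # (w ⊓ˢ -ˢ k) ≼ lit 0)
            (≤-reflexive ∣W∣ , ≥-reflexive (K.∣K∣ i j) , K⊑W , tt)) covW
        where
        X∩W = covers π X W (proj₁ cX) ∣W∣ (proj₂ cX) covW
        Y∩W = covers π Y W (proj₁ cY) ∣W∣ (proj₂ cY) covW
        meets : ∀ X X′ → X ⊑ X′ → t ≤ ∣ X ∩ W ∣ → t ≤ ∣ X′ ∩ W ∣
        meets X X′ X⊑X′ t≤ = linear (X ∷ X′ ∷ W ∷ []) (t ∷ []) (λ x x′ w t → (# (x ⊓ˢ -ˢ x′) ≼ lit 0) ∷ (t ≼ # (x ⊓ˢ w)) ∷ [] ⊢ t ≼ # (x′ ⊓ˢ w)) (X⊑X′ , t≤ , tt)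
        O⊑W : (X ∩ Y) ⊑ W
        O⊑W = linear (X ∷ Y ∷ W ∷ []) (t ∷ []) (λ x y w t → (t ≼ # (x ⊓ˢ w)) ∷ (t ≼ # (y ⊓ˢ w)) ∷ (# w ≼ lit 1 ⊕ t) ∷ (lit 1 ⊕ # (x ⊓ˢ y) ≼ t) ∷ [] ⊢ # ((x ⊓ˢ y) ⊓ˢ -ˢ w) ≼ lit 0)
          (X∩W , Y∩W , ≤-reflexive ∣W∣ , ≤-reflexive ∣X∩Y∣ , tt)

      size-P : ∀ {W₁ W₂ W₃} → IsCover₁ P W₁ → IsCover₁ P W₂ → IsCover₁ P W₃ →
        ∣ W₁ ∩ W₂ ∣ ≤ t → ∣ W₁ ∩ W₃ ∣ ≤ t → ∣ W₂ ∩ W₃ ∣ ≤ t → size P ≤ 3 * x + k * y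
      size-P {W₁} {W₂} {W₃} c₁ c₂ c₃ d₁₂ d₁₃ d₂₃ =
        let i₁ , j₁ , s₁ , r₁ = corner-of W₁ c₁
            i₂ , j₂ , s₂ , r₂ = corner-of W₂ c₂
            i₃ , j₃ , s₃ , r₃ = corner-of W₃ c₃
            i , j , c , c′ , c″ = corner (λ i j → Cover P (K.K i j)) r₁ r₂ r₃
              (distinct W₁ W₂ d₁₂ s₁ s₂) (distinct W₁ W₃ d₁₃ s₁ s₃) (distinct W₂ W₃ d₂₃ s₂ s₃)
        in Quad.Bound.size-three (turned i j) (uniformˡ π) c′ c″ c
        where
        distinct : ∀ W W′ {i j i′ j′} → ∣ W ∩ W′ ∣ ≤ t → K.K i j ⊑ W → K.K i′ j′ ⊑ W′ → ¬ (i ≡ i′ × j ≡ j′)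
        distinct W W′ {i} {j} d s s′ (refl , refl) = <⇒≱ (n<1+n 0) (linear (W ∷ W′ ∷ K.K i j ∷ []) (t ∷ [])
          (λ w w′ k t → (# (w ⊓ˢ w′) ≼ t) ∷ (lit 1 ⊕ t ≼ # k) ∷ (# (k ⊓ˢ -ˢ w) ≼ lit 0) ∷ (# (k ⊓ˢ -ˢ w′) ≼ lit 0) ∷ [] ⊢ lit 1 ≼ lit 0)
          (d , ≥-reflexive (K.∣K∣ i j) , s , s′ , tt))
        -- The four points are paired anew: the two neighbours of the corner, which again share just
        -- `O`, become the sets `X` and `Y` of the new configuration, and the corner becomes its
        -- `K true false`.
        turned : Bool → Bool → Quad
        turned i j = record
          { O = K.O ; p₁ = K.p i ; p₂ = K.q (not j) ; q₁ = K.p (not i) ; q₂ = K.q j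
          ; ∣O∣ = K.∣O∣ ; ∣p₁∣ = K.∣p∣ i ; ∣p₂∣ = K.∣q∣ (not j) ; ∣q₁∣ = K.∣p∣ (not i) ; ∣q₂∣ = K.∣q∣ j
          ; disjoint = linear (K.O ∷ K.p i ∷ K.p (not i) ∷ K.q j ∷ K.q (not j) ∷ []) (t ∷ []) (λ o p p′ q q′ t →
              (lit 3 ⊕ t ≼ # (o ⊔ˢ (p ⊔ˢ (p′ ⊔ˢ (q ⊔ˢ q′))))) ∷ [] ⊢ lit 3 ⊕ t ≼ # (o ⊔ˢ (p ⊔ˢ (q′ ⊔ˢ (p′ ⊔ˢ q))))) (K.disjoint′ i j , tt)
          }

    -- Covers sharing t elements give (c + 2) x + t x = (k + 1) x. Covers sharing t - 1 elements
    -- give 4x + ky ≤ 5x, and 5 ≤ k.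
    size-two-covers : ∀ {X Y W} → IsCover₁ Q X → IsCover₁ Q Y → ∣ X ∩ Y ∣ ≤ t → IsCover₁ P W → size Q ≤ suc k * x
    size-two-covers {X} {Y} {W} cX cY d cW with m≤n⇒m<n∨m≡n d
    ... | inj₁ lt = begin
      size Q           ≤⟨ Distant.size-Q {X} {Y} cX cY (≤-antisym lt (distance≤2 {X} {Y} {W} cX cY cW)) ⟩
      4 * x + k * y    ≤⟨ +-monoʳ-≤ (4 * x) (≤-trans (m≤n*m (k * y) 27) 27ky≤x) ⟩
      4 * x + x        ≡⟨ +-comm (4 * x) x ⟩
      5 * x            ≤⟨ *-monoˡ-≤ x (≤-trans k≥5 (n≤1+n k)) ⟩
      suc k * x        ∎
      where open ≤-Reasoning
    ... | inj₂ ≡t = ≤-trans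
      (TwoCovers.adjacent (deg-t (swap π)) (λ S ∣S∣ → deg≤N′ (uniformʳ π) S ∣S∣) X Y (proj₁ cX) (proj₁ cY) (proj₂ cX) (proj₂ cY) ≡t)
      (≤-reflexive (collect t c x))
      where
      collect : ∀ t c x → (c + 2) * x + t * x ≡ suc (suc t + c) * x
      collect = solve-∀

  -- Three covers within a (t+2)-set

  α₀ η₀ h m₀ : ℕ
  α₀ = a * choose (n ∸ a) k (a ∸ 1) + choose (n ∸ a) k a
  m₀ = n ∸ (t + (c + 2))
  -- The number of k-sets that contain a given t-set and meet a given (k-t+1)-set disjoint from it;
  -- the subtracted sets are those avoiding the latter, and `m₀` is n - k - 1. Adding t gives |ℋ|.
  h  = N t ∸ choose m₀ k t
  η₀ = h + t

  size-near : ∀ D → ∣ D ∣ ≡ a → size (almostAbove k D) ≡ α₀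
  size-near D ∣D∣ rewrite size-almostAbove k D | ∣∁p∣≡n∸∣p∣ D | ∣D∣ = refl

  -- A point of B lies in at most two of X, Y, Z unless it is in X ∩ Y ∩ Z, hence
  -- 3t ≤ 2 ∣B ∩ (X ∪ Y ∪ Z)∣ + (t − 1).
  triangle-meets : ∀ {X Y Z B : Subset n} → ∣ X ∩ (Y ∩ Z) ∣ < t → t ≤ ∣ X ∩ B ∣ → t ≤ ∣ Y ∩ B ∣ → t ≤ ∣ Z ∩ B ∣ → t < ∣ B ∩ (X ∪ (Y ∪ Z)) ∣
  triangle-meets {X} {Y} {Z} {B} lt X∩B Y∩B Z∩B with ≤-<-connex (∣ B ∩ (X ∪ (Y ∪ Z)) ∣) t
  ... | inj₂ t< = t<
  ... | inj₁ ≤t = ⊥-elim (<⇒≱ (n<1+n 0) (linear (X ∷ Y ∷ Z ∷ B ∷ []) (t ∷ []) (λ x y z b t →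
      (lit 1 ⊕ # (x ⊓ˢ (y ⊓ˢ z)) ≼ t) ∷ (t ≼ # (x ⊓ˢ b)) ∷ (t ≼ # (y ⊓ˢ b)) ∷ (t ≼ # (z ⊓ˢ b)) ∷
      (# (b ⊓ˢ (x ⊔ˢ (y ⊔ˢ z))) ≼ t) ∷ (# (b ⊓ˢ (x ⊔ˢ (y ⊔ˢ z))) ≼ t) ∷ [] ⊢ lit 1 ≼ lit 0) (lt , X∩B , Y∩B , Z∩B , ≤t , ≤t , tt)))

  near-bound : ∀ {P} D → ∣ D ∣ ≡ a → Uniform P → (∀ A → T (P A) → t < ∣ A ∩ D ∣) → size P ≤ α₀
  near-bound {P} D ∣D∣ uni h = ≤-trans (size-mono λ A PA → ∧-intro (≤⇒≤ᵇ (linear (A ∷ D ∷ []) (t ∷ []) (λ a d t → (# d ≼ t ⊕ lit 2) ∷ (lit 1 ⊕ t ≼ # (a ⊓ˢ d)) ∷ [] ⊢ # (d ⊓ˢ -ˢ a) ≼ lit 1)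
      (≤-reflexive ∣D∣ , h A PA , tt))) (≡⇒≡ᵇ (∣ A ∣) k (uni A PA))) (≤-reflexive (size-near D ∣D∣))

  record Triple (Q : Family n) : Set where
    field
      X Y Z : Subset n
      cX : IsCover₁ Q X
      cY : IsCover₁ Q Y
      cZ : IsCover₁ Q Z
      XY : ∣ X ∩ Y ∣ ≤ t
      XZ : ∣ X ∩ Z ∣ ≤ t
      YZ : ∣ Y ∩ Z ∣ ≤ t

  module _ {P Q : Family n} (π : Pair P Q) (τ : Triple Q) (τ′ : Triple P) where
    open Triple τ
    open Triple τ′ using () renaming (X to X′; Y to Y′; Z to Z′; cX to cX′; cY to cY′; cZ to cZ′; XY to XY′; XZ to XZ′; YZ to YZ′)

    module _ (≥XY : t ≤ ∣ X ∩ Y ∣) (≥XZ : t ≤ ∣ X ∩ Z ∣) (≥YZ : t ≤ ∣ Y ∩ Z ∣) where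

      -- By inclusion and exclusion the union `D` has 3(t+1) - 3t + |X ∩ Y ∩ Z| ≤ t + 2 elements.
      -- The covers of `P` lie in `D` as well, and three distinct (t+1)-subsets of a (t+2)-set have
      -- only t - 1 elements in common, so `triangle-meets` applies to them too.
      triangle : ∣ X ∩ (Y ∩ Z) ∣ < t → size P ≤ α₀ × size Q ≤ α₀
      triangle lt = near-bound D ∣D∣ (uniformˡ π) meetsP , near-bound D ∣D∣ (uniformʳ π) meetsQ
        where
        D = X ∪ (Y ∪ Z)
        ∣D∣ : ∣ D ∣ ≡ t + 2
        ∣D∣ = ≤-antisym
          (linear (X ∷ Y ∷ Z ∷ []) (t ∷ []) (λ x y z t → (# x ≼ lit 1 ⊕ t) ∷ (# y ≼ lit 1 ⊕ t) ∷ (# z ≼ lit 1 ⊕ t) ∷ (t ≼ # (x ⊓ˢ y)) ∷ (t ≼ # (x ⊓ˢ z)) ∷ (t ≼ # (y ⊓ˢ z)) ∷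
              (lit 1 ⊕ # (x ⊓ˢ (y ⊓ˢ z)) ≼ t) ∷ [] ⊢ # (x ⊔ˢ (y ⊔ˢ z)) ≼ t ⊕ lit 2)
            (≤-reflexive (proj₁ cX) , ≤-reflexive (proj₁ cY) , ≤-reflexive (proj₁ cZ) , ≥XY , ≥XZ , ≥YZ , lt , tt))
          (linear (X ∷ Y ∷ Z ∷ []) (t ∷ []) (λ x y z t → (lit 1 ⊕ t ≼ # x) ∷ (lit 1 ⊕ t ≼ # y) ∷ (# (x ⊓ˢ y) ≼ t) ∷ [] ⊢ t ⊕ lit 2 ≼ # (x ⊔ˢ (y ⊔ˢ z)))
            (≥-reflexive (proj₁ cX) , ≥-reflexive (proj₁ cY) , XY , tt))
        meetsQ : ∀ B → T (Q B) → t < ∣ B ∩ D ∣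
        meetsQ B QB = triangle-meets {X} {Y} {Z} {B} lt (proj₂ cX B QB) (proj₂ cY B QB) (proj₂ cZ B QB)
        inD : ∀ W → IsCover₁ P W → W ⊑ D
        inD W (∣W∣ , covW) = linear (W ∷ D ∷ []) (t ∷ []) (λ w d t → (# w ≼ lit 1 ⊕ t) ∷ (lit 1 ⊕ t ≼ # (w ⊓ˢ d)) ∷ [] ⊢ # (w ⊓ˢ -ˢ d) ≼ lit 0)
          (≤-reflexive ∣W∣ , triangle-meets {X} {Y} {Z} {W} lt (covers π X W (proj₁ cX) ∣W∣ (proj₂ cX) covW) (covers π Y W (proj₁ cY) ∣W∣ (proj₂ cY) covW) (covers π Z W (proj₁ cZ) ∣W∣ (proj₂ cZ) covW) , tt)
        X′⊑D = inD X′ cX′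
        Y′⊑D = inD Y′ cY′
        Z′⊑D = inD Z′ cZ′
        lt′ : ∣ X′ ∩ (Y′ ∩ Z′) ∣ < t
        lt′ = linear (X′ ∷ Y′ ∷ Z′ ∷ D ∷ []) (t ∷ []) (λ x y z d t → (lit 1 ⊕ t ≼ # x) ∷ (lit 1 ⊕ t ≼ # y) ∷ (lit 1 ⊕ t ≼ # z) ∷ (# (x ⊓ˢ y) ≼ t) ∷ (# (x ⊓ˢ z) ≼ t) ∷ (# (y ⊓ˢ z) ≼ t) ∷
            (# d ≼ t ⊕ lit 2) ∷ (# (x ⊓ˢ -ˢ d) ≼ lit 0) ∷ (# (y ⊓ˢ -ˢ d) ≼ lit 0) ∷ (# (z ⊓ˢ -ˢ d) ≼ lit 0) ∷ [] ⊢ lit 1 ⊕ # (x ⊓ˢ (y ⊓ˢ z)) ≼ t)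
          (≥-reflexive (proj₁ cX′) , ≥-reflexive (proj₁ cY′) , ≥-reflexive (proj₁ cZ′) , XY′ , XZ′ , YZ′ , ≤-reflexive ∣D∣ , X′⊑D , Y′⊑D , Z′⊑D , tt)
        meetsP : ∀ A → T (P A) → t < ∣ A ∩ D ∣
        meetsP A PA = linear (A ∷ X′ ∷ Y′ ∷ Z′ ∷ D ∷ []) (t ∷ []) (λ a x y z d t → (lit 1 ⊕ t ≼ # (a ⊓ˢ (x ⊔ˢ (y ⊔ˢ z)))) ∷ (# (x ⊓ˢ -ˢ d) ≼ lit 0) ∷ (# (y ⊓ˢ -ˢ d) ≼ lit 0) ∷ (# (z ⊓ˢ -ˢ d) ≼ lit 0) ∷ []
            ⊢ lit 1 ⊕ t ≼ # (a ⊓ˢ d))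
          (triangle-meets {X′} {Y′} {Z′} {A} lt′ (proj₂ cX′ A PA) (proj₂ cY′ A PA) (proj₂ cZ′ A PA) , X′⊑D , Y′⊑D , Z′⊑D , tt)

  -- Three covers through a common t-set

  module Star {P : Family n} (uni : Uniform P) (τ : Triple P) (S : Subset n) (∣S∣ : ∣ S ∣ ≡ t)
    (S⊑X : S ⊑ Triple.X τ) (S⊑Y : S ⊑ Triple.Y τ) (S⊑Z : S ⊑ Triple.Z τ) where
    open Triple τ

    nearly : ∀ A → T (P A) → t ≤ suc (∣ S ∩ A ∣)
    nearly A PA = linear (X ∷ S ∷ A ∷ []) (t ∷ []) (λ x s a t → (# x ≼ lit 1 ⊕ t) ∷ (t ≼ # s) ∷ (# (s ⊓ˢ -ˢ x) ≼ lit 0) ∷ (t ≼ # (x ⊓ˢ a)) ∷ []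
      ⊢ t ≼ lit 1 ⊕ # (s ⊓ˢ a)) (≤-reflexive (proj₁ cX) , ≥-reflexive ∣S∣ , S⊑X , proj₂ cX A PA , tt)

    -- A member missing z in `S` contains the rest of each of the three covers, that is, t - 1
    -- elements of `S` and three further ones.
    rest : size (without P S) ≤ t * y
    rest = ≤-trans
      (size-branch (without P S) (points S) (λ z → U ∩ ∁ z)
        (λ A RA → Any.map (λ {z} ((∣z∣ , z⊑S) , z⊑∁A) → inside-A A (proj₁ (∧-split (P A) RA)) z ∣z∣ z⊑S z⊑∁A) (point-of S (∁ A) (miss A RA)))
        (All.map (λ {z} (∣z∣ , z⊑S) → deg≤N′ (λ A RA → uni A (proj₁ (∧-split (P A) RA))) (U ∩ ∁ z) (∣U∖z∣ z ∣z∣ z⊑S)) (subsets-sound 1 S)))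
      (≤-reflexive (cong (_* y) (trans (length-points S) ∣S∣)))
      where
      U : Subset n
      U = X ∪ (Y ∪ Z)
      miss : ∀ A → T (without P S A) → 1 ≤ ∣ ∁ A ∩ S ∣
      miss A RA with ⊑-dec S A
      ... | inj₁ S⊑A = ⊥-elim (not-elim (∧-right (P A) RA) (⊑⇒⊑ᵇ S A S⊑A))
      ... | inj₂ 1≤ = subst (1 ≤_) (cong ∣_∣ (∩-comm S (∁ A))) 1≤
      part : ∀ {X} → IsCover₁ P X → S ⊑ X → ∀ A → T (P A) → ∀ z → ∣ z ∣ ≡ 1 → z ⊑ S → z ⊑ ∁ A → (X ∩ ∁ z) ⊑ A
      part {X} (∣X∣ , cov) S⊑X A PA z ∣z∣ z⊑S z⊑∁A = linear (X ∷ S ∷ z ∷ A ∷ []) (t ∷ []) (λ x s z a t →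
        (# x ≼ lit 1 ⊕ t) ∷ (# (s ⊓ˢ -ˢ x) ≼ lit 0) ∷ (t ≼ # (x ⊓ˢ a)) ∷ (lit 1 ≼ # z) ∷ (# (z ⊓ˢ -ˢ s) ≼ lit 0) ∷ (# (z ⊓ˢ -ˢ -ˢ a) ≼ lit 0) ∷ []
        ⊢ # ((x ⊓ˢ -ˢ z) ⊓ˢ -ˢ a) ≼ lit 0) (≤-reflexive ∣X∣ , S⊑X , cov A PA , ≥-reflexive ∣z∣ , z⊑S , z⊑∁A , tt)
      inside-A : ∀ A → T (P A) → ∀ z → ∣ z ∣ ≡ 1 → z ⊑ S → z ⊑ ∁ A → (U ∩ ∁ z) ⊑ A
      inside-A A PA z ∣z∣ z⊑S z⊑∁A = linear (X ∷ Y ∷ Z ∷ z ∷ A ∷ []) [] (λ x y w z a →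
        (# ((x ⊓ˢ -ˢ z) ⊓ˢ -ˢ a) ≼ lit 0) ∷ (# ((y ⊓ˢ -ˢ z) ⊓ˢ -ˢ a) ≼ lit 0) ∷ (# ((w ⊓ˢ -ˢ z) ⊓ˢ -ˢ a) ≼ lit 0) ∷ []
        ⊢ # (((x ⊔ˢ (y ⊔ˢ w)) ⊓ˢ -ˢ z) ⊓ˢ -ˢ a) ≼ lit 0)
        (part cX S⊑X A PA z ∣z∣ z⊑S z⊑∁A , part cY S⊑Y A PA z ∣z∣ z⊑S z⊑∁A , part cZ S⊑Z A PA z ∣z∣ z⊑S z⊑∁A , tt)
      ∣U∖z∣ : ∀ z → ∣ z ∣ ≡ 1 → z ⊑ S → ∣ U ∩ ∁ z ∣ ≡ 2 + t
      ∣U∖z∣ z ∣z∣ z⊑S = ≤-antisym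
        (linear (X ∷ Y ∷ Z ∷ S ∷ z ∷ []) (t ∷ []) (λ x y w s z t →
            (# x ≼ lit 1 ⊕ t) ∷ (# y ≼ lit 1 ⊕ t) ∷ (# w ≼ lit 1 ⊕ t) ∷ (t ≼ # s) ∷ (t ≼ # s) ∷
            (# (s ⊓ˢ -ˢ x) ≼ lit 0) ∷ (# (s ⊓ˢ -ˢ y) ≼ lit 0) ∷ (# (s ⊓ˢ -ˢ w) ≼ lit 0) ∷ (# (s ⊓ˢ -ˢ x) ≼ lit 0) ∷ (lit 1 ≼ # z) ∷ (# (z ⊓ˢ -ˢ s) ≼ lit 0) ∷ []
            ⊢ # ((x ⊔ˢ (y ⊔ˢ w)) ⊓ˢ -ˢ z) ≼ lit 2 ⊕ t)
          (≤-reflexive (proj₁ cX) , ≤-reflexive (proj₁ cY) , ≤-reflexive (proj₁ cZ) , ≥-reflexive ∣S∣ , ≥-reflexive ∣S∣ , S⊑X , S⊑Y , S⊑Z , S⊑X , ≥-reflexive ∣z∣ , z⊑S , tt))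
        (linear (X ∷ Y ∷ Z ∷ S ∷ z ∷ []) (t ∷ []) (λ x y w s z t →
            (lit 1 ⊕ t ≼ # x) ∷ (lit 1 ⊕ t ≼ # y) ∷ (lit 1 ⊕ t ≼ # w) ∷ (# (x ⊓ˢ y) ≼ t) ∷ (# (x ⊓ˢ w) ≼ t) ∷ (# (y ⊓ˢ w) ≼ t) ∷ (t ≼ # s) ∷
            (# (s ⊓ˢ -ˢ x) ≼ lit 0) ∷ (# (s ⊓ˢ -ˢ y) ≼ lit 0) ∷ (# (s ⊓ˢ -ˢ w) ≼ lit 0) ∷ (# z ≼ lit 1) ∷ []
            ⊢ lit 2 ⊕ t ≼ # ((x ⊔ˢ (y ⊔ˢ w)) ⊓ˢ -ˢ z))
          (≥-reflexive (proj₁ cX) , ≥-reflexive (proj₁ cY) , ≥-reflexive (proj₁ cZ) , XY , XZ , YZ , ≥-reflexive ∣S∣ , S⊑X , S⊑Y , S⊑Z , ≤-reflexive ∣z∣ , tt))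

  hitting : Subset n → Subset n → Family n
  hitting S Y A = ((S ⊑ᵇ A) ∧ (∣ A ∣ ≡ᵇ k)) ∧ not (Y ⊑ᵇ ∁ A)

  union-size : (S Y : Subset n) → ∣ S ∩ Y ∣ ≤ 0 → ∣ S ∪ Y ∣ ≡ ∣ S ∣ + ∣ Y ∣
  union-size S Y d = ≤-antisym
    (linear (S ∷ Y ∷ []) [] (λ s y → [] ⊢ # (s ⊔ˢ y) ≼ # s ⊕ # y) tt)
    (linear (S ∷ Y ∷ []) [] (λ s y → (# (s ⊓ˢ y) ≼ lit 0) ∷ [] ⊢ # s ⊕ # y ≼ # (s ⊔ˢ y)) (d , tt))

  size-hitting : ∀ S Y → ∣ S ∣ ≡ t → ∣ Y ∣ ≡ c + 2 → ∣ S ∩ Y ∣ ≤ 0 → size (hitting S Y) ≡ h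
  size-hitting S Y ∣S∣ ∣Y∣ d = ≤-antisym
    (m+n≤o⇒m≤o∸n (size (hitting S Y)) (subst₂ _≤_ (cong (size (hitting S Y) +_) size-missing) size-all
      (disjoint-sum (hitting S Y) (between k S Y) above
        (λ A hA → proj₁ (∧-split (above A) hA))
        (λ A bA → let SA , r = ∧-split (S ⊑ᵇ A) bA in ∧-intro SA (∧-right (Y ⊑ᵇ ∁ A) r))
        (λ A hA bA → ⊥-elim (not-elim (∧-right (above A) hA) (proj₁ (∧-split (Y ⊑ᵇ ∁ A) (∧-right (S ⊑ᵇ A) bA))))))))
    (m≤n+o⇒m∸n≤o (N t) (choose m₀ k t) (subst₂ _≤_ size-all (trans (+-comm (size (hitting S Y)) _) (cong (_+ size (hitting S Y)) size-missing))
      (union₂ above (hitting S Y) (between k S Y) λ A → go (S ⊑ᵇ A) (∣ A ∣ ≡ᵇ k) (Y ⊑ᵇ ∁ A))))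
    where
    above : Family n
    above A = (S ⊑ᵇ A) ∧ (∣ A ∣ ≡ᵇ k)
    size-all : size above ≡ N t
    size-all = trans (size-above k S) (cong₂ (λ m s → choose m k s) (trans (∣∁p∣≡n∸∣p∣ S) (cong (n ∸_) ∣S∣)) ∣S∣)
    size-missing : size (between k S Y) ≡ choose m₀ k t
    size-missing = trans (size-between k S Y d) (cong₂ (λ m s → choose m k s)
      (trans (∣∁p∣≡n∸∣p∣ (S ∪ Y)) (cong (n ∸_) (trans (union-size S Y d) (cong₂ _+_ ∣S∣ ∣Y∣)))) ∣S∣)
    go : ∀ a b c → T (a ∧ b) → T (((a ∧ b) ∧ not c) ∨ (a ∧ c ∧ b))
    go true true true  _ = tt
    go true true false _ = tt

  -- This is C(t, t-1), the number of k-sets between a (k-t+1)-set and a (k+1)-set containing it; it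
  -- accounts for the sets [k+1] without j in ℋ.
  choose-top : choose t k (c + 2) ≡ t
  choose-top with m≤n⇒∃[o]m+o≡n t≥1
  ... | s , refl = begin
    choose (suc s) (2 + s + c) (c + 2)      ≡⟨ cong (λ m → choose (suc s) m (c + 2)) (shuffle s c) ⟩
    choose (suc s) (c + 2 + s) (c + 2)      ≡⟨ choose-+ (suc s) s (c + 2) ⟩
    suc s C s                               ≡⟨ C-pred s ⟩
    suc s                                   ∎
    where
    open ≡-Reasoning
    shuffle : ∀ s c → 2 + s + c ≡ c + 2 + s
    shuffle = solve-∀

  module _ {P Q : Family n} (π : Pair P Q) (S : Subset n) (∣S∣ : ∣ S ∣ ≡ t)
    (nearly : ∀ B → T (Q B) → t ≤ suc (∣ S ∩ B ∣)) (rest : size (without Q S) ≤ t * y) where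

    private
      B₁ = missedʳ π S ∣S∣
      G : Subset n
      G = proj₁ B₁
      Y : Subset n
      Y = G ∩ ∁ S
      ∣outside∣ : ∀ B → T (Q B) → ∣ S ∩ B ∣ < t → ∣ B ∩ ∁ S ∣ ≡ c + 2
      ∣outside∣ B QB lt = ≤-antisym
        (linear (S ∷ B ∷ []) (t ∷ c ∷ []) (λ s b t c → (# b ≼ lit 1 ⊕ t ⊕ c) ∷ (t ≼ lit 1 ⊕ # (s ⊓ˢ b)) ∷ [] ⊢ # (b ⊓ˢ -ˢ s) ≼ c ⊕ lit 2) (≤-reflexive (uniformʳ π B QB) , nearly B QB , tt))
        (linear (S ∷ B ∷ []) (t ∷ c ∷ []) (λ s b t c → (lit 1 ⊕ t ⊕ c ≼ # b) ∷ (lit 1 ⊕ # (s ⊓ˢ b) ≼ t) ∷ [] ⊢ c ⊕ lit 2 ≼ # (b ⊓ˢ -ˢ s)) (≥-reflexive (uniformʳ π B QB) , lt , tt))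
      ∣Y∣ = ∣outside∣ G (proj₁ (proj₂ B₁)) (proj₂ (proj₂ B₁))
      S∩Y : ∣ S ∩ Y ∣ ≤ 0
      S∩Y = linear (S ∷ G ∷ []) [] (λ s g → [] ⊢ # (s ⊓ˢ (g ⊓ˢ -ˢ s)) ≼ lit 0) tt
      outside-lt : ∀ B → T (without Q S B) → ∣ S ∩ B ∣ < t
      outside-lt B WB with ≤-<-connex t (∣ S ∩ B ∣)
      ... | inj₂ lt = lt
      ... | inj₁ t≤ = ⊥-elim (not-elim (∧-right (Q B) WB) (⊑⇒⊑ᵇ S B (linear (S ∷ B ∷ []) (t ∷ []) (λ s b t → (# s ≼ t) ∷ (t ≼ # (s ⊓ˢ b)) ∷ [] ⊢ # (s ⊓ˢ -ˢ b) ≼ lit 0) (≤-reflexive ∣S∣ , t≤ , tt))))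
      hits : ∀ B → T (Q B) → ∣ S ∩ B ∣ < t → ∀ A → T (P A ∧ (S ⊑ᵇ A)) → ¬ T ((B ∩ ∁ S) ⊑ᵇ ∁ A)
      hits B QB lt A PSA h = <⇒≱ (n<1+n 0) (linear (S ∷ B ∷ A ∷ []) (t ∷ []) (λ s b a t → (lit 1 ⊕ # (s ⊓ˢ b) ≼ t) ∷ (t ≼ # (a ⊓ˢ b)) ∷ (# ((b ⊓ˢ -ˢ s) ⊓ˢ -ˢ -ˢ a) ≼ lit 0) ∷ [] ⊢ lit 1 ≼ lit 0)
        (lt , cross π A B (proj₁ (∧-split (P A) PSA)) QB , ⊑ᵇ⇒⊑ (B ∩ ∁ S) (∁ A) h , tt))
      P⊆hitting : ∀ A → T (P A ∧ (S ⊑ᵇ A)) → T (hitting S Y A)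
      P⊆hitting A PSA = ∧-intro (∧-intro (∧-right (P A) PSA) (≡⇒≡ᵇ (∣ A ∣) k (uniformˡ π A (proj₁ (∧-split (P A) PSA))))) (not-intro (hits G (proj₁ (proj₂ B₁)) (proj₂ (proj₂ B₁)) A PSA))

    -- Either the members of Q not containing S all have the same trace outside S, or P loses more
    -- sets containing S than Q can gain.
    half : deg P S + size (without Q S) ≤ η₀
    half with anySubset? (λ B → T? (without Q S B) ×-dec (1 ≤? ∣ Y ∩ ∁ B ∣))
    -- Every member of `Q` not containing `S` consists of `Y` and t - 1 elements of `S`, so there
    -- are at most t of them.
    ... | no ¬B = +-mono-≤ (≤-trans (size-mono P⊆hitting) (≤-reflexive (size-hitting S Y ∣S∣ ∣Y∣ S∩Y)))
      (≤-trans (size-mono into) (≤-reflexive (trans (size-between k Y V (linear (S ∷ Y ∷ []) [] (λ s y → [] ⊢ # (y ⊓ˢ -ˢ (s ⊔ˢ y)) ≼ lit 0) tt))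
        (trans (cong₂ (λ m s → choose m k s) ∣∁∣ ∣Y∣) choose-top))))
      where
      V : Subset n
      V = ∁ (S ∪ Y)
      ∣∁∣ : ∣ ∁ (Y ∪ V) ∣ ≡ t
      ∣∁∣ = ≤-antisym
        (linear (S ∷ Y ∷ []) (t ∷ []) (λ s y t → (# s ≼ t) ∷ [] ⊢ # (-ˢ (y ⊔ˢ -ˢ (s ⊔ˢ y))) ≼ t) (≤-reflexive ∣S∣ , tt))
        (linear (S ∷ Y ∷ []) (t ∷ []) (λ s y t → (t ≼ # s) ∷ (# (s ⊓ˢ y) ≼ lit 0) ∷ [] ⊢ t ≼ # (-ˢ (y ⊔ˢ -ˢ (s ⊔ˢ y)))) (≥-reflexive ∣S∣ , S∩Y , tt))
      into : ∀ B → T (without Q S B) → T (between k Y V B)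
      into B WB = ∧-intro (⊑⇒⊑ᵇ Y B Y⊑B) (∧-intro (⊑⇒⊑ᵇ V (∁ B)
          (linear (S ∷ Y ∷ B ∷ []) (c ∷ []) (λ s y b c → (# (b ⊓ˢ -ˢ s) ≼ c ⊕ lit 2) ∷ (c ⊕ lit 2 ≼ # y) ∷ (# (s ⊓ˢ y) ≼ lit 0) ∷ (# (y ⊓ˢ -ˢ b) ≼ lit 0) ∷ []
            ⊢ # (-ˢ (s ⊔ˢ y) ⊓ˢ -ˢ -ˢ b) ≼ lit 0) (≤-reflexive (∣outside∣ B QB (outside-lt B WB)) , ≥-reflexive ∣Y∣ , S∩Y , Y⊑B , tt)))
          (≡⇒≡ᵇ (∣ B ∣) k (uniformʳ π B QB)))
        where
        QB = proj₁ (∧-split (Q B) WB)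
        Y⊑B : Y ⊑ B
        Y⊑B with ⊑-dec Y B
        ... | inj₁ Y⊑B = Y⊑B
        ... | inj₂ 1≤  = ⊥-elim (¬B (B , WB , 1≤))
    -- The point `v` lies in `Y` but not in `B`. A k-set containing `S` and `v` but no element of
    -- `B` outside `S` meets `Y`, yet it cannot belong to `P`, since it has fewer than t elements in
    -- `B`. These sets are counted by `loss`.
    ... | yes (B , WB , 1≤) = +-cancelʳ-≤ loss _ _ (begin
      deg P S + size (without Q S) + loss          ≡⟨ +-assoc (deg P S) _ loss ⟩
      deg P S + (size (without Q S) + loss)        ≡⟨ cong (deg P S +_) (+-comm (size (without Q S)) loss) ⟩
      deg P S + (loss + size (without Q S))        ≡⟨ +-assoc (deg P S) loss _ ⟨
      deg P S + loss + size (without Q S)          ≤⟨ +-mono-≤ deg+loss (≤-trans rest ty≤loss) ⟩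
      h + loss                                     ≤⟨ +-monoˡ-≤ loss (m≤m+n h t) ⟩
      η₀ + loss                                    ∎)
      where
      open ≤-Reasoning
      QB = proj₁ (∧-split (Q B) WB)
      Y₂ : Subset n
      Y₂ = B ∩ ∁ S
      ∣Y₂∣ = ∣outside∣ B QB (outside-lt B WB)
      e = a-subset 1 (Y ∩ ∁ B) 1≤
      v : Subset n
      v = proj₁ e
      ∣v∣ = proj₁ (proj₂ e)
      v⊑ : v ⊑ (Y ∩ ∁ B)
      v⊑ = proj₂ (proj₂ e)
      m₁ loss : ℕ
      m₁ = n ∸ (suc t + (c + 2))
      loss = choose m₁ k (suc t)
      S∩v : ∣ S ∩ v ∣ ≤ 0
      S∩v = linear (S ∷ Y ∷ B ∷ v ∷ []) [] (λ s y b z → (# (z ⊓ˢ -ˢ (y ⊓ˢ -ˢ b)) ≼ lit 0) ∷ (# (s ⊓ˢ y) ≼ lit 0) ∷ [] ⊢ # (s ⊓ˢ z) ≼ lit 0) (v⊑ , S∩Y , tt)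
      d : ∣ (S ∪ v) ∩ Y₂ ∣ ≤ 0
      d = linear (S ∷ Y ∷ B ∷ v ∷ []) [] (λ s y b z → (# (z ⊓ˢ -ˢ (y ⊓ˢ -ˢ b)) ≼ lit 0) ∷ [] ⊢ # ((s ⊔ˢ z) ⊓ˢ (b ⊓ˢ -ˢ s)) ≼ lit 0) (v⊑ , tt)
      ∣S∪v∣ : ∣ S ∪ v ∣ ≡ suc t
      ∣S∪v∣ = trans (size-adjoin S v ∣v∣ S∩v) (cong suc ∣S∣)
      size-loss : size (between k (S ∪ v) Y₂) ≡ loss
      size-loss = trans (size-between k (S ∪ v) Y₂ d) (cong₂ (λ m s → choose m k s)
        (trans (∣∁p∣≡n∸∣p∣ ((S ∪ v) ∪ Y₂)) (cong (n ∸_) (trans (union-size (S ∪ v) Y₂ d) (cong₂ _+_ ∣S∪v∣ ∣Y₂∣)))) ∣S∪v∣)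
      deg+loss : deg P S + loss ≤ h
      deg+loss = subst₂ _≤_ (cong (deg P S +_) size-loss) (size-hitting S Y ∣S∣ ∣Y∣ S∩Y)
        (disjoint-sum _ (between k (S ∪ v) Y₂) (hitting S Y) P⊆hitting
          (λ A bA → let Sz , r = ∧-split ((S ∪ v) ⊑ᵇ A) bA
                        Sv⊑A = ⊑ᵇ⇒⊑ (S ∪ v) A Sz
                    in ∧-intro (∧-intro (⊑⇒⊑ᵇ S A (linear (S ∷ v ∷ A ∷ []) [] (λ s z a → (# ((s ⊔ˢ z) ⊓ˢ -ˢ a) ≼ lit 0) ∷ [] ⊢ # (s ⊓ˢ -ˢ a) ≼ lit 0) (Sv⊑A , tt))) (∧-right (Y₂ ⊑ᵇ ∁ A) r))
                         (not-intro λ Y⊑ → ⊥-elim (<⇒≱ (n<1+n 0) (linear (S ∷ Y ∷ B ∷ v ∷ A ∷ []) [] (λ s y b z a → (# ((s ⊔ˢ z) ⊓ˢ -ˢ a) ≼ lit 0) ∷ (# (z ⊓ˢ -ˢ (y ⊓ˢ -ˢ b)) ≼ lit 0) ∷ (lit 1 ≼ # z) ∷ (# (y ⊓ˢ -ˢ -ˢ a) ≼ lit 0) ∷ [] ⊢ lit 1 ≼ lit 0)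
                           (Sv⊑A , v⊑ , ≥-reflexive ∣v∣ , ⊑ᵇ⇒⊑ Y (∁ A) Y⊑ , tt)))))
          (λ A PSA bA → ⊥-elim (hits B QB (outside-lt B WB) A PSA (proj₁ (∧-split (Y₂ ⊑ᵇ ∁ A) (∧-right ((S ∪ v) ⊑ᵇ A) bA))))))
      -- Pascal's rule leads from `x` down to `loss` in c + 2 steps, each costing at most `y`; and t
      -- + (c + 2) = k + 1 copies of `y` fit into `x`.
      ty≤loss : t * y ≤ loss
      ty≤loss = +-cancelʳ-≤ ((2 + c) * y) _ _ (begin
        t * y + (2 + c) * y                                 ≡⟨ *-distribʳ-+ y t (2 + c) ⟨
        (t + (2 + c)) * y                                   ≤⟨ *-monoˡ-≤ y (≤-trans (≤-reflexive (shuffle t c)) (≤-trans (+-monoˡ-≤ k 1≤k) (m≤m+n (k + k) (25 * k)))) ⟩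
        (k + k + 25 * k) * y                                ≡⟨ collect k y ⟩
        27 * (k * y)                                        ≤⟨ 27ky≤x ⟩
        x                                                   ≡⟨ cong (λ m → choose m k (suc t)) x-index ⟩
        choose (suc (suc c) + m₁) k (suc t)                 ≤⟨ choose-drop k (suc t) m₁ (suc c) ⟩
        loss + (2 + c) * choose (suc c + m₁) k (2 + t)      ≡⟨ cong (λ m → loss + (2 + c) * choose m k (2 + t)) y-index ⟨
        loss + (2 + c) * y                                  ∎)
        where
        1≤k : 1 ≤ k
        1≤k = s≤s z≤n
        shuffle : ∀ t c → t + (2 + c) ≡ 1 + (suc t + c)
        shuffle = solve-∀
        collect : ∀ k y → (k + k + 25 * k) * y ≡ 27 * (k * y)
        collect = solve-∀
        big : suc t + (2 + c) ≤ n
        big = ≤-trans (linearℕ (t ∷ c ∷ κ ∷ []) (λ t c κ → (lit 5 ≼ lit 1 ⊕ t ⊕ c) ∷ (lit 1 ⊕ t ⊕ c ≼ κ) ∷ [] ⊢ lit 1 ⊕ t ⊕ (lit 2 ⊕ c) ≼ 3 · κ ⊕ (lit 1 ⊕ t ⊕ c)) (k≥5 , k≤κ , tt)) 3κ+k≤n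
        m₁≡ : m₁ ≡ n ∸ (suc t + (2 + c))
        m₁≡ = cong (λ j → n ∸ (suc t + j)) (+-comm c 2)
        x-index : n ∸ suc t ≡ suc (suc c) + m₁
        x-index = trans (∸-shift n (suc t) (2 + c) big) (cong (2 + c +_) (sym m₁≡))
        y-index : n ∸ (2 + t) ≡ suc c + m₁
        y-index = trans (∸-shift n (2 + t) (1 + c) (≤-trans (≤-reflexive (sym (+-suc (suc t) (suc c)))) big)) (cong (1 + c +_) (sym (trans m₁≡ (cong (n ∸_) (+-suc (suc t) (suc c))))))

  module _ {P Q : Family n} (π : Pair P Q) (τ : Triple Q) (τ′ : Triple P) where
    open Triple τ
    open Triple τ′ using () renaming (X to X′; Y to Y′; Z to Z′; cX to cX′; cY to cY′; cZ to cZ′)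

    -- The four parts are paired crosswise, since the members of one family that lack an element of
    -- `S` restrict the members of the other that contain `S`.
    star : t ≤ ∣ X ∩ (Y ∩ Z) ∣ → size P + size Q ≤ 2 * η₀
    star t≤ = begin
      size P + size Q                                                  ≤⟨ +-mono-≤ (size-without P S) (size-without Q S) ⟩
      deg P S + size (without P S) + (deg Q S + size (without Q S))    ≡⟨ regroup (deg P S) _ _ _ ⟩
      deg P S + size (without Q S) + (deg Q S + size (without P S))    ≤⟨ +-mono-≤ (half π S ∣S∣ Q★.nearly Q★.rest) (half (swap π) S ∣S∣ P★.nearly P★.rest) ⟩
      η₀ + η₀                                                          ≡⟨ cong (η₀ +_) (+-identityʳ η₀) ⟨
      2 * η₀                                                           ∎
      where
      open ≤-Reasoning
      regroup : ∀ a b c d → a + b + (c + d) ≡ a + d + (c + b)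
      regroup = solve-∀
      S : Subset n
      S = X ∩ (Y ∩ Z)
      ∣S∣ : ∣ S ∣ ≡ t
      ∣S∣ = ≤-antisym (linear (X ∷ Y ∷ Z ∷ []) (t ∷ []) (λ x y z t → (# (x ⊓ˢ y) ≼ t) ∷ [] ⊢ # (x ⊓ˢ (y ⊓ˢ z)) ≼ t) (XY , tt)) t≤
      -- If `W` missed a point of `S`, it would contain the other t - 1 points and the three
      -- distinct points that `X`, `Y`, `Z` have outside `S`: t + 2 elements in a (t+1)-set.
      centre : ∀ W → IsCover₁ P W → S ⊑ W
      centre W (∣W∣ , covW) with ⊑-dec S W
      ... | inj₁ S⊑W = S⊑W
      ... | inj₂ 1≤ = ⊥-elim (<⇒≱ (n<1+n 0) (linear (X ∷ Y ∷ Z ∷ W ∷ []) (t ∷ []) (λ x y z w t →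
          (t ≼ # (x ⊓ˢ w)) ∷ (t ≼ # (y ⊓ˢ w)) ∷ (t ≼ # (z ⊓ˢ w)) ∷ (# w ≼ lit 1 ⊕ t) ∷ (# (x ⊓ˢ y) ≼ t) ∷ (# (x ⊓ˢ z) ≼ t) ∷ (# (y ⊓ˢ z) ≼ t) ∷
          (t ≼ # (x ⊓ˢ (y ⊓ˢ z))) ∷ (lit 1 ≼ # ((x ⊓ˢ (y ⊓ˢ z)) ⊓ˢ -ˢ w)) ∷ (lit 1 ≼ # ((x ⊓ˢ (y ⊓ˢ z)) ⊓ˢ -ˢ w)) ∷ [] ⊢ lit 1 ≼ lit 0)
        (covers π X W (proj₁ cX) ∣W∣ (proj₂ cX) covW , covers π Y W (proj₁ cY) ∣W∣ (proj₂ cY) covW , covers π Z W (proj₁ cZ) ∣W∣ (proj₂ cZ) covW ,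
         ≤-reflexive ∣W∣ , XY , XZ , YZ , t≤ , 1≤ , 1≤ , tt)))
      module Q★ = Star (uniformʳ π) τ S ∣S∣
        (linear (X ∷ Y ∷ Z ∷ []) [] (λ x y z → [] ⊢ # ((x ⊓ˢ (y ⊓ˢ z)) ⊓ˢ -ˢ x) ≼ lit 0) tt)
        (linear (X ∷ Y ∷ Z ∷ []) [] (λ x y z → [] ⊢ # ((x ⊓ˢ (y ⊓ˢ z)) ⊓ˢ -ˢ y) ≼ lit 0) tt)
        (linear (X ∷ Y ∷ Z ∷ []) [] (λ x y z → [] ⊢ # ((x ⊓ˢ (y ⊓ˢ z)) ⊓ˢ -ˢ z) ≼ lit 0) tt)
      module P★ = Star (uniformˡ π) τ′ S ∣S∣ (centre X′ cX′) (centre Y′ cY′) (centre Z′ cZ′)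

  -- Leading terms of |𝒜| and |ℋ|, and the case of three covers on each side

  α₀≥ : a * x ≤ α₀ + a * y
  α₀≥ = begin
    a * x                                                             ≡⟨ cong (λ m → a * choose m k (suc t)) (+-∸-assoc 1 2+t≤n) ⟩
    a * choose (suc (n ∸ (2 + t))) k (suc t)                          ≡⟨ cong (a *_) (choose-pascal (n ∸ (2 + t)) k (suc t)) ⟩
    a * (y + choose (n ∸ (2 + t)) k (suc t))                          ≡⟨ cong (a *_) (+-comm y _) ⟩
    a * (choose (n ∸ (2 + t)) k (suc t) + y)                          ≡⟨ *-distribˡ-+ a _ y ⟩
    a * choose (n ∸ (2 + t)) k (suc t) + a * y                        ≡⟨ cong (λ m → a * choose (n ∸ m) k (m ∸ 1) + a * y) (+-comm 2 t) ⟩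
    a * choose (n ∸ a) k (a ∸ 1) + a * y                              ≤⟨ +-monoˡ-≤ (a * y) (m≤m+n _ _) ⟩
    α₀ + a * y                                                        ∎
    where
    open ≤-Reasoning
    2+t≤n : 2 + t ≤ n
    2+t≤n = ≤-trans (linearℕ (t ∷ c ∷ κ ∷ []) (λ t c κ → (lit 5 ≼ lit 1 ⊕ t ⊕ c) ∷ (lit 1 ⊕ t ⊕ c ≼ κ) ∷ [] ⊢ lit 2 ⊕ t ≼ 3 · κ ⊕ (lit 1 ⊕ t ⊕ c)) (k≥5 , k≤κ , tt)) 3κ+k≤n

  -- By `choose-rise`, `h` contains c + 2 increments of size at least `w`; by `choose-drop`, `w`
  -- falls short of `x` by at most (c + 1) y.
  η₀≥ : (c + 2) * x ≤ η₀ + (c + 2) * ((c + 1) * y)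
  η₀≥ = begin
    (c + 2) * x                                         ≤⟨ *-monoʳ-≤ (c + 2) x≤ ⟩
    (c + 2) * (w + (c + 1) * y)                         ≡⟨ *-distribˡ-+ (c + 2) w _ ⟩
    (c + 2) * w + (c + 2) * ((c + 1) * y)               ≤⟨ +-monoˡ-≤ _ (≤-trans w≤h (m≤m+n h t)) ⟩
    η₀ + (c + 2) * ((c + 1) * y)                        ∎
    where
    open ≤-Reasoning
    w : ℕ
    w = choose m₀ k (suc t)
    big : t + (2 + c) ≤ n
    big = ≤-trans (linearℕ (t ∷ c ∷ κ ∷ []) (λ t c κ → (lit 5 ≼ lit 1 ⊕ t ⊕ c) ∷ (lit 1 ⊕ t ⊕ c ≼ κ) ∷ [] ⊢ t ⊕ (lit 2 ⊕ c) ≼ 3 · κ ⊕ (lit 1 ⊕ t ⊕ c)) (k≥5 , k≤κ , tt)) 3κ+k≤n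
    m₀≡ : m₀ ≡ n ∸ (t + (2 + c))
    m₀≡ = cong (λ j → n ∸ (t + j)) (+-comm c 2)
    index₀ : n ∸ t ≡ (c + 2) + m₀
    index₀ = trans (∸-shift n t (2 + c) big) (cong₂ _+_ (+-comm 2 c) (sym m₀≡))
    index₁ : n ∸ suc t ≡ suc c + m₀
    index₁ = trans (∸-shift n (suc t) (1 + c) (≤-trans (≤-reflexive (sym (+-suc t (suc c)))) big)) (cong (1 + c +_) (sym (trans m₀≡ (cong (n ∸_) (+-suc t (suc c))))))
    index₂ : n ∸ (2 + t) ≡ c + m₀
    index₂ = trans (∸-shift n (2 + t) c (≤-trans (≤-reflexive (sym (trans (+-suc t (suc c)) (cong suc (+-suc t c))))) big)) (cong (c +_) (sym (trans m₀≡ (cong (n ∸_) (trans (+-suc t (suc c)) (cong suc (+-suc t c)))))))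
    x≤ : x ≤ w + (c + 1) * y
    x≤ = begin
      x                                          ≡⟨ cong (λ m → choose m k (suc t)) index₁ ⟩
      choose (suc c + m₀) k (suc t)              ≤⟨ choose-drop k (suc t) m₀ c ⟩
      w + suc c * choose (c + m₀) k (2 + t)      ≡⟨ cong₂ (λ j m → w + j * choose m k (2 + t)) (+-comm 1 c) (sym index₂) ⟩
      w + (c + 1) * y                            ∎
    w≤h : (c + 2) * w ≤ h
    w≤h = m+n≤o⇒m≤o∸n ((c + 2) * w) (begin
      (c + 2) * w + choose m₀ k t          ≡⟨ +-comm ((c + 2) * w) _ ⟩
      choose m₀ k t + (c + 2) * w          ≤⟨ choose-rise k t m₀ (c + 2) ⟩
      choose (c + 2 + m₀) k t              ≡⟨ cong (λ m → choose m k t) index₀ ⟨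
      N t                                  ∎)

  open Targets α₀ η₀ α₀≥ η₀≥ public

  three-three : ∀ {P Q} → Pair P Q → Triple Q → Triple P → size P * size Q ≤ target
  three-three {P} {Q} π τ τ′ = go (m≤n⇒m<n∨m≡n XY) (m≤n⇒m<n∨m≡n XZ) (m≤n⇒m<n∨m≡n YZ) (≤-<-connex t (∣ X ∩ (Y ∩ Z) ∣))
    where
    open Triple τ
    open Triple τ′ using () renaming (X to X′; Y to Y′; Z to Z′; cX to cX′; cY to cY′; cZ to cZ′; XY to XY′; XZ to XZ′; YZ to YZ′)
    distant : ∀ X Y → IsCover₁ Q X → IsCover₁ Q Y → ∣ X ∩ Y ∣ < t → size P * size Q ≤ target
    distant X Y cX cY lt = ≤-trans (≤-reflexive (*-comm (size P) (size Q))) (case-far {size Q} {size P} D.size-Q (D.size-P {X′} {Y′} {Z′} cX′ cY′ cZ′ XY′ XZ′ YZ′))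
      where module D = Distant π {X} {Y} cX cY (≤-antisym lt (distance≤2 π {X} {Y} {X′} cX cY cX′))
    go : ∣ X ∩ Y ∣ < t ⊎ ∣ X ∩ Y ∣ ≡ t → ∣ X ∩ Z ∣ < t ⊎ ∣ X ∩ Z ∣ ≡ t → ∣ Y ∩ Z ∣ < t ⊎ ∣ Y ∩ Z ∣ ≡ t → t ≤ ∣ X ∩ (Y ∩ Z) ∣ ⊎ ∣ X ∩ (Y ∩ Z) ∣ < t → size P * size Q ≤ target
    go (inj₁ lt) _ _ _ = distant X Y cX cY lt
    go _ (inj₁ lt) _ _ = distant X Z cX cZ lt
    go _ _ (inj₁ lt) _ = distant Y Z cY cZ lt
    go (inj₂ e) (inj₂ e′) (inj₂ e″) (inj₁ t≤) = ≤-trans (product≤square {size P} {size Q} η₀ (star π τ τ′ t≤)) (≤-trans (≤-reflexive (square η₀)) (m≤n⊔m (α₀ ^ 2) (η₀ ^ 2)))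
    go (inj₂ e) (inj₂ e′) (inj₂ e″) (inj₂ lt) =
      let P≤ , Q≤ = triangle π τ τ′ (≥-reflexive e) (≥-reflexive e′) (≥-reflexive e″) lt
      in ≤-trans (*-mono-≤ P≤ Q≤) (≤-trans (≤-reflexive (square α₀)) (m≤m⊔n (α₀ ^ 2) (η₀ ^ 2)))

  -- Least covers and the case distinction

  least-cover : ∀ Q X → Cover Q X → ∃ λ Y → Cover Q Y × (∀ Z → Cover Q Z → ∣ Y ∣ ≤ ∣ Z ∣)
  least-cover Q X = go (∣ X ∣) X ≤-refl
    where
    go : ∀ m X → ∣ X ∣ ≤ m → Cover Q X → ∃ λ Y → Cover Q Y × (∀ Z → Cover Q Z → ∣ Y ∣ ≤ ∣ Z ∣)
    go m X ∣X∣≤m cov with anySubset? (λ Y → Cover? Q Y ×-dec (∣ Y ∣ <? ∣ X ∣))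
    ... | no ¬Y = X , cov , λ Z covZ → ≮⇒≥ λ lt → ¬Y (Z , covZ , lt)
    go zero    X ∣X∣≤0 cov | yes (Y , covY , lt) = ⊥-elim (<⇒≱ lt (≤-trans ∣X∣≤0 z≤n))
    go (suc m) X ∣X∣≤m cov | yes (Y , covY , lt) = go m Y (s≤s⁻¹ (≤-trans lt ∣X∣≤m)) covY

  member : ∀ {P Q} → Pair P Q → ∃ λ A → T (P A)
  member π =
    let S , ∣S∣ , _ = a-subset t (⊤ {n}) (≤-trans t≤k (≤-trans k≤n (≥-reflexive (∣⊤∣≡n n))))
        A , PA , _ = missedˡ π S ∣S∣
    in A , PA

  record Excess (Q : Family n) (r : ℕ) : Set where
    field
      W     : Subset n
      ∣W∣   : ∣ W ∣ ≡ t + r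
      cover : Cover Q W
      least : ∀ Z → Cover Q Z → t + r ≤ ∣ Z ∣

  excess : ∀ {P Q} → Pair P Q → ∃ λ r → Excess Q r
  excess {P} {Q} π =
    let A , PA = member π
        B , QB = member (swap π)
        W , cov , least = least-cover Q A (λ B QB → cross π A B PA QB)
        r , t+r≡ = m≤n⇒∃[o]m+o≡n (linear (W ∷ B ∷ []) (t ∷ []) (λ w b t → (t ≼ # (w ⊓ˢ b)) ∷ [] ⊢ t ≼ # w) (cov B QB , tt))
    in r , record { W = W ; ∣W∣ = sym t+r≡ ; cover = cov ; least = λ Z covZ → ≤-trans (≤-reflexive t+r≡) (least Z covZ) }

  size-excess : ∀ {P Q r r′} → Pair P Q → Excess Q r → Excess P r′ → size P ≤ ((t + r′) C t) * (k ^ r * N (t + r))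
  size-excess {P} {Q} {r} {r′} π ε ε′ = ≤-trans
    (cover-bound W cover λ S ∣S∣ → branching π (λ A PA → PA) (t + r) missed r S (cong (_+ r) ∣S∣) (≥-reflexive ∣S∣))
    (≤-reflexive (cong (λ m → (m C t) * (k ^ r * N (t + r))) ∣W∣))
    where
    open Excess ε′
    missed : ∀ S → t ≤ ∣ S ∣ → ∣ S ∣ < t + r → Missed Q S ⊎ (∀ A → T (P A) → ¬ S ⊑ A)
    missed S _ lt with cover? Q S
    ... | inj₁ cov = ⊥-elim (<⇒≱ lt (Excess.least ε S cov))
    ... | inj₂ m   = inj₁ m

  product-excess : ∀ {P Q r r′} → Pair P Q → Excess Q r → Excess P r′ → size P * size Q ≤ bound r′ * bound r
  product-excess {r = r} {r′} π ε ε′ = ≤-trans (*-mono-≤ (size-excess π ε ε′) (size-excess (swap π) ε′ ε)) (≤-reflexive (regroup ((t + r′) C t) _ ((t + r) C t) _))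
    where
    regroup : ∀ a b c d → a * b * (c * d) ≡ a * d * (c * b)
    regroup = solve-∀

  ≥2 : ∀ {P Q r} → Pair P Q → Complete Q [] → Excess Q r → 2 ≤ r
  ≥2 {r = 0} π none ε =
    let open Excess ε
        B , QB , lt = missedʳ π W (trans ∣W∣ (+-identityʳ t))
    in ⊥-elim (<⇒≱ lt (cover B QB))
  ≥2 {r = 1} π none ε with none (Excess.W ε) (trans (Excess.∣W∣ ε) (+-comm t 1) , Excess.cover ε)
  ... | ()
  ≥2 {r = suc (suc r)} π none ε = s≤s (s≤s z≤n)

  excess-1 : ∀ {P Q X} → Pair P Q → IsCover₁ Q X → Excess Q 1
  excess-1 {P} {Q} {X} π (∣X∣ , cov) = record { W = X ; ∣W∣ = trans ∣X∣ (+-comm 1 t) ; cover = cov ; least = least }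
    where
    least : ∀ Z → Cover Q Z → t + 1 ≤ ∣ Z ∣
    least Z covZ with ≤-<-connex (t + 1) (∣ Z ∣)
    ... | inj₁ h = h
    ... | inj₂ lt =
      let B′ , QB′ = member (swap π)
          t≤∣Z∣ = linear (Z ∷ B′ ∷ []) (t ∷ []) (λ z b t → (t ≼ # (z ⊓ˢ b)) ∷ [] ⊢ t ≼ # z) (covZ B′ QB′ , tt)
          B , QB , lt′ = missedʳ π Z (≤-antisym (s≤s⁻¹ (≤-trans lt (≤-reflexive (+-comm t 1)))) t≤∣Z∣)
      in ⊥-elim (<⇒≱ lt′ (covZ B QB))

  data Listing (Q : Family n) : Set where
    none  : Complete Q [] → Listing Q
    one   : ∀ X → IsCover₁ Q X → Complete Q (X ∷ []) → Listing Q
    two   : ∀ X Y → IsCover₁ Q X → IsCover₁ Q Y → ∣ X ∩ Y ∣ ≤ t → Complete Q (X ∷ Y ∷ []) → Listing Q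
    three : Triple Q → Listing Q

  listing : ∀ Q → Listing Q
  listing Q with another? Q []
  ... | inj₂ complete = none complete
  ... | inj₁ (X , cX , _) with another? Q (X ∷ [])
  ...   | inj₂ complete = one X cX complete
  ...   | inj₁ (Y , cY , XY ∷ _) with another? Q (X ∷ Y ∷ [])
  ...     | inj₂ complete = two X Y cX cY XY complete
  ...     | inj₁ (Z , cZ , XZ ∷ YZ ∷ _) = three record { X = X ; Y = Y ; Z = Z ; cX = cX ; cY = cY ; cZ = cZ ; XY = XY ; XZ = XZ ; YZ = YZ }

  -- Serves both for exactly two covers and for the first two of a triple.
  record Two (P : Family n) : Set where
    constructor mkTwo
    field
      X Y : Subset n
      cX  : IsCover₁ P X
      cY  : IsCover₁ P Y
      XY  : ∣ X ∩ Y ∣ ≤ t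

  firstTwo : ∀ {P} → Triple P → Two P
  firstTwo τ = record { X = X ; Y = Y ; cX = cX ; cY = cY ; XY = XY }
    where open Triple τ

  module Cases {P Q : Family n} (π : Pair P Q) where

    -- `P` has excess 1 and `Q` at least 2. Excess 3 or more is covered by `bound 1 * bound 3`.
    -- Excess 2 gives r + r′ = 3, where the covers of `P` have to be used; a least cover `W` of `Q`
    -- with t + 2 elements is handed over for that.
    none-excess : ∀ {X′} → Complete Q [] → IsCover₁ P X′ → (∀ W → ∣ W ∣ ≡ t + 2 → Cover Q W → size P * size Q ≤ target) → size P * size Q ≤ target
    none-excess {X′} complete cX′ h = let r , ε = excess π in go r ε (m≤n⇒m<n∨m≡n (≥2 π complete ε))
      where
      go : ∀ r → Excess Q r → 2 < r ⊎ 2 ≡ r → size P * size Q ≤ target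
      go r ε (inj₁ 3≤r)  = case-13 {size P * size Q} (≤-trans (product-excess π ε (excess-1 {X = X′} (swap π) cX′)) (*-monoʳ-≤ (bound 1) (bound-antitone {3} {r} 3≤r)))
      go r ε (inj₂ refl) = h (Excess.W ε) (Excess.∣W∣ ε) (Excess.cover ε)

    none-none : Complete Q [] → Complete P [] → size P * size Q ≤ target
    none-none complete complete′ =
      let r , ε = excess π
          r′ , ε′ = excess (swap π)
      in ≤-trans (product-excess π ε ε′) (case-22 {bound r′} {bound r} (bound-antitone {2} {r′} (≥2 (swap π) complete′ ε′)) (bound-antitone {2} {r} (≥2 π complete ε)))

    none-one : ∀ X′ → Complete Q [] → IsCover₁ P X′ → Complete P (X′ ∷ []) → size P * size Q ≤ target
    none-one X′ complete cX′ complete′ = none-excess {X′} complete cX′ λ W ∣W∣ cov → case-2-one {size P} {size Q}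
      (Sparse.size-one π [] [] complete X′ cX′)
      (≤-trans (Sparse.size-cover (swap π) (X′ ∷ []) (cX′ ∷ []) complete′ W cov) (≤-reflexive (cong₂ (λ i j → i + (j C t) * u) (+-identityʳ x) ∣W∣)))

    none-two : Complete Q [] → Two P → size P * size Q ≤ target
    none-two complete (mkTwo X′ Y′ cX′ cY′ XY′) = none-excess {X′} complete cX′ λ W ∣W∣ cov → case-2-two {size P} {size Q}
      (Sparse.size-two π [] [] complete X′ Y′ cX′ cY′ XY′)
      (≤-trans (cover-bound W cov (deg-t (swap π))) (≤-reflexive (cong (λ j → (j C t) * ((c + 2) * x)) ∣W∣)))

    one-one : ∀ X X′ → IsCover₁ Q X → Complete Q (X ∷ []) → IsCover₁ P X′ → Complete P (X′ ∷ []) → size P * size Q ≤ target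
    one-one X X′ cX complete cX′ complete′ = case-one-one {size P} {size Q}
      (≤-trans (Sparse.size-one π (X ∷ []) (cX ∷ []) complete X′ cX′) (≤-reflexive (cong (_+ suc t * u) (+-identityʳ x))))
      (≤-trans (Sparse.size-one (swap π) (X′ ∷ []) (cX′ ∷ []) complete′ X cX) (≤-reflexive (cong (_+ suc t * u) (+-identityʳ x))))

    one-two : ∀ X → IsCover₁ Q X → Complete Q (X ∷ []) → Two P → size P * size Q ≤ target
    one-two X cX complete (mkTwo X′ Y′ cX′ cY′ XY′) = case-one-two {size P} {size Q}
      (≤-trans (Sparse.size-two π (X ∷ []) (cX ∷ []) complete X′ Y′ cX′ cY′ XY′) (≤-reflexive (cong (_+ 2 * u) (+-identityʳ x))))
      (cover-bound₁ X (proj₁ cX) (proj₂ cX) (deg-t (swap π)))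

    two-two : ∀ X Y → IsCover₁ Q X → IsCover₁ Q Y → ∣ X ∩ Y ∣ ≤ t → Complete Q (X ∷ Y ∷ []) → Two P → size P * size Q ≤ target
    two-two X Y cX cY XY complete (mkTwo X′ Y′ cX′ cY′ XY′) = case-two-more {size P} {size Q}
      (Sparse.size-two π (X ∷ Y ∷ []) (cX ∷ cY ∷ []) complete X′ Y′ cX′ cY′ XY′)
      (size-two-covers π {X} {Y} {X′} cX cY XY cX′)

  product-bound : ∀ {P Q} → Pair P Q → size P * size Q ≤ target
  product-bound {P} {Q} π = go (listing Q) (listing P)
    where
    flipped : size Q * size P ≤ target → size P * size Q ≤ target
    flipped = ≤-trans (≤-reflexive (*-comm (size P) (size Q)))
    go : Listing Q → Listing P → size P * size Q ≤ target
    go (none c)              (none c′)                  = Cases.none-none π c c′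
    go (none c)              (one X′ cX′ c′)            = Cases.none-one π X′ c cX′ c′
    go (none c)              (two X′ Y′ cX′ cY′ d′ _)   = Cases.none-two π c (mkTwo X′ Y′ cX′ cY′ d′)
    go (none c)              (three τ′)                 = Cases.none-two π c (firstTwo τ′)
    go (one X cX c)          (none c′)                  = flipped (Cases.none-one (swap π) X c′ cX c)
    go (two X Y cX cY d _)   (none c′)                  = flipped (Cases.none-two (swap π) c′ (mkTwo X Y cX cY d))
    go (three τ)             (none c′)                  = flipped (Cases.none-two (swap π) c′ (firstTwo τ))
    go (one X cX c)          (one X′ cX′ c′)            = Cases.one-one π X X′ cX c cX′ c′
    go (one X cX c)          (two X′ Y′ cX′ cY′ d′ _)   = Cases.one-two π X cX c (mkTwo X′ Y′ cX′ cY′ d′)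
    go (one X cX c)          (three τ′)                 = Cases.one-two π X cX c (firstTwo τ′)
    go (two X Y cX cY d _)   (one X′ cX′ c′)            = flipped (Cases.one-two (swap π) X′ cX′ c′ (mkTwo X Y cX cY d))
    go (three τ)             (one X′ cX′ c′)            = flipped (Cases.one-two (swap π) X′ cX′ c′ (firstTwo τ))
    go (two X Y cX cY d c)   (two X′ Y′ cX′ cY′ d′ _)   = Cases.two-two π X Y cX cY d c (mkTwo X′ Y′ cX′ cY′ d′)
    go (two X Y cX cY d c)   (three τ′)                 = Cases.two-two π X Y cX cY d c (firstTwo τ′)
    go (three τ)             (two X′ Y′ cX′ cY′ d′ c′)  = flipped (Cases.two-two (swap π) X′ Y′ cX′ cY′ d′ c′ (firstTwo τ))
    go (three τ)             (three τ′)                 = three-three π τ τ′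

  -- The sizes of 𝒜 and ℋ

  suc-k≤n : suc k ≤ n
  suc-k≤n = ≤-trans (linearℕ (t ∷ c ∷ κ ∷ []) (λ t c κ → (lit 5 ≼ lit 1 ⊕ t ⊕ c) ∷ (lit 1 ⊕ t ⊕ c ≼ κ) ∷ [] ⊢ lit 2 ⊕ t ⊕ c ≼ 3 · κ ⊕ (lit 1 ⊕ t ⊕ c)) (k≥5 , k≤κ , tt)) 3κ+k≤n

  α₀≤card : α₀ ≤ card (AFam n k t)
  α₀≤card = begin
    α₀                        ≡⟨ size-near D (trans ∣D∣ (+-comm 2 t)) ⟨
    size (almostAbove k D)    ≤⟨ size-mono into ⟩
    size (AFam n k t)         ≡⟨ card≡size (AFam n k t) ⟨
    card (AFam n k t)         ∎
    where
    open ≤-Reasoning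
    D : Subset n
    D = range (suc (suc t))
    ∣D∣ : ∣ D ∣ ≡ 2 + t
    ∣D∣ = ∣range∣ n (2 + t) (≤-trans (s≤s (s≤s (m≤m+n t c))) suc-k≤n)
    into : ∀ A → T (almostAbove k D A) → T (AFam n k t A)
    into A h = let h₁ , h₂ = ∧-split (∣ D ∩ ∁ A ∣ ≤ᵇ 1) h in
      ∧-intro h₂ (≤⇒≤ᵇ (linear (A ∷ D ∷ []) (t ∷ []) (λ a d t → (lit 2 ⊕ t ≼ # d) ∷ (# (d ⊓ˢ -ˢ a) ≼ lit 1) ∷ [] ⊢ lit 1 ⊕ t ≼ # (a ⊓ˢ d))
        (≥-reflexive ∣D∣ , ≤ᵇ⇒≤ (∣ D ∩ ∁ A ∣) 1 h₁ , tt)))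

  -- The sets through [t] that meet I = [t+1, k+1] contribute `h`, and the k-sets between `I` and
  -- [k+1] contribute t. The two kinds are disjoint because a k-set cannot contain both [t] and `I`,
  -- which have k + 1 elements together.
  η₀≤card : η₀ ≤ card (HFam n k t)
  η₀≤card = begin
    h + t                                            ≡⟨ cong₂ _+_ (size-hitting S I ∣S∣ ∣I∣ S∩I) size-second ⟨
    size (hitting S I) + size (between k I (∁ R))    ≤⟨ disjoint-sum (hitting S I) (between k I (∁ R)) (HFam n k t) first second exclusive ⟩
    size (HFam n k t)                                ≡⟨ card≡size (HFam n k t) ⟨
    card (HFam n k t)                                ∎
    where
    open ≤-Reasoning
    R S I : Subset n
    R = range (suc k)
    S = range t
    I = R ∩ ∁ S
    ∣R∣ : ∣ R ∣ ≡ suc k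
    ∣R∣ = ∣range∣ n (suc k) suc-k≤n
    ∣S∣ : ∣ S ∣ ≡ t
    ∣S∣ = ∣range∣ n t (≤-trans t≤k k≤n)
    range-mono : ∀ n t k → t ≤ k → range {n} t ⊑ range k
    range-mono n       zero    k       _   = ≤-trans (≤-reflexive (cong (λ X → ∣ X ∩ ∁ (range {n} k) ∣) (range-0 {n}))) (⊥⊑ (range {n} k))
    range-mono zero    (suc t) (suc k) _   = z≤n
    range-mono (suc n) (suc t) (suc k) t≤k = range-mono n t k (s≤s⁻¹ t≤k)
    S⊑R : S ⊑ R
    S⊑R = range-mono n t (suc k) (≤-trans t≤k (n≤1+n k))
    ∣I∣ : ∣ I ∣ ≡ c + 2
    ∣I∣ = ≤-antisym
      (linear (R ∷ S ∷ []) (t ∷ c ∷ []) (λ r s t c → (# r ≼ lit 2 ⊕ t ⊕ c) ∷ (t ≼ # s) ∷ (# (s ⊓ˢ -ˢ r) ≼ lit 0) ∷ [] ⊢ # (r ⊓ˢ -ˢ s) ≼ c ⊕ lit 2) (≤-reflexive ∣R∣ , ≥-reflexive ∣S∣ , S⊑R , tt))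
      (linear (R ∷ S ∷ []) (t ∷ c ∷ []) (λ r s t c → (lit 2 ⊕ t ⊕ c ≼ # r) ∷ (# s ≼ t) ∷ [] ⊢ c ⊕ lit 2 ≼ # (r ⊓ˢ -ˢ s)) (≥-reflexive ∣R∣ , ≤-reflexive ∣S∣ , tt))
    S∩I : ∣ S ∩ I ∣ ≤ 0
    S∩I = linear (R ∷ S ∷ []) [] (λ r s → [] ⊢ # (s ⊓ˢ (r ⊓ˢ -ˢ s)) ≼ lit 0) tt
    size-second : size (between k I (∁ R)) ≡ t
    size-second = trans (size-between k I (∁ R) (linear (R ∷ S ∷ []) [] (λ r s → [] ⊢ # ((r ⊓ˢ -ˢ s) ⊓ˢ -ˢ r) ≼ lit 0) tt))
      (trans (cong₂ (λ m s → choose m k s) ∣∁∣ ∣I∣) choose-top)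
      where
      ∣∁∣ : ∣ ∁ (I ∪ ∁ R) ∣ ≡ t
      ∣∁∣ = ≤-antisym
        (linear (R ∷ S ∷ []) (t ∷ []) (λ r s t → (# s ≼ t) ∷ [] ⊢ # (-ˢ ((r ⊓ˢ -ˢ s) ⊔ˢ -ˢ r)) ≼ t) (≤-reflexive ∣S∣ , tt))
        (linear (R ∷ S ∷ []) (t ∷ []) (λ r s t → (t ≼ # s) ∷ (# (s ⊓ˢ -ˢ r) ≼ lit 0) ∷ [] ⊢ t ≼ # (-ˢ ((r ⊓ˢ -ˢ s) ⊔ˢ -ˢ r))) (≥-reflexive ∣S∣ , S⊑R , tt))
    ∨-introˡ : ∀ {a b} → T a → T (a ∨ b)
    ∨-introˡ {true} _ = tt
    ∨-introʳ : ∀ {a b} → T b → T (a ∨ b)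
    ∨-introʳ {true}  _ = tt
    ∨-introʳ {false} p = p
    first : ∀ A → T (hitting S I A) → T (HFam n k t A)
    first A hA =
      let h₁ , h₂ = ∧-split ((S ⊑ᵇ A) ∧ (∣ A ∣ ≡ᵇ k)) hA
          S⊑A , ∣A∣ = ∧-split (S ⊑ᵇ A) h₁
      in ∨-introˡ (∧-intro ∣A∣ (∧-intro (fromWitness {a? = S ⊆? A} (⊑⇒⊆ S A (⊑ᵇ⇒⊑ S A S⊑A)))
           (not-intro λ e → ⊥-elim (not-elim h₂ (⊑⇒⊑ᵇ I (∁ A) (missed (≡ᵇ⇒≡ (∣ A ∩ interval (suc t) (suc k) ∣) 0 e)))))))
      where
      missed : ∣ A ∩ interval (suc t) (suc k) ∣ ≡ 0 → I ⊑ ∁ A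
      missed e = linear (I ∷ A ∷ []) [] (λ i a → (# (a ⊓ˢ i) ≼ lit 0) ∷ [] ⊢ # (i ⊓ˢ -ˢ -ˢ a) ≼ lit 0)
        (≤-reflexive (trans (cong (λ X → ∣ A ∩ X ∣) (sym (interval≡ n t (suc k) (≤-trans t≤k (n≤1+n k))))) e) , tt)
    second : ∀ A → T (between k I (∁ R) A) → T (HFam n k t A)
    second A bA = ∨-introʳ {isK k A ∧ ⌊ S ⊆? A ⌋ ∧ not (∣ A ∩ interval (suc t) (suc k) ∣ ≡ᵇ 0)}
      (Any.any⁺ (λ j → A == (R ∖ single j)) (Any.map⁺ (Any.map (λ { refl → fromWitness A≡ }) (∈-upTo⁺ i<t))))
      where
      h₁ = ∧-split (I ⊑ᵇ A) bA
      h₂ = ∧-split (∁ R ⊑ᵇ ∁ A) (proj₂ h₁)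
      I⊑A : I ⊑ A
      I⊑A = ⊑ᵇ⇒⊑ I A (proj₁ h₁)
      A⊑R : ∁ R ⊑ ∁ A
      A⊑R = ⊑ᵇ⇒⊑ (∁ R) (∁ A) (proj₁ h₂)
      ∣A∣ : ∣ A ∣ ≡ k
      ∣A∣ = ≡ᵇ⇒≡ (∣ A ∣) k (proj₂ h₂)
      -- The element of [k+1] that `A` omits; it lies in [t] because `A` contains `I`. Its index is
      -- needed in `Fin n`, and `suc (toℕ i)` shifts it to the numbering from 1.
      gap = element (R ∩ ∁ A) (linear (R ∷ A ∷ []) (k ∷ []) (λ r a k → (lit 1 ⊕ k ≼ # r) ∷ (# a ≼ k) ∷ [] ⊢ lit 1 ≼ # (r ⊓ˢ -ˢ a)) (≥-reflexive ∣R∣ , ≤-reflexive ∣A∣ , tt))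
      i : Fin n
      i = proj₁ gap
      i⊑ : ⁅ i ⁆ ⊑ (R ∩ ∁ A)
      i⊑ = proj₂ gap
      i<t : toℕ i < t
      i<t = range-index t i (linear (⁅ i ⁆ ∷ R ∷ S ∷ A ∷ []) [] (λ i r s a → (# (i ⊓ˢ -ˢ (r ⊓ˢ -ˢ a)) ≼ lit 0) ∷ (# ((r ⊓ˢ -ˢ s) ⊓ˢ -ˢ a) ≼ lit 0) ∷ [] ⊢ # (i ⊓ˢ -ˢ s) ≼ lit 0) (i⊑ , I⊑A , tt))
      A≡ : A ≡ R ∖ single (suc (toℕ i))
      A≡ = trans (⊑-antisym A (R ∩ ∁ ⁅ i ⁆)
          (linear (⁅ i ⁆ ∷ R ∷ A ∷ []) [] (λ i r a → (# (i ⊓ˢ -ˢ (r ⊓ˢ -ˢ a)) ≼ lit 0) ∷ (# (-ˢ r ⊓ˢ -ˢ -ˢ a) ≼ lit 0) ∷ [] ⊢ # (a ⊓ˢ -ˢ (r ⊓ˢ -ˢ i)) ≼ lit 0) (i⊑ , A⊑R , tt))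
          (linear (⁅ i ⁆ ∷ R ∷ A ∷ []) (k ∷ []) (λ i r a k → (# (i ⊓ˢ -ˢ (r ⊓ˢ -ˢ a)) ≼ lit 0) ∷ (lit 1 ≼ # i) ∷ (# r ≼ lit 1 ⊕ k) ∷ (k ≼ # a) ∷ (# (-ˢ r ⊓ˢ -ˢ -ˢ a) ≼ lit 0) ∷ [] ⊢ # ((r ⊓ˢ -ˢ i) ⊓ˢ -ˢ a) ≼ lit 0)
            (i⊑ , ≥-reflexive (∣⁅x⁆∣≡1 i) , ≤-reflexive ∣R∣ , ≥-reflexive ∣A∣ , A⊑R , tt)))
        (trans (cong (λ X → R ∩ ∁ X) (sym (single≡ i))) (sym (∖≡∩∁ R (single (suc (toℕ i))))))
    exclusive : ∀ A → T (hitting S I A) → T (between k I (∁ R) A) → T false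
    exclusive A hA bA =
      let h₁ , _ = ∧-split ((S ⊑ᵇ A) ∧ (∣ A ∣ ≡ᵇ k)) hA
          S⊑A , ∣A∣ = ∧-split (S ⊑ᵇ A) h₁
          I⊑A , _ = ∧-split (I ⊑ᵇ A) bA
      in ⊥-elim (<⇒≱ (n<1+n 0) (linear (R ∷ S ∷ A ∷ []) (k ∷ []) (λ r s a k → (lit 1 ⊕ k ≼ # r) ∷ (# (s ⊓ˢ -ˢ a) ≼ lit 0) ∷ (# ((r ⊓ˢ -ˢ s) ⊓ˢ -ˢ a) ≼ lit 0) ∷ (# a ≼ k) ∷ [] ⊢ lit 1 ≼ lit 0)
        (≥-reflexive ∣R∣ , ⊑ᵇ⇒⊑ S A S⊑A , ⊑ᵇ⇒⊑ I A I⊑A , ≤-reflexive (≡ᵇ⇒≡ (∣ A ∣) k ∣A∣) , tt)))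

  -- Passage to a maximal pair

  nontrivial⇒missed : ∀ P → NonTrivial t P → ∀ S → ∣ S ∣ ≡ t → Missed P S
  nontrivial⇒missed P nt S ∣S∣ with cover? P S
  ... | inj₂ m   = m
  -- A t-set that meets a member in t elements is contained in it, so a cover `S` would lie in the
  -- intersection of the whole family.
  ... | inj₁ cov = ⊥-elim (<⇒≱ nt (linear (S ∷ ⋂ (members P) ∷ []) (t ∷ []) (λ s m t → (t ≼ # s) ∷ (# (s ⊓ˢ -ˢ m) ≼ lit 0) ∷ [] ⊢ t ≼ # m)
      (≥-reflexive ∣S∣ , ⊑⋂ S (members P) (All.map (λ {A} PA → linear (S ∷ A ∷ []) (t ∷ []) (λ s a t → (# s ≼ t) ∷ (t ≼ # (s ⊓ˢ a)) ∷ [] ⊢ # (s ⊓ˢ -ˢ a) ≼ lit 0) (≤-reflexive ∣S∣ , cov A PA , tt))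
        (All.all-filter (λ A → T? (P A)) (allSubsets n))) , tt)))

  saturate : Family n → Family n
  saturate Q A = isK k A ∧ ⌊ Cover? Q A ⌋

  saturate-uniform : ∀ Q → Uniform (saturate Q)
  saturate-uniform Q A h = ≡ᵇ⇒≡ (∣ A ∣) k (proj₁ (∧-split (isK k A) h))

  saturate-cover : ∀ Q A → T (saturate Q A) → Cover Q A
  saturate-cover Q A h = toWitness {a? = Cover? Q A} (∧-right (isK k A) h)

  saturate-intro : ∀ Q A → ∣ A ∣ ≡ k → Cover Q A → T (saturate Q A)
  saturate-intro Q A ∣A∣ cov = ∧-intro (≡⇒≡ᵇ (∣ A ∣) k ∣A∣) (fromWitness {a? = Cover? Q A} cov)

  Missed-mono : ∀ {P P′} → P ⊆ᶠ P′ → ∀ {S} → Missed P S → Missed P′ S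
  Missed-mono P⊆P′ (A , PA , lt) = A , P⊆P′ A PA , lt

  module Saturation {F G : Family n} (uniF : Uniform F) (uniG : Uniform G) (cross : CrossIntersecting t F G)
    (ntF : NonTrivial t F) (ntG : NonTrivial t G) where

    -- One round suffices: `Ĝ` consists of all k-covers of `F̂`, and a k-cover of `Ĝ` also covers
    -- the subfamily `G`, hence belongs to `F̂`.
    F̂ Ĝ : Family n
    F̂ = saturate G
    Ĝ = saturate F̂

    F⊆F̂ : F ⊆ᶠ F̂
    F⊆F̂ A FA = saturate-intro G A (uniF A FA) λ B GB → cross A B FA GB

    G⊆Ĝ : G ⊆ᶠ Ĝ
    G⊆Ĝ B GB = saturate-intro F̂ B (uniG B GB) λ A F̂A → subst (t ≤_) (cong ∣_∣ (∩-comm A B)) (saturate-cover G A F̂A B GB)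

    saturated : Pair F̂ Ĝ
    saturated = record
      { uniformˡ = saturate-uniform G
      ; uniformʳ = saturate-uniform F̂
      ; cross = λ A B F̂A ĜB → subst (t ≤_) (cong ∣_∣ (∩-comm B A)) (saturate-cover F̂ B ĜB A F̂A)
      ; missedˡ = λ S ∣S∣ → Missed-mono F⊆F̂ {S} (nontrivial⇒missed F ntF S ∣S∣)
      ; missedʳ = λ S ∣S∣ → Missed-mono G⊆Ĝ {S} (nontrivial⇒missed G ntG S ∣S∣)
      ; covers = cover-meets
      }
      where
      -- X extends to a k-set avoiding Y ∖ X, and that set belongs to F̂.
      cover-meets : ∀ X Y → ∣ X ∣ ≡ suc t → ∣ Y ∣ ≡ suc t → Cover Ĝ X → Cover F̂ Y → t ≤ ∣ X ∩ Y ∣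
      cover-meets X Y ∣X∣ ∣Y∣ covX covY =
        let M , ∣M∣ , M⊑ = a-subset c (∁ (X ∪ Y)) room
            X⊑ = linear (X ∷ M ∷ []) [] (λ x m → [] ⊢ # (x ⊓ˢ -ˢ (x ⊔ˢ m)) ≼ lit 0) tt
            F̂A = saturate-intro G (X ∪ M)
              (≤-antisym
                (linear (X ∷ M ∷ []) (t ∷ c ∷ []) (λ x m t c → (# x ≼ lit 1 ⊕ t) ∷ (# m ≼ c) ∷ [] ⊢ # (x ⊔ˢ m) ≼ lit 1 ⊕ t ⊕ c) (≤-reflexive ∣X∣ , ≤-reflexive ∣M∣ , tt))
                (linear (X ∷ Y ∷ M ∷ []) (t ∷ c ∷ []) (λ x y m t c → (lit 1 ⊕ t ≼ # x) ∷ (c ≼ # m) ∷ (# (m ⊓ˢ -ˢ -ˢ (x ⊔ˢ y)) ≼ lit 0) ∷ [] ⊢ lit 1 ⊕ t ⊕ c ≼ # (x ⊔ˢ m)) (≥-reflexive ∣X∣ , ≥-reflexive ∣M∣ , M⊑ , tt)))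
              (cover-mono {G} {X} {X ∪ M} X⊑ (λ B GB → covX B (G⊆Ĝ B GB)))
        in linear (X ∷ Y ∷ M ∷ []) (t ∷ []) (λ x y m t → (t ≼ # (y ⊓ˢ (x ⊔ˢ m))) ∷ (# (m ⊓ˢ -ˢ -ˢ (x ⊔ˢ y)) ≼ lit 0) ∷ [] ⊢ t ≼ # (x ⊓ˢ y)) (covY (X ∪ M) F̂A , M⊑ , tt)
        where
        room : c ≤ ∣ ∁ (X ∪ Y) ∣
        room = linear (X ∷ Y ∷ ⊤ ∷ []) (t ∷ c ∷ κ ∷ n ∷ [])
          (λ x y o t c κ n → (# x ≼ lit 1 ⊕ t) ∷ (# y ≼ lit 1 ⊕ t) ∷ (n ≼ # o) ∷ (3 · κ ⊕ (lit 1 ⊕ t ⊕ c) ≼ n) ∷ (lit 1 ⊕ t ⊕ c ≼ κ) ∷ [] ⊢ c ≼ # (-ˢ (x ⊔ˢ y)))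
          (≤-reflexive ∣X∣ , ≤-reflexive ∣Y∣ , ≥-reflexive (∣⊤∣≡n n) , 3κ+k≤n , k≤κ , tt)

theorem1p3 : (n k t : ℕ) → 0 < t → t < k → k < n →
    4 * ((t + 2) ^ 2) * (k ^ 2) ≤ n → 5 ≤ k →
    (F G : Family n) → IsKUniform k F → IsKUniform k G →
    NonTrivialCrossIntersecting t F G →
    card F * card G ≤ (card (AFam n k t) ^ 2) ⊔ (card (HFam n k t) ^ 2)
theorem1p3 n k t t>0 t<k k<n n≥ k≥5 F G uniF uniG (cross , ntF , ntG) with m≤n⇒∃[o]m+o≡n t<k
... | c , refl = begin
  card F * card G        ≡⟨ cong₂ _*_ (card≡size F) (card≡size G) ⟩
  size F * size G        ≤⟨ *-mono-≤ (size-mono F⊆F̂) (size-mono G⊆Ĝ) ⟩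
  size F̂ * size Ĝ        ≤⟨ product-bound saturated ⟩
  α₀ ^ 2 ⊔ η₀ ^ 2        ≤⟨ ⊔-mono-≤ (^-monoˡ-≤ 2 α₀≤card) (^-monoˡ-≤ 2 η₀≤card) ⟩
  card (AFam n (suc t + c) t) ^ 2 ⊔ card (HFam n (suc t + c) t) ^ 2 ∎
  where
  open ≤-Reasoning
  regroup : ∀ a b → 4 * (a * a * (b * b)) ≡ 4 * (a * (a * 1)) * (b * (b * 1))
  regroup = solve-∀
  open Extremal n t c t>0 k≥5 (≤-trans (≤-reflexive (regroup (t + 2) (suc t + c))) n≥)
  open Saturation uniF uniG cross ntF ntG
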